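{- Let $\mathbb{F}_q$ be a finite field of characteristic $p$ and $n$ a positive integer. (1) If $n$ is odd and $q\geq 8$, then \[ \mathrm{CN}_q(n)\geq q^n\left(\frac{2}{q+1}-\frac{1.45\cdot n}{q^2(q+1)}\right). \] (2) If $n$ is even, $q\geq 9$ and $q-1\nmid n$, then \[ \mathrm{CN}_q(n)\geq q^n\left(\frac12+\frac{1}{q+1}-\frac{0.86\cdot n}{q^2}\right). \]
   Context: For a divisor $l$ of $n$, $x\in\mathbb{F}_{q^n}$ is normal over $\mathbb{F}_{q^l}$ if $\{x, x^{q^l},\ldots,x^{q^{l(n/l-1)}}\}$ is an $\mathbb{F}_{q^l}$-basis of $\mathbb{F}_{q^n}$; $x$ is completely normal over $\mathbb{F}_q$ if it is normal over $\mathbb{F}_{q^l}$ for every positive divisor $l$ of $n$. $\mathrm{CN}_q(n)$ denotes the number of elements of $\mathbb{F}_{q^n}$ that are completely normal over $\mathbb{F}_q$. -}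

module Defs where

open import Level using (Level; _⊔_)
open import Data.Nat using (ℕ; zero; suc)
import Data.Nat as ℕ
open import Data.Fin using (Fin)
import Data.Fin as F
open import Data.List using (List; length)
open import Data.List.Relation.Unary.All using (All)
open import Data.Product using (Σ; ∃; _×_; _,_)
open import Relation.Nullary using (¬_)
open import Relation.Binary.PropositionalEquality using (_≡_)
open import Algebra.Bundles using (CommutativeRing)
import Data.List.Relation.Unary.Unique.Setoid as USet
import Data.List.Membership.Setoid as MSet

module _ {c ℓ : Level} (R : CommutativeRing c ℓ) where
  open CommutativeRing R

  record IsFieldCR : Set (c ⊔ ℓ) where
    field
      nontrivial : ¬ (1# ≈ 0#)
      inverse    : ∀ x → ¬ (x ≈ 0#) → ∃ λ y → x * y ≈ 1#

  record IsSubfield {p : Level} (K : Carrier → Set p) : Set (c ⊔ ℓ ⊔ p) where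
    field
      resp  : ∀ {x y} → x ≈ y → K x → K y
      has0  : K 0#
      has1  : K 1#
      +-cl  : ∀ {x y} → K x → K y → K (x + y)
      neg-cl : ∀ {x} → K x → K (- x)
      *-cl  : ∀ {x y} → K x → K y → K (x * y)
      inv-cl : ∀ {x} → K x → ¬ (x ≈ 0#) → ∃ λ y → K y × (x * y ≈ 1#)

  HasSize : {p : Level} → (Carrier → Set p) → ℕ → Set (c ⊔ ℓ ⊔ p)
  HasSize P m = Σ (List Carrier) λ xs →
      length xs ≡ m
    × USet.Unique setoid xs
    × All P xs
    × (∀ x → P x → MSet._∈_ setoid x xs)

  pow : Carrier → ℕ → Carrier
  pow x zero    = 1#
  pow x (suc k) = x * pow x k

  sumFin : (m : ℕ) → (Fin m → Carrier) → Carrier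
  sumFin zero    f = 0#
  sumFin (suc m) f = f F.zero + sumFin m (λ i → f (F.suc i))

  -- the subfield F_{q^l} of a field of size q^n, l ∣ n: {y | y^{q^l} = y}
  Sub : ℕ → ℕ → Carrier → Set ℓ
  Sub q l y = pow y (q ℕ.^ l) ≈ y

  IsBasisOver : {p : Level} → (Carrier → Set p) → (m : ℕ) → (Fin m → Carrier) → Set (c ⊔ ℓ ⊔ p)
  IsBasisOver K m v =
      (∀ (a : Fin m → Carrier) → (∀ i → K (a i)) →
          sumFin m (λ i → a i * v i) ≈ 0# → ∀ i → a i ≈ 0#)
    × (∀ y → Σ (Fin m → Carrier) λ a → (∀ i → K (a i)) × (sumFin m (λ i → a i * v i) ≈ y))

  -- x is normal over F_{q^l}, where l * m = n:
  -- {x, x^{q^l}, ..., x^{q^{l(m-1)}}} is an F_{q^l}-basis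
  NormalOver : ℕ → ℕ → ℕ → Carrier → Set (c ⊔ ℓ)
  NormalOver q l m x = IsBasisOver (Sub q l) m (λ i → pow x (q ℕ.^ (l ℕ.* F.toℕ i)))

  CompletelyNormal : ℕ → ℕ → Carrier → Set (c ⊔ ℓ)
  CompletelyNormal q n x = ∀ l m → l ℕ.* m ≡ n → NormalOver q l m x

{-# OPTIONS --safe #-}
module Submission where

-- For l m = n put Q = q ^ l and let the polynomials over F_Q = Sub q l act on the big field through
-- σ : x ↦ x ^ Q.  An element is not normal over F_Q exactly if it is killed by (Xᵐ − 1)/P for some
-- irreducible factor P of Xᵐ − 1, and this kernel has at most Q ^ (m − deg P) elements because the
-- operator is a polynomial function of degree Q ^ (m − deg P).  For l ≥ 2 the union bound over the at
-- most m factors leaves at most m q ^ (n − l) bad elements.  For l = 1 the conditions for distinct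
-- factors are independent: the g ≤ gcd (n, q − 1) linear factors leave a proportion of at least
-- (1 − 1/q) ^ g, and each of the at most n/2 other factors removes at most a proportion 1/q² of what
-- is left, so (1 − 1/q) ^ g (1 − n/(2q²)) remains.  Finally g ≤ q − 1 gives (1 − 1/q) ^ g ≥ 2/(q + 1),
-- and g ≤ (q − 1)/2 (when q − 1 ∤ n) gives (1 − 1/q) ^ g ≥ 1/2 + 1/(q + 1).

-- Independence for l = 1 rests on coprimality, yet the factors of Xⁿ - 1 repeat when the
-- characteristic divides n. So one linear factor per root is sieved, equal roots giving equal
-- cofactors, while every non-linear factor is compared with the survivors of the linear sieve
-- alone: there the losses are merely added, and repetitions do no harm. Bernoulli's inequality
-- applied once to the exponent q - 1 would give only 1/q. Applied to the two halves of the exponent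
-- it gives about 1/4, and about 9/16 for the exponent (q - 1)/2; the rounding terms are kept
-- because the second estimate is tight near q = 9. Origin of the constants: all l ≥ 3 together cost
-- at most n/(3q²(q - 1)) of the field. For odd n, 1.45 = 1 + 0.45, where 1 comes from the sieve
-- loss 2/(q + 1) · n/(2q²) and 0.45 ≥ (q + 1)/(3(q - 1)) for q ≥ 8. For even n and q ≥ 9, in units
-- of n/q², the sieve costs at most 0.3, l = 2 costs 0.5 and l ≥ 3 at most 0.045, which 0.86 covers.

open import Defs
open import Level using (Level; _⊔_)
open import Algebra.Bundles using (CommutativeRing)
import Algebra.Properties.Ring
import Algebra.Properties.Semiring.Mult
import Algebra.Solver.Ring
open import Algebra.Solver.Ring.AlmostCommutativeRing using (AlmostCommutativeRing; fromCommutativeRing; _-Raw-AlmostCommutative⟶_)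
open import Data.Empty using (⊥)
open import Data.Fin as Fin using (Fin; toℕ)
open import Data.Integer as ℤ using (ℤ; -[1+_]; _⊖_) renaming (+_ to pos)
import Data.Integer.Properties as ℤₚ
open import Data.List using (List; []; _∷_; length; map; filter; concat; tabulate; cartesianProductWith; _++_)
open import Data.List.Properties using (length-map; length-++; map-∘; filter-accept; filter-reject)
import Data.List.Membership.Setoid
import Data.List.Membership.Setoid.Properties as ∈ₚ
open import Data.List.Relation.Unary.All as All using (All; []; _∷_)
import Data.List.Relation.Unary.All.Properties as Allₚ
open import Data.List.Relation.Unary.AllPairs as AllPairs using (AllPairs; []; _∷_)
import Data.List.Relation.Unary.AllPairs.Properties as AllPairsₚ
open import Data.List.Relation.Unary.Any as Any using (Any; here; there)
import Data.List.Relation.Unary.Any.Properties as Anyₚ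
import Data.List.Relation.Unary.Unique.Setoid
open import Data.Maybe using (Maybe; just; nothing)
open import Data.Nat as ℕ using (ℕ; zero; suc; _∸_; _^_; _≤_; _<_; z≤n; s≤s)
import Data.Nat.Divisibility as ℕ∣
open import Data.Nat.GCD using (module Bézout; gcd-GCD; gcd[m,n]≡0⇒m≡0; gcd[m,n]∣m; gcd[m,n]∣n) renaming (gcd to ℕ-gcd)
open import Data.Nat.ListAction using (sum)
import Data.Nat.Properties as ℕₚ
open import Data.Nat.Tactic.RingSolver using (solve-∀)
open import Data.Product using (Σ; ∃; ∃₂; _×_; _,_; proj₁; proj₂)
open import Data.Sum using (_⊎_; inj₁; inj₂)
open import Data.Unit using (⊤; tt)
open import Relation.Binary.Bundles using (Setoid)
open import Relation.Binary.Definitions using (Decidable; Tri; tri<; tri≈; tri>)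
open import Relation.Binary.PropositionalEquality as ≡ using (_≡_)
import Relation.Binary.Reasoning.Setoid
open import Relation.Nullary using (¬_; Dec; yes; no; contradiction; ¬?)
open import Relation.Nullary.Decidable using (decidable-stable)
import Relation.Unary as U

-- Ring solver with integer coefficients

module IntegerCoefficients {c ℓ : Level} (R : CommutativeRing c ℓ) where
  open CommutativeRing R
  open Algebra.Properties.Ring ring
  open Algebra.Properties.Semiring.Mult semiring using (×-homo-+; ×1-homo-*) renaming (_×_ to _×ℕ_)
  open Relation.Binary.Reasoning.Setoid setoid

  private
    nat : ℕ → Carrier
    nat n = n ×ℕ 1#

  fromℤ : ℤ → Carrier
  fromℤ (pos n)    = nat n
  fromℤ -[1+ n ] = - nat (suc n)

  private
    cancel-1 : ∀ a b → a - b ≈ (1# + a) - (1# + b)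
    cancel-1 a b = sym (begin
      (1# + a) - (1# + b)       ≈⟨ +-congˡ (sym (-‿+-comm 1# b)) ⟩
      (1# + a) + (- 1# + - b)   ≈⟨ +-congʳ (+-comm 1# a) ⟩
      (a + 1#) + (- 1# + - b)   ≈⟨ +-assoc a 1# _ ⟩
      a + (1# + (- 1# + - b))   ≈⟨ +-congˡ (sym (+-assoc 1# _ _)) ⟩
      a + ((1# - 1#) + - b)     ≈⟨ +-congˡ (+-congʳ (-‿inverseʳ 1#)) ⟩
      a + (0# + - b)            ≈⟨ +-congˡ (+-identityˡ _) ⟩
      a - b ∎)

    fromℤ-⊖ : ∀ m n → fromℤ (m ⊖ n) ≈ nat m - nat n
    fromℤ-⊖ zero    zero    = sym (-‿inverseʳ 0#)
    fromℤ-⊖ (suc m) zero    = sym (trans (+-congˡ -0#≈0#) (+-identityʳ _))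
    fromℤ-⊖ zero    (suc n) = sym (+-identityˡ _)
    fromℤ-⊖ (suc m) (suc n) = begin
      fromℤ (suc m ⊖ suc n)    ≡⟨ ≡.cong fromℤ (ℤₚ.[1+m]⊖[1+n]≡m⊖n m n) ⟩
      fromℤ (m ⊖ n)            ≈⟨ fromℤ-⊖ m n ⟩
      nat m - nat n            ≈⟨ cancel-1 _ _ ⟩
      nat (suc m) - nat (suc n) ∎

    fromℤ-+ : ∀ i j → fromℤ (i ℤ.+ j) ≈ fromℤ i + fromℤ j
    fromℤ-+ (pos m)    (pos n)    = ×-homo-+ 1# m n
    fromℤ-+ (pos m)    -[1+ n ] = fromℤ-⊖ m (suc n)
    fromℤ-+ -[1+ m ] (pos n)    = trans (fromℤ-⊖ n (suc m)) (+-comm _ _)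
    fromℤ-+ -[1+ m ] -[1+ n ] = begin
      - nat (suc (suc (m ℕ.+ n)))      ≡⟨ ≡.cong (λ k → - nat (suc k)) (ℕₚ.+-suc m n) ⟨
      - nat (suc m ℕ.+ suc n)          ≈⟨ -‿cong (×-homo-+ 1# (suc m) (suc n)) ⟩
      - (nat (suc m) + nat (suc n))    ≈⟨ -‿+-comm _ _ ⟨
      - nat (suc m) + - nat (suc n)    ∎

    fromℤ-neg : ∀ i → fromℤ (ℤ.- i) ≈ - fromℤ i
    fromℤ-neg (pos zero)  = sym -0#≈0#
    fromℤ-neg (pos (suc n)) = refl
    fromℤ-neg -[1+ n ]  = sym (-‿involutive _)

    fromℤ-pos* : ∀ m j → fromℤ (pos m ℤ.* j) ≈ nat m * fromℤ j
    fromℤ-pos* m (pos n) = begin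
      fromℤ (pos m ℤ.* pos n)  ≡⟨ ≡.cong fromℤ (ℤₚ.pos-* m n) ⟨
      nat (m ℕ.* n)        ≈⟨ ×1-homo-* m n ⟩
      nat m * nat n        ∎
    fromℤ-pos* m -[1+ n ] = begin
      fromℤ (pos m ℤ.* -[1+ n ])       ≡⟨ ≡.cong fromℤ (ℤₚ.neg-distribʳ-* (pos m) (pos (suc n))) ⟨
      fromℤ (ℤ.- (pos m ℤ.* pos (suc n)))  ≈⟨ fromℤ-neg (pos m ℤ.* pos (suc n)) ⟩
      - fromℤ (pos m ℤ.* pos (suc n))      ≈⟨ -‿cong (fromℤ-pos* m (pos (suc n))) ⟩
      - (nat m * nat (suc n))        ≈⟨ -‿distribʳ-* _ _ ⟩
      nat m * - nat (suc n)          ∎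

    fromℤ-* : ∀ i j → fromℤ (i ℤ.* j) ≈ fromℤ i * fromℤ j
    fromℤ-* (pos m)    j = fromℤ-pos* m j
    fromℤ-* -[1+ m ] j = begin
      fromℤ (-[1+ m ] ℤ.* j)        ≡⟨ ≡.cong fromℤ (ℤₚ.neg-distribˡ-* (pos (suc m)) j) ⟨
      fromℤ (ℤ.- (pos (suc m) ℤ.* j))   ≈⟨ fromℤ-neg (pos (suc m) ℤ.* j) ⟩
      - fromℤ (pos (suc m) ℤ.* j)       ≈⟨ -‿cong (fromℤ-pos* (suc m) j) ⟩
      - (nat (suc m) * fromℤ j)     ≈⟨ -‿distribˡ-* _ _ ⟩
      - nat (suc m) * fromℤ j       ∎

    acr : AlmostCommutativeRing c ℓ
    acr = fromCommutativeRing R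

    morphism : CommutativeRing.rawRing ℤₚ.+-*-commutativeRing -Raw-AlmostCommutative⟶ acr
    morphism = record
      { ⟦_⟧    = fromℤ
      ; +-homo = fromℤ-+
      ; *-homo = fromℤ-*
      ; -‿homo = fromℤ-neg
      ; 0-homo = refl
      ; 1-homo = +-identityʳ 1#
      }

    coeff≟ : ∀ i j → Maybe (fromℤ i ≈ fromℤ j)
    coeff≟ i j with i ℤ.≟ j
    ... | yes ≡.refl = just refl
    ... | no _       = nothing

  open Algebra.Solver.Ring (CommutativeRing.rawRing ℤₚ.+-*-commutativeRing) acr morphism coeff≟ public
    using (solve; _:=_; _:+_; _:*_; _:-_; :-_; con)

-- Lengths of products and partitions of lists

length-cartesianProductWith : {a b c : Level} {A : Set a} {B : Set b} {C : Set c} (f : A → B → C) (xs : List A) (ys : List B) →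
  length (cartesianProductWith f xs ys) ≡ length xs ℕ.* length ys
length-cartesianProductWith f []       ys = ≡.refl
length-cartesianProductWith f (x ∷ xs) ys = ≡.trans (length-++ (map (f x) ys))
  (≡.cong₂ ℕ._+_ (length-map (f x) ys) (length-cartesianProductWith f xs ys))

length-filter-split : {a p : Level} {A : Set a} {P Q : A → Set p} (P? : U.Decidable P) (Q? : U.Decidable Q) →
  (∀ {x} → ¬ P x → Q x) → (∀ {x} → P x → ¬ Q x) → (xs : List A) →
  length xs ≡ length (filter P? xs) ℕ.+ length (filter Q? xs)
length-filter-split P? Q? f g [] = ≡.refl
length-filter-split P? Q? f g (x ∷ xs) with P? x
... | yes px rewrite filter-reject Q? {xs = xs} (g px) = ≡.cong suc (length-filter-split P? Q? f g xs)
... | no ¬px rewrite filter-accept Q? {xs = xs} (f ¬px) =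
  ≡.trans (≡.cong suc (length-filter-split P? Q? f g xs)) (≡.sym (ℕₚ.+-suc (length (filter P? xs)) _))

-- Counting in finite setoids

module Counting {c ℓ : Level} (S : Setoid c ℓ) (_≟_ : Decidable (Setoid._≈_ S)) where
  open Setoid S
  open Data.List.Relation.Unary.Unique.Setoid S using (Unique)
  open Data.List.Membership.Setoid S

  private
    delete : ∀ {x ys} → x ∈ ys → ∃ λ zs → (length ys ≡ suc (length zs)) × (∀ {y} → y ∈ ys → ¬ (x ≈ y) → y ∈ zs)
    delete {x} {y ∷ ys} (here x≈y) = ys , ≡.refl ,
      λ { (here z≈y) x≉z → contradiction (trans x≈y (sym z≈y)) x≉z ; (there z∈) _ → z∈ }
    delete {x} {y ∷ ys} (there x∈) with delete x∈
    ... | zs , eq , f = y ∷ zs , ≡.cong suc eq ,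
      λ { (here z≈y) _ → here z≈y ; (there z∈) x≉z → there (f z∈ x≉z) }

  Unique-⊆⇒length≤ : ∀ {xs ys} → Unique xs → (∀ {x} → x ∈ xs → x ∈ ys) → length xs ≤ length ys
  Unique-⊆⇒length≤ [] sub = z≤n
  Unique-⊆⇒length≤ {x ∷ xs} {ys} (x∉ ∷ xs!) sub with delete (sub (here refl))
  ... | zs , eq , f rewrite eq = s≤s (Unique-⊆⇒length≤ xs!
    λ {y} y∈ → f (sub (there y∈)) λ x≈y → Allₚ.All¬⇒¬Any x∉ (Any.map (trans x≈y) y∈))

  _∈?_ : ∀ x xs → Dec (x ∈ xs)
  x ∈? xs = Any.any? (x ≟_) xs

  -- A missed element of `ys` could be prepended to `xs`, and the longer list would violate the
  -- pigeonhole principle. In this form a count of linear combinations shows that they span.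
  Unique-⊆-length≥⇒⊇ : ∀ {xs ys} → Unique xs → (∀ {x} → x ∈ xs → x ∈ ys) → length ys ≤ length xs →
    ∀ {y} → y ∈ ys → y ∈ xs
  Unique-⊆-length≥⇒⊇ {xs} {ys} xs! sub le {y} y∈ys with y ∈? xs
  ... | yes y∈ = y∈
  ... | no y∉  = contradiction
    (ℕₚ.≤-trans (Unique-⊆⇒length≤ {y ∷ xs} (Allₚ.¬Any⇒All¬ xs y∉ ∷ xs!)
       λ { (here z≈y) → ∈ₚ.∈-resp-≈ S (sym z≈y) y∈ys ; (there z∈) → sub z∈ }) le)
    ℕₚ.1+n≰n

  -- `out` separates different rows and `inn` the entries of one row. The relations are left
  -- abstract because rows are told apart by more than inequality: by distinct images under an
  -- operator, or by distinct coefficients known to lie in a subfield.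
  Unique-cartesianProductWith : {a b p r : Level} {A : Set a} {B : Set b} {P : B → Set p} {R : A → A → Set r} {T : B → B → Set r}
    (f : A → B → Carrier) →
    (∀ {x x′ y y′} → R x x′ → P y → P y′ → ¬ (f x y ≈ f x′ y′)) →
    (∀ {x y y′} → P y → P y′ → T y y′ → ¬ (f x y ≈ f x y′)) →
    ∀ {xs ys} → AllPairs R xs → AllPairs T ys → All P ys → Unique (cartesianProductWith f xs ys)
  Unique-cartesianProductWith {P = P} {R = R} {T = T} f out inn {[]} [] T-ys P-ys = []
  Unique-cartesianProductWith {P = P} {R = R} {T = T} f out inn {x ∷ xs} {ys} (Rx ∷ R-xs) T-ys P-ys =
    AllPairsₚ.++⁺ (AllPairsₚ.map⁺ (row P-ys T-ys))
      (Unique-cartesianProductWith {P = P} f out inn R-xs T-ys P-ys)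
      (Allₚ.map⁺ (All.map (λ Py → block Py Rx) P-ys))
    where
    row : ∀ {zs} → All P zs → AllPairs T zs → AllPairs (λ y y′ → ¬ (f x y ≈ f x y′)) zs
    row [] [] = []
    row (Py ∷ Pzs) (Ty ∷ Tzs) = All.zipWith (λ (Pz , Tz) → inn Py Pz Tz) (Pzs , Ty) ∷ row Pzs Tzs
    block : ∀ {y ws} → P y → All (R x) ws → All (λ z → ¬ (f x y ≈ z)) (cartesianProductWith f ws ys)
    block Py [] = []
    block Py (Rw ∷ Rws) = Allₚ.++⁺ (Allₚ.map⁺ (All.map (out Rw Py) P-ys)) (block Py Rws)

  -- Serves twice: for coset representatives of a kernel, with an operator as `key`, and for
  -- choosing one linear factor per root.
  distinct-representatives : {a : Level} {A : Set a} (key : A → Carrier) (xs : List A) → ∃ λ ws →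
    AllPairs (λ v w → ¬ (key v ≈ key w)) ws × All (λ x → Any (λ w → key x ≈ key w) ws) xs
  distinct-representatives key [] = [] , [] , []
  distinct-representatives key (x ∷ xs) with distinct-representatives key xs
  ... | ws , ws! , cover with Any.any? (λ w → key x ≟ key w) ws
  ...   | yes x∈ = ws , ws! , x∈ ∷ cover
  ...   | no x∉  = x ∷ ws , Allₚ.¬Any⇒All¬ ws x∉ ∷ ws! , here refl ∷ All.map there cover

-- Powers, polynomial functions and the Frobenius map

module Powers {c ℓ : Level} (R : CommutativeRing c ℓ) where
  open CommutativeRing R hiding (zero)
  open IntegerCoefficients R
  open Relation.Binary.Reasoning.Setoid setoid

  x≈y⇒x-y≈0 : ∀ {x y} → x ≈ y → x - y ≈ 0#
  x≈y⇒x-y≈0 {x} {y} x≈y = trans (+-congʳ x≈y) (-‿inverseʳ y)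

  x-y≈0⇒x≈y : ∀ {x y} → x - y ≈ 0# → x ≈ y
  x-y≈0⇒x≈y {x} {y} eq = trans (solve 2 (λ x y → x := (x :- y) :+ y) refl x y) (trans (+-congʳ eq) (+-identityˡ y))

  infixr 8 _↑_
  _↑_ : Carrier → ℕ → Carrier
  x ↑ k = pow R x k

  ↑-cong : ∀ {x y} k → x ≈ y → x ↑ k ≈ y ↑ k
  ↑-cong zero    eq = refl
  ↑-cong (suc k) eq = *-cong eq (↑-cong k eq)

  ↑-+ : ∀ x a b → x ↑ (a ℕ.+ b) ≈ x ↑ a * x ↑ b
  ↑-+ x zero    b = sym (*-identityˡ _)
  ↑-+ x (suc a) b = trans (*-congˡ (↑-+ x a b)) (sym (*-assoc _ _ _))

  ↑-distrib-* : ∀ x y k → (x * y) ↑ k ≈ x ↑ k * y ↑ k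
  ↑-distrib-* x y zero    = sym (*-identityˡ _)
  ↑-distrib-* x y (suc k) = trans (*-congˡ (↑-distrib-* x y k))
    (solve 4 (λ x y u v → (x :* y) :* (u :* v) := (x :* u) :* (y :* v)) refl x y _ _)

  1↑ : ∀ k → 1# ↑ k ≈ 1#
  1↑ zero    = refl
  1↑ (suc k) = trans (*-identityˡ _) (1↑ k)

  ↑-* : ∀ x a b → x ↑ (a ℕ.* b) ≈ (x ↑ a) ↑ b
  ↑-* x zero    b = sym (1↑ b)
  ↑-* x (suc a) b = trans (↑-+ x b (a ℕ.* b)) (trans (*-congˡ (↑-* x a b)) (sym (↑-distrib-* x (x ↑ a) b)))

  0↑ : ∀ {k} → 1 ≤ k → 0# ↑ k ≈ 0#
  0↑ (s≤s _) = zeroˡ _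

  private
    ↑-multiple : ∀ x a k → x ↑ a ≈ 1# → x ↑ (k ℕ.* a) ≈ 1#
    ↑-multiple x a k e = trans (reflexive (≡.cong (x ↑_) (ℕₚ.*-comm k a))) (trans (↑-* x a k) (trans (↑-cong k e) (1↑ k)))

    ↑-difference : ∀ x d a {b} → d ℕ.+ a ≡ b → x ↑ a ≈ 1# → x ↑ b ≈ 1# → x ↑ d ≈ 1#
    ↑-difference x d a {b} eq ea eb = begin
      x ↑ d            ≈⟨ *-identityʳ _ ⟨
      x ↑ d * 1#       ≈⟨ *-congˡ ea ⟨
      x ↑ d * x ↑ a    ≈⟨ ↑-+ x d a ⟨
      x ↑ (d ℕ.+ a)    ≡⟨ ≡.cong (x ↑_) eq ⟩
      x ↑ b            ≈⟨ eb ⟩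
      1#               ∎

    -- Over ℕ the Bézout identity reads d + t b = s a, or the same with a and b exchanged; in both
    -- cases x ↑ d is cancelled out of two powers that equal 1.
    ↑-Bézout : ∀ x d a b → Bézout.Identity d a b → x ↑ a ≈ 1# → x ↑ b ≈ 1# → x ↑ d ≈ 1#
    ↑-Bézout x d a b (Bézout.+- s t eq) ea eb = ↑-difference x d (t ℕ.* b) eq (↑-multiple x b t eb) (↑-multiple x a s ea)
    ↑-Bézout x d a b (Bézout.-+ s t eq) ea eb = ↑-difference x d (s ℕ.* a) eq (↑-multiple x a s ea) (↑-multiple x b t eb)

  ↑-gcd : ∀ {x} a b → x ↑ a ≈ 1# → x ↑ b ≈ 1# → x ↑ ℕ-gcd a b ≈ 1#
  ↑-gcd {x} a b = ↑-Bézout x (ℕ-gcd a b) a b (Bézout.identity (gcd-GCD a b))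

  -- The quotient 1 + y + ... is built in Horner form. In the polynomial ring, with y a power of X,
  -- this yields that Xˡ - 1 divides Xⁿ - 1.
  geometric : ∀ y k → ∃ λ d → d * (y - 1#) ≈ y ↑ k - 1#
  geometric y zero    = 0# , trans (zeroˡ _) (sym (-‿inverseʳ 1#))
  geometric y (suc k) with geometric y k
  ... | d , e = y * d + 1# , (begin
    (y * d + 1#) * (y - 1#)              ≈⟨ solve 3 (λ y d s → (y :* d :+ s) :* (y :- s) := y :* (d :* (y :- s)) :+ s :* (y :- s)) refl y d 1# ⟩
    y * (d * (y - 1#)) + 1# * (y - 1#)   ≈⟨ +-cong (*-congˡ e) (*-identityˡ _) ⟩
    y * (y ↑ k - 1#) + (y - 1#)          ≈⟨ solve 3 (λ y z s → y :* (z :- s) :+ (y :- s) := y :* z :+ (y :- y :* s) :- s) refl y (y ↑ k) 1# ⟩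
    y * y ↑ k + (y - y * 1#) - 1#        ≈⟨ +-congʳ (+-congˡ (x≈y⇒x-y≈0 (sym (*-identityʳ y)))) ⟩
    y * y ↑ k + 0# - 1#                  ≈⟨ +-congʳ (+-identityʳ _) ⟩
    y * y ↑ k - 1#                       ∎)

module Field {c ℓ : Level} (R : CommutativeRing c ℓ) (isField : IsFieldCR R)
             (_≟_ : Decidable (CommutativeRing._≈_ R)) where
  open CommutativeRing R hiding (zero)
  open IntegerCoefficients R
  open IsFieldCR isField
  open Powers R
  open Counting setoid _≟_
  open Data.List.Relation.Unary.Unique.Setoid setoid using (Unique)
  open Data.List.Membership.Setoid setoid
  open Relation.Binary.Reasoning.Setoid setoid

  zero-product : ∀ {x y} → x * y ≈ 0# → ¬ (x ≈ 0#) → y ≈ 0#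
  zero-product {x} {y} xy≈0 x≉0 with inverse x x≉0
  ... | w , xw≈1 = begin
    y            ≈⟨ *-identityˡ y ⟨
    1# * y       ≈⟨ *-congʳ xw≈1 ⟨
    x * w * y    ≈⟨ solve 3 (λ x w y → x :* w :* y := w :* (x :* y)) refl x w y ⟩
    w * (x * y)  ≈⟨ *-congˡ xy≈0 ⟩
    w * 0#       ≈⟨ zeroʳ w ⟩
    0#           ∎

  *-cancelˡ : ∀ {x y z} → ¬ (x ≈ 0#) → x * y ≈ x * z → y ≈ z
  *-cancelˡ {x} {y} {z} x≉0 eq = x-y≈0⇒x≈y (zero-product (begin
    x * (y - z)    ≈⟨ solve 3 (λ x y z → x :* (y :- z) := x :* y :- x :* z) refl x y z ⟩
    x * y - x * z  ≈⟨ x≈y⇒x-y≈0 eq ⟩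
    0#             ∎) x≉0)

  -- Lead k a f: f is a polynomial function of formal degree k with (possibly vanishing) leading coefficient a.
  Lead : ℕ → Carrier → (Carrier → Carrier) → Set (c ⊔ ℓ)
  Lead zero    a f = ∀ x → f x ≈ a
  Lead (suc k) a f = ∃₂ λ b g → Lead k a g × (∀ x → f x ≈ b + x * g x)

  Lead-resp : ∀ k {a b f g} → a ≈ b → (∀ x → f x ≈ g x) → Lead k a f → Lead k b g
  Lead-resp zero    a≈b f≈g F = λ x → trans (sym (f≈g x)) (trans (F x) a≈b)
  Lead-resp (suc k) a≈b f≈g (d , h , H , eq) =
    d , h , Lead-resp k a≈b (λ _ → refl) H , λ x → trans (sym (f≈g x)) (eq x)

  Lead-+ : ∀ k {a b f g} → Lead k a f → Lead k b g → Lead k (a + b) (λ x → f x + g x)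
  Lead-+ zero    F G = λ x → +-cong (F x) (G x)
  Lead-+ (suc k) (d , f , F , eqf) (e , g , G , eqg) = d + e , _ , Lead-+ k F G ,
    λ x → trans (+-cong (eqf x) (eqg x))
      (solve 5 (λ d e x f g → (d :+ x :* f) :+ (e :+ x :* g) := (d :+ e) :+ x :* (f :+ g)) refl d e x _ _)

  Lead-scale : ∀ k {a f} r → Lead k a f → Lead k (r * a) (λ x → r * f x)
  Lead-scale zero    r F = λ x → *-congˡ (F x)
  Lead-scale (suc k) r (d , f , F , eqf) = r * d , _ , Lead-scale k r F ,
    λ x → trans (*-congˡ (eqf x)) (solve 4 (λ r d x f → r :* (d :+ x :* f) := r :* d :+ x :* (r :* f)) refl r d x _)

  Lead-suc : ∀ k {a f} → Lead k a f → Lead (suc k) 0# f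
  Lead-suc zero    {a} F = a , (λ _ → 0#) , (λ _ → refl) ,
    λ x → trans (F x) (sym (trans (+-congˡ (zeroʳ x)) (+-identityʳ a)))
  Lead-suc (suc k) (d , g , G , eq) = d , g , Lead-suc k G , eq

  Lead-< : ∀ {j k a f} → j < k → Lead j a f → Lead k 0# f
  Lead-< {j} {suc k} (s≤s j≤k) F with j ℕₚ.≟ k
  ... | yes ≡.refl = Lead-suc j F
  ... | no j≢k     = Lead-suc k (Lead-< (ℕₚ.≤∧≢⇒< j≤k j≢k) F)

  Lead-x* : ∀ k {a f} → Lead k a f → Lead (suc k) a (λ x → x * f x)
  Lead-x* k {f = f} F = 0# , f , F , λ x → sym (+-identityˡ _)

  Lead-↑ : ∀ k → Lead k 1# (_↑ k)
  Lead-↑ zero    = λ _ → refl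
  Lead-↑ (suc k) = Lead-x* k (Lead-↑ k)

  Lead-[x+1]↑ : ∀ k → Lead k 1# (λ x → (x + 1#) ↑ k)
  Lead-[x+1]↑ zero    = λ _ → refl
  Lead-[x+1]↑ (suc k) = Lead-resp (suc k) (+-identityʳ 1#)
    (λ x → trans (+-congˡ (sym (*-identityˡ _))) (sym (distribʳ _ x 1#)))
    (Lead-+ (suc k) (Lead-x* k (Lead-[x+1]↑ k)) (Lead-suc k (Lead-[x+1]↑ k)))

  -- Synthetic division: if f x = d + x g x and g x - g r = (x - r) h x, the quotient for f is g + r
  -- h. The summand r h has lower formal degree, so the leading coefficient is unchanged.
  Lead-quotient : ∀ k {a f} → Lead (suc k) a f → ∀ r → ∃ λ g → Lead k a g × (∀ x → f x - f r ≈ (x - r) * g x)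
  Lead-quotient zero {a} {f} (d , g , G , eq) r = g , G , λ x → begin
    f x - f r                      ≈⟨ +-cong (eq x) (-‿cong (eq r)) ⟩
    d + x * g x - (d + r * g r)    ≈⟨ +-congˡ (-‿cong (+-congˡ (*-congˡ (trans (G r) (sym (G x)))))) ⟩
    d + x * g x - (d + r * g x)    ≈⟨ solve 4 (λ d x r g → d :+ x :* g :- (d :+ r :* g) := (x :- r) :* g) refl d x r (g x) ⟩
    (x - r) * g x                  ∎
  Lead-quotient (suc k) {a} {f} (d , g , G , eq) r with Lead-quotient k G r
  ... | h , H , eqh = _ , Lead-resp (suc k) (trans (+-congˡ (zeroʳ r)) (+-identityʳ a)) (λ _ → refl)
                            (Lead-+ (suc k) G (Lead-scale (suc k) r (Lead-suc k H))) , λ x → begin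
    f x - f r                            ≈⟨ +-cong (eq x) (-‿cong (eq r)) ⟩
    d + x * g x - (d + r * g r)          ≈⟨ solve 5 (λ d x r u v → d :+ x :* u :- (d :+ r :* v) := (x :- r) :* u :+ r :* (u :- v)) refl d x r (g x) (g r) ⟩
    (x - r) * g x + r * (g x - g r)      ≈⟨ +-congˡ (*-congˡ (eqh x)) ⟩
    (x - r) * g x + r * ((x - r) * h x)  ≈⟨ solve 4 (λ s r u v → s :* u :+ r :* (s :* v) := s :* (u :+ r :* v)) refl (x - r) r (g x) (h x) ⟩
    (x - r) * (g x + r * h x)            ∎

  private
    other-roots : (f g : Carrier → Carrier) {r : Carrier} {xs : List Carrier} → f r ≈ 0# → (∀ x → f x - f r ≈ (x - r) * g x) →
      All (λ x → ¬ (r ≈ x)) xs → All (λ x → f x ≈ 0#) xs → All (λ x → g x ≈ 0#) xs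
    other-roots f g {r} fr≈0 eq r∉ roots = All.zipWith (λ {x} (r≉x , fx≈0) → zero-product (begin
      (x - r) * g x  ≈⟨ eq x ⟨
      f x - f r      ≈⟨ +-cong fx≈0 (-‿cong fr≈0) ⟩
      0# - 0#        ≈⟨ -‿inverseʳ 0# ⟩
      0#             ∎) (λ x-r≈0 → r≉x (sym (x-y≈0⇒x≈y x-r≈0)))) (r∉ , roots)

  roots≤degree : ∀ k {a f} → Lead k a f → ¬ (a ≈ 0#) → ∀ {xs} → Unique xs → All (λ x → f x ≈ 0#) xs → length xs ≤ k
  roots≤degree k       F a≉0 [] [] = z≤n
  roots≤degree zero    F a≉0 {x ∷ _} _ (fx≈0 ∷ _) = contradiction (trans (sym (F x)) fx≈0) a≉0
  roots≤degree (suc k) {f = f} F a≉0 {r ∷ _} (r∉ ∷ xs!) (fr≈0 ∷ roots) with Lead-quotient k F r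
  ... | g , G , eq = s≤s (roots≤degree k G a≉0 xs! (other-roots f g fr≈0 eq r∉ roots))

  -- With vanishing leading coefficient the true degree is below k, so k distinct zeros leave only
  -- the zero function: dividing them out one by one ends at the constant `a`.
  vanishes : ∀ k {a f} → Lead k a f → a ≈ 0# → ∀ {xs} → Unique xs → All (λ x → f x ≈ 0#) xs → k ≤ length xs →
    ∀ x → f x ≈ 0#
  vanishes zero    F a≈0 _ _ _ x = trans (F x) a≈0
  vanishes (suc k) {f = f} F a≈0 {r ∷ _} (r∉ ∷ xs!) (fr≈0 ∷ roots) (s≤s le) x with Lead-quotient k F r
  ... | g , G , eq = begin
    f x                    ≈⟨ solve 2 (λ u v → u := (u :- v) :+ v) refl (f x) (f r) ⟩
    f x - f r + f r        ≈⟨ +-cong (eq x) fr≈0 ⟩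
    (x - r) * g x + 0#     ≈⟨ +-identityʳ _ ⟩
    (x - r) * g x          ≈⟨ *-congˡ (vanishes k G a≈0 xs! (other-roots f g fr≈0 eq r∉ roots) le x) ⟩
    (x - r) * 0#           ≈⟨ zeroʳ _ ⟩
    0#                     ∎

  private
    product : List Carrier → Carrier
    product []       = 1#
    product (x ∷ xs) = x * product xs

    factor : ∀ {x ys} → x ∈ ys → ∃ λ zs → (length ys ≡ suc (length zs)) × (product ys ≈ x * product zs)
                                        × (∀ {y} → y ∈ ys → ¬ (x ≈ y) → y ∈ zs)
    factor {x} {y ∷ ys} (here x≈y) = ys , ≡.refl , *-congʳ (sym x≈y) ,
      λ { (here z≈y) x≉z → contradiction (trans x≈y (sym z≈y)) x≉z ; (there z∈) _ → z∈ }
    factor {x} {y ∷ ys} (there x∈) with factor x∈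
    ... | zs , eq , prod , f = y ∷ zs , ≡.cong suc eq ,
      trans (*-congˡ prod) (solve 3 (λ x y p → y :* (x :* p) := x :* (y :* p)) refl x y _) ,
      λ { (here z≈y) _ → here z≈y ; (there z∈) x≉z → there (f z∈ x≉z) }

    product-⊆ : ∀ {xs ys} → Unique xs → (∀ {x} → x ∈ xs → x ∈ ys) → length ys ≡ length xs → product xs ≈ product ys
    product-⊆ {ys = []} [] sub len = refl
    product-⊆ {x ∷ xs} (x∉ ∷ xs!) sub len with factor (sub (here refl))
    ... | zs , eq , prod , f = trans (*-congˡ (product-⊆ xs!
      (λ y∈ → f (sub (there y∈)) λ x≈y → Allₚ.All¬⇒¬Any x∉ (Any.map (trans x≈y) y∈))
      (ℕₚ.suc-injective (≡.trans (≡.sym eq) len)))) (sym prod)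

    product-map : ∀ x xs → product (map (x *_) xs) ≈ x ↑ length xs * product xs
    product-map x []       = sym (*-identityˡ 1#)
    product-map x (y ∷ xs) = trans (*-congˡ (product-map x xs))
      (solve 4 (λ x y u p → (x :* y) :* (u :* p) := (x :* u) :* (y :* p)) refl x y _ _)

    product≉0 : ∀ {xs} → All (λ x → ¬ (x ≈ 0#)) xs → ¬ (product xs ≈ 0#)
    product≉0 [] = nontrivial
    product≉0 (x≉0 ∷ xs≉0) eq = product≉0 xs≉0 (zero-product eq x≉0)

  module FiniteSubfield {p : Level} {K : Carrier → Set p} (isSubfield : IsSubfield R K)
                        {q : ℕ} (size : HasSize R K q) where
    open IsSubfield isSubfield
    private
      xs  = proj₁ size
      len = proj₁ (proj₂ size)
      xs! = proj₁ (proj₂ (proj₂ size))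
      xsK = proj₁ (proj₂ (proj₂ (proj₂ size)))
      all = proj₂ (proj₂ (proj₂ (proj₂ size)))

      nz? : ∀ x → Dec (¬ (x ≈ 0#))
      nz? x = ¬? (x ≟ 0#)
      z? : ∀ x → Dec (x ≈ 0#)
      z? x = x ≟ 0#

      resp-nz : ∀ {x y} → x ≈ y → ¬ (x ≈ 0#) → ¬ (y ≈ 0#)
      resp-nz x≈y x≉0 y≈0 = x≉0 (trans x≈y y≈0)

      ns : List Carrier
      ns = filter nz? xs

      ns! : Unique ns
      ns! = AllPairsₚ.filter⁺ nz? xs!

      q≡ : q ≡ suc (length ns)
      q≡ = ≡.trans (≡.sym len) (≡.trans (length-filter-split z? nz? (λ h → h) (λ h g → g h) xs)
        (≡.cong (ℕ._+ length ns) (ℕₚ.≤-antisym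
          (Unique-⊆⇒length≤ {ys = 0# ∷ []} (AllPairsₚ.filter⁺ z? xs!)
            λ x∈ → here (proj₂ (∈ₚ.∈-filter⁻ setoid z? (λ x≈y x≈0 → trans (sym x≈y) x≈0) {xs = xs} x∈)))
          (Unique-⊆⇒length≤ {0# ∷ []} ([] ∷ [])
            λ { (here x≈0) → ∈ₚ.∈-filter⁺ setoid z? (λ x≈y x≈0 → trans (sym x≈y) x≈0)
                  (∈ₚ.∈-resp-≈ setoid (sym x≈0) (all 0# has0)) x≈0 }))))

    1≤size : 1 ≤ q
    1≤size = ≡.subst (1 ≤_) (≡.sym q≡) (s≤s z≤n)

    -- Multiplication by x ≠ 0 permutes the non-zero elements of `K`, so their product is multiplied
    -- by x ↑ (q - 1) and yet unchanged.
    fermat : ∀ {x} → K x → x ↑ q ≈ x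
    fermat {x} Kx with x ≟ 0#
    ... | yes x≈0 = trans (↑-cong q x≈0) (trans (0↑ 1≤size) (sym x≈0))
    ... | no x≉0 = begin
      x ↑ q                ≡⟨ ≡.cong (x ↑_) q≡ ⟩
      x * x ↑ length ns    ≈⟨ *-congˡ (sym (*-cancelˡ (product≉0 (Allₚ.all-filter nz? xs)) (begin
        product ns * 1#                ≈⟨ *-identityʳ _ ⟩
        product ns                     ≈⟨ product-⊆ shifted! shifted⊆ (≡.sym (length-map (x *_) ns)) ⟨
        product (map (x *_) ns)        ≈⟨ product-map x ns ⟩
        x ↑ length ns * product ns     ≈⟨ *-comm _ _ ⟩
        product ns * x ↑ length ns     ∎))) ⟩
      x * 1#               ≈⟨ *-identityʳ x ⟩
      x                    ∎
      where
      shifted! : Unique (map (x *_) ns)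
      shifted! = AllPairsₚ.map⁺ (AllPairs.map (λ y≉z xy≈xz → y≉z (*-cancelˡ x≉0 xy≈xz)) ns!)
      shifted⊆ : ∀ {y} → y ∈ map (x *_) ns → y ∈ ns
      shifted⊆ {y} y∈ with ∈ₚ.∈-map⁻ setoid setoid y∈
      ... | z , z∈ , y≈xz with ∈ₚ.∈-filter⁻ setoid nz? resp-nz {xs = xs} z∈
      ...   | z∈xs , z≉0 = ∈ₚ.∈-filter⁺ setoid nz? resp-nz
        (all y (resp (sym y≈xz) (*-cl Kx (All.lookupWith (λ Kw z≈w → resp (sym z≈w) Kw) xsK z∈xs))))
        λ y≈0 → z≉0 (zero-product (trans (sym y≈xz) y≈0) x≉0)

    -- (X + 1)^q − X^q − 1 has degree < q but vanishes on the q elements of K.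
    private
      [x+1]↑q : ∀ x → (x + 1#) ↑ q ≈ x ↑ q + 1#
      [x+1]↑q x = begin
        (x + 1#) ↑ q                                                     ≈⟨ solve 3 (λ s t e → s := (s :+ ((:- e) :* t :+ (:- e) :* e)) :+ (e :* t :+ e :* e)) refl ((x + 1#) ↑ q) (x ↑ q) 1# ⟩
        ((x + 1#) ↑ q + (- 1# * x ↑ q + - 1# * 1#)) + (1# * x ↑ q + 1# * 1#)  ≈⟨ +-congʳ (vanishes q difference
            (trans (solve 1 (λ e → e :+ ((:- e) :* e :+ (:- e) :* con (pos 0)) := e :- e :* e) refl 1#) (trans (+-congˡ (-‿cong (*-identityˡ 1#))) (-‿inverseʳ 1#)))
            xs! (All.map on-K xsK) (ℕₚ.≤-reflexive (≡.sym len)) x) ⟩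
        0# + (1# * x ↑ q + 1# * 1#)                                      ≈⟨ +-identityˡ _ ⟩
        1# * x ↑ q + 1# * 1#                                             ≈⟨ +-cong (*-identityˡ _) (*-identityˡ 1#) ⟩
        x ↑ q + 1#                                                       ∎
        where
        difference : Lead q (1# + (- 1# * 1# + - 1# * 0#)) (λ x → (x + 1#) ↑ q + (- 1# * x ↑ q + - 1# * 1#))
        difference = Lead-+ q (Lead-[x+1]↑ q) (Lead-+ q (Lead-scale q (- 1#) (Lead-↑ q))
          (Lead-scale q (- 1#) (Lead-< {f = λ _ → 1#} 1≤size (λ _ → refl))))
        on-K : ∀ {x} → K x → (x + 1#) ↑ q + (- 1# * x ↑ q + - 1# * 1#) ≈ 0#
        on-K {x} Kx = begin
          (x + 1#) ↑ q + (- 1# * x ↑ q + - 1# * 1#)  ≈⟨ +-cong (fermat (+-cl Kx has1)) (+-congʳ (*-congˡ (fermat Kx))) ⟩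
          (x + 1#) + (- 1# * x + - 1# * 1#)          ≈⟨ solve 2 (λ x e → (x :+ e) :+ ((:- e) :* x :+ (:- e) :* e) := (x :- e :* x) :+ (e :- e :* e)) refl x 1# ⟩
          (x - 1# * x) + (1# - 1# * 1#)              ≈⟨ +-cong (+-congˡ (-‿cong (*-identityˡ x))) (+-congˡ (-‿cong (*-identityˡ 1#))) ⟩
          (x - x) + (1# - 1#)                        ≈⟨ +-cong (-‿inverseʳ x) (-‿inverseʳ 1#) ⟩
          0# + 0#                                    ≈⟨ +-identityˡ 0# ⟩
          0#                                         ∎

    -- Homogenisation: for y ≠ 0 write x + y = y (x/y + 1). Counting zeros on `K` has taken the
    -- place of the binomial theorem in characteristic p, and the resulting identity holds on the
    -- whole field.
    frobenius-+ : ∀ x y → (x + y) ↑ q ≈ x ↑ q + y ↑ q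
    frobenius-+ x y with y ≟ 0#
    ... | yes y≈0 = begin
      (x + y) ↑ q      ≈⟨ ↑-cong q (trans (+-congˡ y≈0) (+-identityʳ x)) ⟩
      x ↑ q            ≈⟨ +-identityʳ _ ⟨
      x ↑ q + 0#       ≈⟨ +-congˡ (trans (↑-cong q y≈0) (0↑ 1≤size)) ⟨
      x ↑ q + y ↑ q    ∎
    ... | no y≉0 with inverse y y≉0
    ...   | w , yw≈1 = begin
      (x + y) ↑ q                    ≈⟨ ↑-cong q (+-cong (sym x≈) (sym (*-identityʳ y))) ⟩
      (y * (x * w) + y * 1#) ↑ q     ≈⟨ ↑-cong q (distribˡ y (x * w) 1#) ⟨
      (y * (x * w + 1#)) ↑ q         ≈⟨ ↑-distrib-* y _ q ⟩
      y ↑ q * (x * w + 1#) ↑ q       ≈⟨ *-congˡ ([x+1]↑q (x * w)) ⟩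
      y ↑ q * ((x * w) ↑ q + 1#)     ≈⟨ distribˡ _ _ _ ⟩
      y ↑ q * (x * w) ↑ q + y ↑ q * 1#  ≈⟨ +-cong (sym (↑-distrib-* y (x * w) q)) (*-identityʳ _) ⟩
      (y * (x * w)) ↑ q + y ↑ q      ≈⟨ +-congʳ (↑-cong q x≈) ⟩
      x ↑ q + y ↑ q                  ∎
      where
      x≈ : y * (x * w) ≈ x
      x≈ = trans (solve 3 (λ x y w → y :* (x :* w) := x :* (y :* w)) refl x y w) (trans (*-congˡ yw≈1) (*-identityʳ x))

-- Polynomials over a field

module PolynomialRing {c ℓ : Level} (F : CommutativeRing c ℓ) where
  open CommutativeRing F hiding (zero)
  open IntegerCoefficients F
  open Relation.Binary.Reasoning.Setoid setoid

  -- Coefficient lists, constant term first, with trailing zeros allowed; equality is therefore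
  -- coefficientwise and degree becomes a predicate.
  Poly : Set c
  Poly = List Carrier

  coef : Poly → ℕ → Carrier
  coef []      i       = 0#
  coef (a ∷ p) zero    = a
  coef (a ∷ p) (suc i) = coef p i

  infix 4 _≋_
  record _≋_ (p q : Poly) : Set ℓ where
    constructor coefwise
    field at : ∀ i → coef p i ≈ coef q i
  open _≋_ public

  private
    infixl 6 _⊕_
    infixl 7 _⊗_ _·_

    _⊕_ : Poly → Poly → Poly
    []      ⊕ q       = q
    (a ∷ p) ⊕ []      = a ∷ p
    (a ∷ p) ⊕ (b ∷ q) = (a + b) ∷ (p ⊕ q)

    _·_ : Carrier → Poly → Poly
    r · p = map (r *_) p

    ⊖_ : Poly → Poly
    ⊖ p = map -_ p

    _⊗_ : Poly → Poly → Poly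
    []      ⊗ q = []
    (a ∷ p) ⊗ q = a · q ⊕ (0# ∷ p ⊗ q)

  coef-+ : ∀ p q i → coef (p ⊕ q) i ≈ coef p i + coef q i
  coef-+ []      q       i       = sym (+-identityˡ _)
  coef-+ (a ∷ p) []      i       = sym (+-identityʳ _)
  coef-+ (a ∷ p) (b ∷ q) zero    = refl
  coef-+ (a ∷ p) (b ∷ q) (suc i) = coef-+ p q i

  private
    coef-· : ∀ r p i → coef (r · p) i ≈ r * coef p i
    coef-· r []      i       = sym (zeroʳ r)
    coef-· r (a ∷ p) zero    = refl
    coef-· r (a ∷ p) (suc i) = coef-· r p i

  coef-neg : ∀ p i → coef (⊖ p) i ≈ - coef p i
  coef-neg []      i       = solve 0 (con (pos 0) := :- con (pos 0)) refl
  coef-neg (a ∷ p) zero    = refl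
  coef-neg (a ∷ p) (suc i) = coef-neg p i

  ∷-cong : ∀ {a b p q} → a ≈ b → p ≋ q → (a ∷ p) ≋ (b ∷ q)
  ∷-cong a≈b p≋q .at zero    = a≈b
  ∷-cong a≈b p≋q .at (suc i) = p≋q .at i

  private
    ≋-refl : ∀ {p} → p ≋ p
    ≋-refl .at i = refl

    ≋-sym : ∀ {p q} → p ≋ q → q ≋ p
    ≋-sym e .at i = sym (e .at i)

    ≋-trans : ∀ {p q r} → p ≋ q → q ≋ r → p ≋ r
    ≋-trans e f .at i = trans (e .at i) (f .at i)

    ⊕-cong : ∀ {p p′ q q′} → p ≋ p′ → q ≋ q′ → (p ⊕ q) ≋ (p′ ⊕ q′)
    ⊕-cong {p} {p′} {q} {q′} e f .at i = trans (coef-+ p q i) (trans (+-cong (e .at i) (f .at i)) (sym (coef-+ p′ q′ i)))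

    coef-⊗ : ∀ a p q i → coef ((a ∷ p) ⊗ q) i ≈ a * coef q i + coef (0# ∷ p ⊗ q) i
    coef-⊗ a p q i = trans (coef-+ (a · q) (0# ∷ p ⊗ q) i) (+-congʳ (coef-· a q i))

    ⊗-zeroʳ : ∀ p → (p ⊗ []) ≋ []
    ⊗-zeroʳ []      .at i       = refl
    ⊗-zeroʳ (a ∷ p) .at zero    = refl
    ⊗-zeroʳ (a ∷ p) .at (suc i) = ⊗-zeroʳ p .at i

    ⊗-congˡ : ∀ p {q q′} → q ≋ q′ → (p ⊗ q) ≋ (p ⊗ q′)
    ⊗-congˡ []      e = ≋-refl
    ⊗-congˡ (a ∷ p) {q} {q′} e .at i = trans (coef-⊗ a p q i)
      (trans (+-cong (*-congˡ (e .at i)) (∷-cong {0#} refl (⊗-congˡ p e) .at i)) (sym (coef-⊗ a p q′ i)))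

    -- Multiplication recurses on its left argument; this is the mirror image of that recursion. It
    -- gives commutativity, through which the remaining laws are transported from one side to the
    -- other.
    ⊗-∷ : ∀ p b q → (p ⊗ (b ∷ q)) ≋ (b · p ⊕ (0# ∷ p ⊗ q))
    ⊗-∷ []      b q .at zero    = refl
    ⊗-∷ []      b q .at (suc i) = refl
    ⊗-∷ (a ∷ p) b q .at zero    = +-congʳ (*-comm a b)
    ⊗-∷ (a ∷ p) b q .at (suc i) = begin
      coef (a · q ⊕ p ⊗ (b ∷ q)) i                    ≈⟨ coef-+ (a · q) (p ⊗ (b ∷ q)) i ⟩
      coef (a · q) i + coef (p ⊗ (b ∷ q)) i           ≈⟨ +-congˡ (⊗-∷ p b q .at i) ⟩
      coef (a · q) i + coef (b · p ⊕ (0# ∷ p ⊗ q)) i  ≈⟨ +-congˡ (coef-+ (b · p) (0# ∷ p ⊗ q) i) ⟩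
      coef (a · q) i + (coef (b · p) i + coef (0# ∷ p ⊗ q) i)  ≈⟨ solve 3 (λ x y z → x :+ (y :+ z) := y :+ (x :+ z)) refl (coef (a · q) i) (coef (b · p) i) (coef (0# ∷ p ⊗ q) i) ⟩
      coef (b · p) i + (coef (a · q) i + coef (0# ∷ p ⊗ q) i)  ≈⟨ +-congˡ (coef-+ (a · q) (0# ∷ p ⊗ q) i) ⟨
      coef (b · p) i + coef (a · q ⊕ (0# ∷ p ⊗ q)) i  ≈⟨ coef-+ (b · p) (a · q ⊕ (0# ∷ p ⊗ q)) i ⟨
      coef (b · p ⊕ (a · q ⊕ (0# ∷ p ⊗ q))) i         ∎

    ⊗-comm : ∀ p q → (p ⊗ q) ≋ (q ⊗ p)
    ⊗-comm []      q = ≋-sym (⊗-zeroʳ q)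
    ⊗-comm (a ∷ p) q = ≋-trans (⊕-cong {a · q} ≋-refl (∷-cong refl (⊗-comm p q))) (≋-sym (⊗-∷ q a p))

    ⊗-cong : ∀ {p p′ q q′} → p ≋ p′ → q ≋ q′ → (p ⊗ q) ≋ (p′ ⊗ q′)
    ⊗-cong {p} {p′} {q} {q′} e f =
      ≋-trans (⊗-comm p q) (≋-trans (⊗-congˡ q e) (≋-trans (⊗-comm q p′) (⊗-congˡ p′ f)))

    ⊗-distribˡ : ∀ p q r → (p ⊗ (q ⊕ r)) ≋ (p ⊗ q ⊕ p ⊗ r)
    ⊗-distribˡ []      q r = ≋-refl
    ⊗-distribˡ (a ∷ p) q r .at i = begin
      coef ((a ∷ p) ⊗ (q ⊕ r)) i                               ≈⟨ coef-⊗ a p (q ⊕ r) i ⟩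
      a * coef (q ⊕ r) i + coef (0# ∷ p ⊗ (q ⊕ r)) i           ≈⟨ +-cong (*-congˡ (coef-+ q r i)) (tails i) ⟩
      a * (coef q i + coef r i) + (coef (0# ∷ p ⊗ q) i + coef (0# ∷ p ⊗ r) i)
        ≈⟨ solve 5 (λ a x y u v → a :* (x :+ y) :+ (u :+ v) := (a :* x :+ u) :+ (a :* y :+ v)) refl a (coef q i) (coef r i) (coef (0# ∷ p ⊗ q) i) (coef (0# ∷ p ⊗ r) i) ⟩
      (a * coef q i + coef (0# ∷ p ⊗ q) i) + (a * coef r i + coef (0# ∷ p ⊗ r) i)  ≈⟨ +-cong (coef-⊗ a p q i) (coef-⊗ a p r i) ⟨
      coef ((a ∷ p) ⊗ q) i + coef ((a ∷ p) ⊗ r) i              ≈⟨ coef-+ ((a ∷ p) ⊗ q) ((a ∷ p) ⊗ r) i ⟨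
      coef ((a ∷ p) ⊗ q ⊕ (a ∷ p) ⊗ r) i                       ∎
      where
      tails : ∀ i → coef (0# ∷ p ⊗ (q ⊕ r)) i ≈ coef (0# ∷ p ⊗ q) i + coef (0# ∷ p ⊗ r) i
      tails zero    = sym (+-identityˡ 0#)
      tails (suc i) = trans (⊗-distribˡ p q r .at i) (coef-+ (p ⊗ q) (p ⊗ r) i)

    ⊗-distribʳ : ∀ p q r → ((q ⊕ r) ⊗ p) ≋ (q ⊗ p ⊕ r ⊗ p)
    ⊗-distribʳ p q r = ≋-trans (⊗-comm (q ⊕ r) p) (≋-trans (⊗-distribˡ p q r)
      (⊕-cong {p ⊗ q} {q ⊗ p} (⊗-comm p q) (⊗-comm p r)))

    ·-⊗ : ∀ r p q → ((r · p) ⊗ q) ≋ (r · (p ⊗ q))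
    ·-⊗ r []      q = ≋-refl
    ·-⊗ r (a ∷ p) q .at i = begin
      coef ((r * a ∷ r · p) ⊗ q) i                         ≈⟨ coef-⊗ (r * a) (r · p) q i ⟩
      r * a * coef q i + coef (0# ∷ (r · p) ⊗ q) i         ≈⟨ +-congˡ (tails i) ⟩
      r * a * coef q i + r * coef (0# ∷ p ⊗ q) i           ≈⟨ solve 4 (λ r a x y → r :* a :* x :+ r :* y := r :* (a :* x :+ y)) refl r a (coef q i) (coef (0# ∷ p ⊗ q) i) ⟩
      r * (a * coef q i + coef (0# ∷ p ⊗ q) i)             ≈⟨ *-congˡ (coef-⊗ a p q i) ⟨
      r * coef ((a ∷ p) ⊗ q) i                             ≈⟨ coef-· r ((a ∷ p) ⊗ q) i ⟨
      coef (r · ((a ∷ p) ⊗ q)) i                           ∎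
      where
      tails : ∀ i → coef (0# ∷ (r · p) ⊗ q) i ≈ r * coef (0# ∷ p ⊗ q) i
      tails zero    = sym (zeroʳ r)
      tails (suc i) = trans (·-⊗ r p q .at i) (coef-· r (p ⊗ q) i)

  0∷-* : ∀ p q → ((0# ∷ p) ⊗ q) ≋ (0# ∷ p ⊗ q)
  0∷-* p q .at i = trans (coef-⊗ 0# p q i) (trans (+-congʳ (zeroˡ _)) (+-identityˡ _))

  private
    ⊗-assoc : ∀ p q r → ((p ⊗ q) ⊗ r) ≋ (p ⊗ (q ⊗ r))
    ⊗-assoc []      q r = ≋-refl
    ⊗-assoc (a ∷ p) q r = ≋-trans (⊗-distribʳ r (a · q) (0# ∷ p ⊗ q))
      (⊕-cong {(a · q) ⊗ r} {a · (q ⊗ r)} (·-⊗ a q r) (≋-trans (0∷-* (p ⊗ q) r) (∷-cong refl (⊗-assoc p q r))))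

  const : Carrier → Poly
  const r = r ∷ []

  coef-const* : ∀ r p i → coef (const r ⊗ p) i ≈ r * coef p i
  coef-const* r p zero    = trans (coef-⊗ r [] p zero) (+-identityʳ _)
  coef-const* r p (suc i) = trans (coef-⊗ r [] p (suc i)) (+-identityʳ _)

  coef-∷* : ∀ a p q i → coef ((a ∷ p) ⊗ q) (suc i) ≈ a * coef q (suc i) + coef (p ⊗ q) i
  coef-∷* a p q i = coef-⊗ a p q (suc i)

  polyRing : CommutativeRing c ℓ
  polyRing = record
    { Carrier = Poly
    ; _≈_     = _≋_
    ; _+_     = _⊕_
    ; _*_     = _⊗_
    ; -_      = ⊖_
    ; 0#      = []
    ; 1#      = const 1#
    ; isCommutativeRing = record
      { isRing = record
        { +-isAbelianGroup = record
          { isGroup = record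
            { isMonoid = record
              { isSemigroup = record
                { isMagma = record
                  { isEquivalence = record { refl = ≋-refl ; sym = ≋-sym ; trans = ≋-trans }
                  ; ∙-cong = λ {p} {p′} → ⊕-cong {p} {p′} }
                ; assoc = λ p q r → coefwise λ i → trans (coef-+ (p ⊕ q) r i) (trans (+-congʳ (coef-+ p q i))
                    (trans (+-assoc _ _ _) (sym (trans (coef-+ p (q ⊕ r) i) (+-congˡ (coef-+ q r i)))))) }
              ; identity = (λ p → ≋-refl) , λ p → coefwise λ i → trans (coef-+ p [] i) (+-identityʳ _) }
            ; inverse = (λ p → coefwise λ i → trans (coef-+ (⊖ p) p i) (trans (+-congʳ (coef-neg p i)) (-‿inverseˡ _)))
                      , (λ p → coefwise λ i → trans (coef-+ p (⊖ p) i) (trans (+-congˡ (coef-neg p i)) (-‿inverseʳ _)))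
            ; ⁻¹-cong = λ {p} {q} e → coefwise λ i → trans (coef-neg p i) (trans (-‿cong (e .at i)) (sym (coef-neg q i))) }
          ; comm = λ p q → coefwise λ i → trans (coef-+ p q i) (trans (+-comm _ _) (sym (coef-+ q p i))) }
        ; *-cong = ⊗-cong
        ; *-assoc = ⊗-assoc
        ; *-identity = one , λ p → ≋-trans (⊗-comm p (const 1#)) (one p)
        ; distrib = ⊗-distribˡ , ⊗-distribʳ }
      ; *-comm = ⊗-comm }
    }
    where
    one : ∀ p → (const 1# ⊗ p) ≋ p
    one p .at i = trans (coef-const* 1# p i) (*-identityˡ _)

-- Division, greatest common divisors and irreducible factors

module Factorisation {c ℓ : Level} (F : CommutativeRing c ℓ) (isField : IsFieldCR F)
                     (_≟_ : Decidable (CommutativeRing._≈_ F)) where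
  private module F = CommutativeRing F
  open F using (_≈_)
  open PolynomialRing F
  open CommutativeRing polyRing hiding (zero; _≈_)
  open IntegerCoefficients polyRing
  open IsFieldCR isField
  private
    module R≈ = Relation.Binary.Reasoning.Setoid F.setoid
    module R≋ = Relation.Binary.Reasoning.Setoid setoid

  Below : ℕ → Poly → Set ℓ
  Below d p = ∀ i → d ≤ i → coef p i ≈ F.0#

  record Monic (d : ℕ) (p : Poly) : Set ℓ where
    field
      leading : coef p d ≈ F.1#
      below   : Below (suc d) p
  open Monic public

  Below-length : ∀ p → Below (length p) p
  Below-length []      i       _        = F.refl
  Below-length (a ∷ p) (suc i) (s≤s le) = Below-length p i le

  Below-resp : ∀ {d p q} → p ≋ q → Below d p → Below d q
  Below-resp e b i le = F.trans (F.sym (e .at i)) (b i le)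

  Monic-resp : ∀ {d p q} → p ≋ q → Monic d p → Monic d q
  Monic-resp {d} e m = record { leading = F.trans (F.sym (e .at d)) (m .leading) ; below = Below-resp e (m .below) }

  Below-0⇒≋0 : ∀ {p} → Below 0 p → p ≋ 0#
  Below-0⇒≋0 b .at i = b i z≤n

  -- Induction on the constant term of the left factor: above degree e the summand a q contributes
  -- nothing, so the coefficients of (a ∷ p) * q are those of p * q shifted by one.
  top-coefficient : ∀ d e p q → Below (suc d) p → Below (suc e) q →
    (coef (p * q) (d ℕ.+ e) ≈ coef p d F.* coef q e) × Below (suc (d ℕ.+ e)) (p * q)
  top-coefficient d e [] q bp bq = F.sym (F.zeroˡ _) , λ i _ → F.refl
  top-coefficient zero e (a ∷ p) q bp bq = coef* e , λ i le → F.trans (coef* i) (F.trans (F.*-congˡ (bq i le)) (F.zeroʳ a))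
    where
    coef* : ∀ i → coef ((a ∷ p) * q) i ≈ a F.* coef q i
    coef* i = F.trans (*-cong {a ∷ p} {const a} {q} {q} (∷-cong F.refl (Below-0⇒≋0 λ i _ → bp (suc i) (s≤s z≤n))) refl .at i)
      (coef-const* a q i)
  top-coefficient (suc d) e (a ∷ p) q bp bq with top-coefficient d e p q (λ i le → bp (suc i) (s≤s le)) bq
  ... | top , b = F.trans (step (d ℕ.+ e) (ℕₚ.m≤n+m e d)) top ,
                  λ { (suc i) (s≤s le) → F.trans (step i (ℕₚ.≤-trans (ℕₚ.m≤n+m e (suc d)) le)) (b i le) }
    where
    step : ∀ i → e ≤ i → coef ((a ∷ p) * q) (suc i) ≈ coef (p * q) i
    step i le = F.trans (coef-∷* a p q i) (F.trans (F.+-congʳ (F.trans (F.*-congˡ (bq (suc i) (s≤s le))) (F.zeroʳ a))) (F.+-identityˡ _))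

  Monic-* : ∀ {d e p q} → Monic d p → Monic e q → Monic (d ℕ.+ e) (p * q)
  Monic-* {d} {e} {p} {q} mp mq with top-coefficient d e p q (mp .below) (mq .below)
  ... | top , b = record
    { leading = F.trans top (F.trans (F.*-cong (mp .leading) (mq .leading)) (F.*-identityˡ _)) ; below = b }

  Monic-1 : Monic 0 1#
  Monic-1 = record { leading = F.refl ; below = λ { (suc i) _ → F.refl } }

  Monic-0⇒≋1 : ∀ {p} → Monic 0 p → p ≋ 1#
  Monic-0⇒≋1 m .at zero    = m .leading
  Monic-0⇒≋1 m .at (suc i) = m .below (suc i) (s≤s z≤n)

  Monic⇒≉0 : ∀ {d p} → Monic d p → ¬ (p ≋ 0#)
  Monic⇒≉0 {d} m e = nontrivial (F.trans (F.sym (m .leading)) (e .at d))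

  -- Horner's scheme: B = Q A + R gives b + X B = (X Q) A + S with S = b + X R, and subtracting t A
  -- removes the coefficient `t` of degree d from S.
  division : ∀ {d A} → Monic d A → ∀ B → ∃₂ λ Q R → (B ≋ Q * A + R) × Below d R
  division mA [] = 0# , 0# , refl , λ i _ → F.refl
  division {d} {A} mA (b ∷ B) with division mA B
  ... | Q , R , eq , bR = (t ∷ Q) , S - const t * A , (R≋.begin
      (b ∷ B)                                            R≋.≈⟨ coefwise split ⟩
      (F.0# ∷ Q * A) + S                                 R≋.≈⟨ +-congʳ (0∷-* Q A) ⟨
      (F.0# ∷ Q) * A + S                                 R≋.≈⟨ solve 4 (λ x a s t → x :* a :+ s := (t :+ x) :* a :+ (s :- t :* a)) refl (F.0# ∷ Q) A S (const t) ⟩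
      (const t + (F.0# ∷ Q)) * A + (S - const t * A)     R≋.≈⟨ +-congʳ (*-congʳ {A} (∷-cong (F.+-identityʳ t) (refl {Q}))) ⟩
      (t ∷ Q) * A + (S - const t * A)                    R≋.∎) ,
    λ i le → F.trans (coef-+ S (- (const t * A)) i) (F.trans
      (F.+-congˡ (F.trans (coef-neg (const t * A) i) (F.-‿cong (coef-const* t A i)))) (rest i le))
    where
    S = b ∷ R
    t = coef S d
    split : ∀ i → coef (b ∷ B) i ≈ coef ((F.0# ∷ Q * A) + S) i
    split zero    = F.sym (F.+-identityˡ b)
    split (suc i) = eq .at i
    rest : ∀ i → d ≤ i → coef S i F.- t F.* coef A i ≈ F.0#
    rest i le with ℕₚ.m≤n⇒m<n∨m≡n le
    ... | inj₂ ≡.refl = F.trans (F.+-congˡ (F.-‿cong (F.trans (F.*-congˡ (mA .leading)) (F.*-identityʳ t)))) (F.-‿inverseʳ t)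
    ... | inj₁ (s≤s d≤j) = F.trans (F.+-cong (bR _ d≤j) (F.-‿cong (F.trans (F.*-congˡ (mA .below _ (s≤s d≤j))) (F.zeroʳ t)))) (F.-‿inverseʳ F.0#)

  -- Decidable equality finds the leading coefficient by descending from d. Both `a` and its inverse
  -- `w` are returned, so that p can be recovered from its monic multiple by `const-inverse`.
  normalise : ∀ d {p} → Below d p → (p ≋ 0#) ⊎ (∃ λ e → e < d × ∃₂ λ a w → (a F.* w ≈ F.1#) × Monic e (const w * p))
  normalise zero    b = inj₁ (Below-0⇒≋0 b)
  normalise (suc d) {p} b with coef p d ≟ F.0#
  ... | no a≉0 with inverse (coef p d) a≉0
  ...   | w , aw≈1 = inj₂ (d , ℕₚ.≤-refl , coef p d , w , aw≈1 , record
    { leading = F.trans (coef-const* w p d) (F.trans (F.*-comm _ _) aw≈1)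
    ; below   = λ i le → F.trans (coef-const* w p i) (F.trans (F.*-congˡ (b i le)) (F.zeroʳ w)) })
  normalise (suc d) {p} b | yes a≈0 with normalise d {p} lower
    where
    lower : Below d p
    lower i le with ℕₚ.m≤n⇒m<n∨m≡n le
    ... | inj₁ lt     = b i lt
    ... | inj₂ ≡.refl = a≈0
  ...   | inj₁ p≋0 = inj₁ p≋0
  ...   | inj₂ (e , e<d , rest) = inj₂ (e , ℕₚ.m<n⇒m<1+n e<d , rest)

  const-inverse : ∀ {a w} → a F.* w ≈ F.1# → ∀ p → const a * (const w * p) ≋ p
  const-inverse {a} {w} aw≈1 p .at i = R≈.begin
    coef (const a * (const w * p)) i  R≈.≈⟨ coef-const* a (const w * p) i ⟩
    a F.* coef (const w * p) i        R≈.≈⟨ F.*-congˡ (coef-const* w p i) ⟩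
    a F.* (w F.* coef p i)            R≈.≈⟨ F.*-assoc _ _ _ ⟨
    a F.* w F.* coef p i              R≈.≈⟨ F.*-congʳ aw≈1 ⟩
    F.1# F.* coef p i                 R≈.≈⟨ F.*-identityˡ _ ⟩
    coef p i                          R≈.∎

  *-cancelʳ-Monic : ∀ {d A p} → Monic d A → p * A ≋ 0# → p ≋ 0#
  *-cancelʳ-Monic {A = A} {p} mA eq with normalise (length p) {p} (Below-length p)
  ... | inj₁ p≋0 = p≋0
  ... | inj₂ (e , _ , a , w , _ , m) = contradiction
    (trans (*-assoc (const w) p A) (trans (*-congˡ {const w} eq) (zeroʳ (const w)))) (Monic⇒≉0 (Monic-* m mA))

  infix 4 _∣_
  _∣_ : Poly → Poly → Set (c ⊔ ℓ)
  A ∣ B = ∃ λ C → C * A ≋ B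

  Combination : Poly → Poly → Poly → Set (c ⊔ ℓ)
  Combination A B G = ∃₂ λ u v → u * A + v * B ≋ G

  ∣-trans : ∀ {A B C} → A ∣ B → B ∣ C → A ∣ C
  ∣-trans {A} (D , DA≋B) (E , EB≋C) = E * D , trans (*-assoc E D A) (trans (*-congˡ {E} DA≋B) EB≋C)

  -- If w C is monic of degree k, then w N = (w C) A is monic of degree k + d. As N is monic of
  -- degree m, any other degree would force w = 0 or 1 = 0, and equal degrees give w = 1, so that C
  -- itself is monic.
  cofactor-degree : ∀ {d m A N C} → Monic d A → Monic m N → C * A ≋ N → ∃ λ k → Monic k C × (k ℕ.+ d ≡ m)
  cofactor-degree {d} {m} {A} {N} {C} mA mN CA≋N with normalise (length C) {C} (Below-length C)
  ... | inj₁ C≋0 = contradiction (trans (sym CA≋N) (*-congʳ {A} C≋0)) (Monic⇒≉0 mN)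
  ... | inj₂ (k , _ , a , w , aw≈1 , mC) = by-degree (ℕₚ.<-cmp (k ℕ.+ d) m)
    where
    monic : Monic (k ℕ.+ d) (const w * N)
    monic = Monic-resp (trans (*-assoc (const w) C A) (*-congˡ {const w} CA≋N)) (Monic-* mC mA)
    w≉0 : ¬ (w ≈ F.0#)
    w≉0 w≈0 = nontrivial (F.trans (F.sym aw≈1) (F.trans (F.*-congˡ w≈0) (F.zeroʳ a)))
    by-degree : Tri (k ℕ.+ d < m) (k ℕ.+ d ≡ m) (m < k ℕ.+ d) → ∃ λ k → Monic k C × (k ℕ.+ d ≡ m)
    by-degree (tri< lt _ _) = contradiction (R≈.begin
      w                     R≈.≈⟨ F.*-identityʳ w ⟨
      w F.* F.1#            R≈.≈⟨ F.*-congˡ (mN .leading) ⟨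
      w F.* coef N m        R≈.≈⟨ coef-const* w N m ⟨
      coef (const w * N) m  R≈.≈⟨ monic .below m lt ⟩
      F.0#                  R≈.∎) w≉0
    by-degree (tri> _ _ gt) = contradiction (R≈.begin
      F.1#                            R≈.≈⟨ monic .leading ⟨
      coef (const w * N) (k ℕ.+ d)    R≈.≈⟨ coef-const* w N _ ⟩
      w F.* coef N (k ℕ.+ d)          R≈.≈⟨ F.*-congˡ (mN .below _ gt) ⟩
      w F.* F.0#                      R≈.≈⟨ F.zeroʳ w ⟩
      F.0#                            R≈.∎) nontrivial
    by-degree (tri≈ _ eq _) = k , Monic-resp (coefwise λ i → F.trans (coef-const* w C i) (F.trans (F.*-congʳ w≈1) (F.*-identityˡ _))) mC , eq
      where
      w≈1 : w ≈ F.1#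
      w≈1 = R≈.begin
        w                             R≈.≈⟨ F.*-identityʳ w ⟨
        w F.* F.1#                    R≈.≈⟨ F.*-congˡ (mN .leading) ⟨
        w F.* coef N m                R≈.≈⟨ coef-const* w N m ⟨
        coef (const w * N) m          R≈.≡⟨ ≡.cong (coef (const w * N)) eq ⟨
        coef (const w * N) (k ℕ.+ d)  R≈.≈⟨ monic .leading ⟩
        F.1#                          R≈.∎

  -- Euclid's algorithm, each remainder being made monic before the next round; `n` is fuel bounding
  -- the degree.
  gcd : ∀ n {d A} → d < n → Monic d A → ∀ B →
    ∃₂ λ e G → (e ≤ d) × Monic e G × (G ∣ A) × (G ∣ B) × Combination A B G
  gcd (suc n) {d} {A} (s≤s d≤n) mA B with division mA B
  ... | Q , R , B≋ , bR with normalise d bR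
  ...   | inj₁ R≋0 = d , A , ℕₚ.≤-refl , mA , (1# , *-identityˡ A) ,
    (Q , sym (trans B≋ (trans (+-congˡ {Q * A} R≋0) (+-identityʳ (Q * A))))) ,
    1# , 0# , trans (+-congˡ {1# * A} (zeroˡ B)) (trans (+-identityʳ (1# * A)) (*-identityˡ A))
  ...   | inj₂ (d′ , d′<d , a , w , aw≈1 , mR) with gcd n (ℕₚ.<-≤-trans d′<d d≤n) mR A
  ...     | e , G , e≤d′ , mG , (S , SG≋) , (T , TG≋) , (u , v , comb) =
    e , G , ℕₚ.≤-trans e≤d′ (ℕₚ.<⇒≤ d′<d) , mG , (T , TG≋) ,
    (Q * T + const a * S , (R≋.begin
      (Q * T + const a * S) * G                   R≋.≈⟨ solve 5 (λ q t a s g → (q :* t :+ a :* s) :* g := q :* (t :* g) :+ a :* (s :* g)) refl Q T (const a) S G ⟩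
      Q * (T * G) + const a * (S * G)             R≋.≈⟨ +-cong (*-congˡ {Q} TG≋) (*-congˡ {const a} SG≋) ⟩
      Q * A + const a * (const w * R)             R≋.≈⟨ +-congˡ {Q * A} (const-inverse aw≈1 R) ⟩
      Q * A + R                                   R≋.≈⟨ B≋ ⟨
      B                                           R≋.∎)) ,
    -- From w R = w (B - Q A) substituted into u (w R) + v A = G.
    v - u * const w * Q , u * const w , (R≋.begin
      (v - u * const w * Q) * A + u * const w * B              R≋.≈⟨ +-congˡ {(v - u * const w * Q) * A} (*-congˡ {u * const w} B≋) ⟩
      (v - u * const w * Q) * A + u * const w * (Q * A + R)    R≋.≈⟨ solve 6 (λ v u w q a r → (v :- u :* w :* q) :* a :+ u :* w :* (q :* a :+ r) := u :* (w :* r) :+ v :* a) refl v u (const w) Q A R ⟩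
      u * (const w * R) + v * A                                R≋.≈⟨ comb ⟩
      G                                                        R≋.∎)

  -- A Bézout identity rather than the absence of common divisors: read through the action, it says
  -- that an element killed by both operators is 0.
  Coprime : Poly → Poly → Set (c ⊔ ℓ)
  Coprime A B = Combination A B 1#

  Coprime-1 : ∀ A → Coprime A 1#
  Coprime-1 A = 0# , 1# , trans (+-congʳ (zeroˡ A)) (trans (+-identityˡ (1# * 1#)) (*-identityˡ 1#))

  -- The two Bézout identities are multiplied; every term of the product except v t B C contains
  -- `A`.
  Coprime-* : ∀ {A B C} → Coprime A B → Coprime A C → Coprime A (B * C)
  Coprime-* {A} {B} {C} (u , v , e) (s , t , f) = u * s * A + u * t * C + v * B * s , v * t , (R≋.begin
    (u * s * A + u * t * C + v * B * s) * A + v * t * (B * C)   R≋.≈⟨ solve 7 (λ a b c u v s t → (u :* s :* a :+ u :* t :* c :+ v :* b :* s) :* a :+ v :* t :* (b :* c) := (u :* a :+ v :* b) :* (s :* a :+ t :* c)) refl A B C u v s t ⟩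
    (u * A + v * B) * (s * A + t * C)                           R≋.≈⟨ *-cong e f ⟩
    1# * 1#                                                     R≋.≈⟨ *-identityˡ 1# ⟩
    1#                                                          R≋.∎)

  -- Irreducibility as maximality of the ideal generated by `P`, stated as an alternative on which a
  -- proof can branch for each `D`.
  Maximal : Poly → Set (c ⊔ ℓ)
  Maximal P = ∀ D → (P ∣ D) ⊎ Coprime P D

  linear-≋ : ∀ {p} → Monic 1 p → p ≋ coef p 0 ∷ F.1# ∷ []
  linear-≋ m .at zero          = F.refl
  linear-≋ m .at (suc zero)    = m .leading
  linear-≋ m .at (suc (suc i)) = m .below (suc (suc i)) (s≤s (s≤s z≤n))

  -- X cancels in p - q and leaves a non-zero constant, whose inverse is `w`.
  linear-coprime : ∀ {p q} → Monic 1 p → Monic 1 q → ¬ (coef p 0 ≈ coef q 0) → Coprime p q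
  linear-coprime {p} {q} mp mq a≉b with inverse (coef p 0 F.- coef q 0) (λ e → a≉b (Powers.x-y≈0⇒x≈y F e))
  ... | w , e = const w , const (F.- w) ,
    trans (+-cong (*-congˡ {const w} (linear-≋ mp)) (*-congˡ {const (F.- w)} (linear-≋ mq))) (coefwise coefs)
    where
    module Fs = IntegerCoefficients F
    coefs : ∀ i → coef (const w * (coef p 0 ∷ F.1# ∷ []) + const (F.- w) * (coef q 0 ∷ F.1# ∷ [])) i ≈ coef 1# i
    coefs zero = F.trans (Fs.solve 3 (λ w a b → (w Fs.:* a Fs.:+ Fs.con (pos 0)) Fs.:+ ((Fs.:- w) Fs.:* b Fs.:+ Fs.con (pos 0)) Fs.:= (a Fs.:- b) Fs.:* w) F.refl w (coef p 0) (coef q 0)) e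
    coefs (suc zero) = Fs.solve 2 (λ w e → w Fs.:* e Fs.:+ (Fs.:- w) Fs.:* e Fs.:= Fs.con (pos 0)) F.refl w F.1#
    coefs (suc (suc i)) = F.refl

  cofactor-unique : ∀ {d A B C D N} → Monic d A → A ≋ B → A * C ≋ N → B * D ≋ N → C ≋ D
  cofactor-unique {A = A} {B} {C} {D} {N} mA A≋B AC≋N BD≋N = Powers.x-y≈0⇒x≈y polyRing (*-cancelʳ-Monic {p = C - D} mA (R≋.begin
    (C - D) * A        R≋.≈⟨ solve 3 (λ c d a → (c :- d) :* a := a :* c :- a :* d) refl C D A ⟩
    A * C - A * D      R≋.≈⟨ +-cong AC≋N (-‿cong {A * D} {B * D} (*-congʳ {D} A≋B)) ⟩
    N - B * D          R≋.≈⟨ +-congˡ {N} (-‿cong BD≋N) ⟩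
    N - N              R≋.≈⟨ -‿inverseʳ N ⟩
    0#                 R≋.∎))

  -- Ensures that linear factors of N with the same root impose the same condition on x, so that
  -- repeated ones need be sieved only once.
  linear-cofactor-unique : ∀ {A B C D N} → Monic 1 A → Monic 1 B → coef A 0 ≈ coef B 0 → A * C ≋ N → B * D ≋ N → C ≋ D
  linear-cofactor-unique mA mB a≈b =
    cofactor-unique mA (trans (linear-≋ mA) (trans (∷-cong a≈b refl) (sym (linear-≋ mB))))

  maximal-coprime-linear : ∀ {d p q} → Maximal p → Monic d p → 2 ≤ d → Monic 1 q → Coprime p q
  maximal-coprime-linear {d} {p} {q} max mp 2≤d mq with max q
  ... | inj₂ cop = cop
  ... | inj₁ (C , Cp≋q) with cofactor-degree {C = C} mp mq Cp≋q
  ...   | k , _ , k+d≡1 = contradiction (ℕₚ.≤-trans 2≤d (ℕₚ.≤-trans (ℕₚ.m≤n+m d k) (ℕₚ.≤-reflexive k+d≡1))) ℕₚ.1+n≰n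

  private
    excluded-middle : ∀ {x} {X : Set x} → ¬ ¬ (X ⊎ ¬ X)
    excluded-middle k = k (inj₂ λ x → k (inj₁ x))

  -- Irreducibility is not decided here; existence up to double negation is enough, the final inequalities being decidable.
  maximal-factor : ∀ n {d N} → d < n → 1 ≤ d → Monic d N → ¬ ¬ (∃₂ λ e P → 1 ≤ e × Monic e P × Maximal P × P ∣ N)
  maximal-factor (suc n) {d} {N} (s≤s d≤n) 1≤d mN k =
    excluded-middle {X = ∃₂ λ e G → 1 ≤ e × e < d × Monic e G × G ∣ N} λ
      { (inj₁ (e , G , 1≤e , e<d , mG , G∣N)) → maximal-factor n (ℕₚ.<-≤-trans e<d d≤n) 1≤e mG
          λ (e′ , P , 1≤e′ , mP , max , P∣G) → k (e′ , P , 1≤e′ , mP , max , ∣-trans P∣G G∣N)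
      ; (inj₂ none) → k (d , N , 1≤d , mN , (λ D → is-maximal none D (gcd (suc d) ℕₚ.≤-refl mN D)) , 1# , *-identityˡ N) }
    where
    -- The degree of the monic gcd `G` decides: degree 0 is coprimality, a degree strictly between 0
    -- and d contradicts `none`, and degree d makes G equal to N, so that N divides D.
    is-maximal : ¬ (∃₂ λ e G → 1 ≤ e × e < d × Monic e G × G ∣ N) → ∀ D →
      (∃₂ λ e G → (e ≤ d) × Monic e G × (G ∣ N) × (G ∣ D) × Combination N D G) → (N ∣ D) ⊎ Coprime N D
    is-maximal none D (zero , G , _ , mG , _ , _ , u , v , comb) = inj₂ (u , v , trans comb (Monic-0⇒≋1 mG))
    is-maximal none D (suc e , G , le , mG , G∣N@(C , CG≋N) , G∣D , _) with ℕₚ.m≤n⇒m<n∨m≡n le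
    ... | inj₁ lt = contradiction (suc e , G , s≤s z≤n , lt , mG , G∣N) none
    ... | inj₂ ≡.refl with cofactor-degree {C = C} mG mN CG≋N
    ...   | zero , mC , _ = inj₁ (∣-trans (1# , trans (*-identityˡ N) (trans (sym CG≋N) (trans (*-congʳ {G} (Monic-0⇒≋1 mC)) (*-identityˡ G)))) G∣D)
    ...   | suc k , _ , eq = contradiction (≡.sym eq) (ℕₚ.m≢1+n+m (suc e))

  record Factor (m : ℕ) (N : Poly) : Set (c ⊔ ℓ) where
    field
      P M      : Poly
      deg codeg : ℕ
      deg-sum  : deg ℕ.+ codeg ≡ m
      1≤deg    : 1 ≤ deg
      monic-P  : Monic deg P
      monic-M  : Monic codeg M
      maximal  : Maximal P
      PM≋N     : P * M ≋ N

  -- For non-zero D of degree below m, gcd (D, N) is a proper divisor of N and hence divides N/P for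
  -- some irreducible P; `covers` expresses this through ideals. Factors are listed with
  -- multiplicity, which is what makes the degrees add up to m.
  record Cover (m : ℕ) (N : Poly) : Set (c ⊔ ℓ) where
    field
      factors   : List (Factor m N)
      total-deg : sum (map Factor.deg factors) ≡ m
      covers    : ∀ D → ¬ (D ≋ 0#) → Below m D → Any (λ f → Combination D N (Factor.M f)) factors

  -- One irreducible factor P of N = C P is split off, and a cover of C is lifted by multiplying its
  -- cofactors by P. A D coprime to P is met by the new factor; a multiple of P is divided by P and
  -- left to the cover of C.
  cover : ∀ n {m N} → m < n → Monic m N → ¬ ¬ Cover m N
  cover (suc n) {zero} {N} _ mN k = k record
    { factors = [] ; total-deg = ≡.refl ; covers = λ D D≉0 b → contradiction (Below-0⇒≋0 b) D≉0 }
  cover (suc n) {m@(suc _)} {N} (s≤s m≤n) mN k = maximal-factor (suc m) ℕₚ.≤-refl (s≤s z≤n) mN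
    λ (e , P , 1≤e , mP , max , C , CP≋N) → let (j , mC , j+e≡m) = cofactor-degree {C = C} mP mN CP≋N in
      cover n (ℕₚ.<-≤-trans (ℕₚ.≤-trans (ℕₚ.≤-trans (ℕₚ.≤-reflexive (ℕₚ.+-comm 1 j)) (ℕₚ.+-monoʳ-≤ j 1≤e)) (ℕₚ.≤-reflexive j+e≡m)) m≤n) mC
        λ cov → k (extend 1≤e mP max CP≋N mC j+e≡m cov)
    where
    extend : ∀ {e j P C} → 1 ≤ e → Monic e P → Maximal P → C * P ≋ N → Monic j C → j ℕ.+ e ≡ m → Cover j C → Cover m N
    extend {e} {j} {P} {C} 1≤e mP max CP≋N mC j+e≡m cov = record
      { factors   = new ∷ map lift factors
      ; total-deg = ≡.trans (≡.cong (λ s → e ℕ.+ s) (≡.trans (≡.cong sum (≡.sym (map-∘ factors))) total-deg)) e+j≡m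
      ; covers    = covers′ }
      where
      open Cover cov
      e+j≡m : e ℕ.+ j ≡ m
      e+j≡m = ≡.trans (ℕₚ.+-comm e j) j+e≡m
      new : Factor m N
      new = record { P = P ; M = C ; deg = e ; codeg = j ; deg-sum = e+j≡m ; 1≤deg = 1≤e
                   ; monic-P = mP ; monic-M = mC ; maximal = max ; PM≋N = trans (*-comm P C) CP≋N }
      lift : Factor j C → Factor m N
      lift f = record { P = f.P ; M = P * f.M ; deg = f.deg ; codeg = e ℕ.+ f.codeg
        ; deg-sum = ≡.trans (≡.sym (ℕₚ.+-assoc f.deg e f.codeg)) (≡.trans (≡.cong (ℕ._+ f.codeg) (ℕₚ.+-comm f.deg e))
            (≡.trans (ℕₚ.+-assoc e f.deg f.codeg) (≡.trans (≡.cong (e ℕ.+_) f.deg-sum) e+j≡m)))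
        ; 1≤deg = f.1≤deg ; monic-P = f.monic-P ; monic-M = Monic-* mP f.monic-M ; maximal = f.maximal
        ; PM≋N = trans (solve 3 (λ p q m → q :* (p :* m) := p :* (q :* m)) refl P f.P f.M)
                   (trans (*-congˡ {P} f.PM≋N) (trans (*-comm P C) CP≋N)) }
        where module f = Factor f
      covers′ : ∀ D → ¬ (D ≋ 0#) → Below m D → Any (λ f → Combination D N (Factor.M f)) (new ∷ map lift factors)
      covers′ D D≉0 bD with max D
      -- Multiplying u P + v D = 1 by C puts C into the ideal generated by D and N = C P.
      ... | inj₂ (u , v , uP+vD≋1) = here (v * C , u , (R≋.begin
        v * C * D + u * N         R≋.≈⟨ +-congˡ {v * C * D} (*-congˡ {u} CP≋N) ⟨
        v * C * D + u * (C * P)   R≋.≈⟨ solve 5 (λ v c d u p → v :* c :* d :+ u :* (c :* p) := c :* (u :* p :+ v :* d)) refl v C D u P ⟩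
        C * (u * P + v * D)       R≋.≈⟨ *-congˡ {C} uP+vD≋1 ⟩
        C * 1#                    R≋.≈⟨ *-identityʳ C ⟩
        C                         R≋.∎))
      ... | inj₁ (D′ , D′P≋D) = there (Anyₚ.map⁺ (Any.map (λ {f} → up f) (covers D′ D′≉0 bD′)))
        where
        D′≉0 : ¬ (D′ ≋ 0#)
        D′≉0 D′≋0 = D≉0 (trans (sym D′P≋D) (*-congʳ {P} D′≋0))
        -- Degrees add: were D′ of degree i ≥ j, the leading coefficient 1 of w D′ P would sit at i
        -- + e ≥ m, where w D has only zeros.
        bD′ : Below j D′
        bD′ with normalise (length D′) {D′} (Below-length D′)
        ... | inj₁ D′≋0 = contradiction D′≋0 D′≉0
        ... | inj₂ (i , _ , a , w , aw≈1 , mD′) with i ℕₚ.<? j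
        ...   | yes i<j = Below-resp (const-inverse aw≈1 D′) λ s le → F.trans (coef-const* a (const w * D′) s)
                  (F.trans (F.*-congˡ (mD′ .below s (ℕₚ.≤-trans i<j le))) (F.zeroʳ a))
        ...   | no i≮j = contradiction (R≈.begin
          F.1#                                       R≈.≈⟨ Monic-* mD′ mP .leading ⟨
          coef (const w * D′ * P) (i ℕ.+ e)          R≈.≈⟨ trans (*-assoc (const w) D′ P) (*-congˡ {const w} D′P≋D) .at (i ℕ.+ e) ⟩
          coef (const w * D) (i ℕ.+ e)               R≈.≈⟨ coef-const* w D (i ℕ.+ e) ⟩
          w F.* coef D (i ℕ.+ e)                     R≈.≈⟨ F.*-congˡ (bD (i ℕ.+ e) (ℕₚ.≤-trans (ℕₚ.≤-reflexive (≡.sym j+e≡m)) (ℕₚ.+-monoˡ-≤ e (ℕₚ.≮⇒≥ i≮j)))) ⟩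
          w F.* F.0#                                 R≈.≈⟨ F.zeroʳ w ⟩
          F.0#                                       R≈.∎) nontrivial
        up : (f : Factor j C) → Combination D′ C (Factor.M f) → Combination D N (P * Factor.M f)
        up f (u , v , comb) = u , v , (R≋.begin
          u * D + v * N                     R≋.≈⟨ +-cong (*-congˡ {u} (sym D′P≋D)) (*-congˡ {v} (sym CP≋N)) ⟩
          u * (D′ * P) + v * (C * P)        R≋.≈⟨ solve 5 (λ u d p v c → u :* (d :* p) :+ v :* (c :* p) := p :* (u :* d :+ v :* c)) refl u D′ P v C ⟩
          P * (u * D′ + v * C)              R≋.≈⟨ *-congˡ {P} comb ⟩
          P * Factor.M f                    R≋.∎)

-- Polynomials acting on an extension field

module SubfieldRing {c ℓ p : Level} (R : CommutativeRing c ℓ) {K : CommutativeRing.Carrier R → Set p}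
                    (isSubfield : IsSubfield R K) where
  open CommutativeRing R
  open IsSubfield isSubfield

  subring : CommutativeRing (c ⊔ p) ℓ
  subring = record
    { Carrier = Σ Carrier K
    ; _≈_     = λ x y → proj₁ x ≈ proj₁ y
    ; _+_     = λ (x , Kx) (y , Ky) → x + y , +-cl Kx Ky
    ; _*_     = λ (x , Kx) (y , Ky) → x * y , *-cl Kx Ky
    ; -_      = λ (x , Kx) → - x , neg-cl Kx
    ; 0#      = 0# , has0
    ; 1#      = 1# , has1
    ; isCommutativeRing = record
      { isRing = record
        { +-isAbelianGroup = record
          { isGroup = record
            { isMonoid = record
              { isSemigroup = record
                { isMagma = record
                  { isEquivalence = record { refl = refl ; sym = sym ; trans = trans }
                  ; ∙-cong = +-cong }
                ; assoc = λ x y z → +-assoc _ _ _ }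
              ; identity = (λ x → +-identityˡ _) , λ x → +-identityʳ _ }
            ; inverse = (λ x → -‿inverseˡ _) , λ x → -‿inverseʳ _
            ; ⁻¹-cong = -‿cong }
          ; comm = λ x y → +-comm _ _ }
        ; *-cong = *-cong
        ; *-assoc = λ x y z → *-assoc _ _ _
        ; *-identity = (λ x → *-identityˡ _) , λ x → *-identityʳ _
        ; distrib = (λ x y z → distribˡ _ _ _) , λ x y z → distribʳ _ _ _ }
      ; *-comm = λ x y → *-comm _ _ }
    }

  subring-isField : IsFieldCR R → IsFieldCR subring
  subring-isField isField = record
    { nontrivial = IsFieldCR.nontrivial isField
    ; inverse    = λ (x , Kx) x≉0 → let (y , Ky , xy≈1) = inv-cl Kx x≉0 in (y , Ky) , xy≈1 }

-- `τ` is an arbitrary K-linear map because two are needed: the power map x ↦ x ^ Q, which detects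
-- normality, and multiplication by a root, for which the action on 1 is evaluation.
module Action {c ℓ p : Level} (R : CommutativeRing c ℓ) {K : CommutativeRing.Carrier R → Set p}
              (isSubfield : IsSubfield R K) (τ : CommutativeRing.Carrier R → CommutativeRing.Carrier R)
              (τ-cong : ∀ {x y} → CommutativeRing._≈_ R x y → CommutativeRing._≈_ R (τ x) (τ y))
              (τ-+ : ∀ x y → CommutativeRing._≈_ R (τ (CommutativeRing._+_ R x y)) (CommutativeRing._+_ R (τ x) (τ y)))
              (τ-* : ∀ {a} x → K a → CommutativeRing._≈_ R (τ (CommutativeRing._*_ R a x)) (CommutativeRing._*_ R a (τ x))) where
  open CommutativeRing R hiding (zero)
  open SubfieldRing R isSubfield
  open PolynomialRing subring
  open IntegerCoefficients R
  open Powers polyRing using (_↑_)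
  open Relation.Binary.Reasoning.Setoid setoid
  private
    module F  = CommutativeRing subring
    module F[X] = CommutativeRing polyRing

  act : Poly → Carrier → Carrier
  act []            x = 0#
  act ((a , _) ∷ p) x = a * x + act p (τ x)

  act-cong : ∀ p {x y} → x ≈ y → act p x ≈ act p y
  act-cong []      x≈y = refl
  act-cong (a ∷ p) x≈y = +-cong (*-congˡ x≈y) (act-cong p (τ-cong x≈y))

  act-≋ : ∀ {p q} → p ≋ q → ∀ x → act p x ≈ act q x
  act-≋ {[]}    {[]}    e x = refl
  act-≋ {[]}    {b ∷ q} e x = begin
    0#                           ≈⟨ +-identityˡ 0# ⟨
    0# + 0#                      ≈⟨ +-congʳ (zeroˡ x) ⟨
    0# * x + 0#                  ≈⟨ +-cong (*-congʳ (e .at 0)) (act-≋ {[]} {q} (coefwise λ i → e .at (suc i)) (τ x)) ⟩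
    proj₁ b * x + act q (τ x)    ∎
  act-≋ {a ∷ p} {[]}    e x = begin
    proj₁ a * x + act p (τ x)    ≈⟨ +-cong (*-congʳ (e .at 0)) (act-≋ {p} {[]} (coefwise λ i → e .at (suc i)) (τ x)) ⟩
    0# * x + 0#                  ≈⟨ +-congʳ (zeroˡ x) ⟩
    0# + 0#                      ≈⟨ +-identityˡ 0# ⟩
    0#                           ∎
  act-≋ {a ∷ p} {b ∷ q} e x = +-cong (*-congʳ (e .at 0)) (act-≋ {p} {q} (coefwise λ i → e .at (suc i)) (τ x))

  act-+ : ∀ p q x → act (p F[X].+ q) x ≈ act p x + act q x
  act-+ []      q       x = sym (+-identityˡ _)
  act-+ (a ∷ p) []      x = sym (+-identityʳ _)
  act-+ (a ∷ p) (b ∷ q) x = trans (+-congˡ (act-+ p q (τ x)))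
    (solve 5 (λ a b x u v → (a :+ b) :* x :+ (u :+ v) := (a :* x :+ u) :+ (b :* x :+ v)) refl (proj₁ a) (proj₁ b) x _ _)

  act-additive : ∀ p x y → act p (x + y) ≈ act p x + act p y
  act-additive []      x y = sym (+-identityˡ 0#)
  act-additive (a ∷ p) x y = trans (+-congˡ (trans (act-cong p (τ-+ x y)) (act-additive p (τ x) (τ y))))
    (solve 5 (λ a x y u v → a :* (x :+ y) :+ (u :+ v) := (a :* x :+ u) :+ (a :* y :+ v)) refl (proj₁ a) x y _ _)

  act-0 : ∀ p → act p 0# ≈ 0#
  act-0 p = begin
    act p 0#                          ≈⟨ solve 1 (λ z → z := (z :+ z) :- z) refl (act p 0#) ⟩
    act p 0# + act p 0# - act p 0#    ≈⟨ +-congʳ (act-additive p 0# 0#) ⟨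
    act p (0# + 0#) - act p 0#        ≈⟨ +-congʳ (act-cong p (+-identityˡ 0#)) ⟩
    act p 0# - act p 0#               ≈⟨ -‿inverseʳ _ ⟩
    0#                                ∎

  act-sub : ∀ p x y → act p (x - y) ≈ act p x - act p y
  act-sub p x y = begin
    act p (x - y)                        ≈⟨ solve 2 (λ u v → u := (u :+ v) :- v) refl _ (act p y) ⟩
    act p (x - y) + act p y - act p y    ≈⟨ +-congʳ (act-additive p (x - y) y) ⟨
    act p (x - y + y) - act p y          ≈⟨ +-congʳ (act-cong p (solve 2 (λ x y → x :- y :+ y := x) refl x y)) ⟩
    act p x - act p y                    ∎

  private
    act-scale : ∀ r p x → act (map (r F.*_) p) x ≈ proj₁ r * act p x
    act-scale r []      x = sym (zeroʳ _)
    act-scale r (a ∷ p) x = trans (+-congˡ (act-scale r p (τ x)))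
      (solve 4 (λ r a x u → r :* a :* x :+ r :* u := r :* (a :* x :+ u)) refl (proj₁ r) (proj₁ a) x _)

    τ-0 : τ 0# ≈ 0#
    τ-0 = begin
      τ 0#                    ≈⟨ solve 1 (λ z → z := (z :+ z) :- z) refl (τ 0#) ⟩
      τ 0# + τ 0# - τ 0#      ≈⟨ +-congʳ (τ-+ 0# 0#) ⟨
      τ (0# + 0#) - τ 0#      ≈⟨ +-congʳ (τ-cong (+-identityˡ 0#)) ⟩
      τ 0# - τ 0#             ≈⟨ -‿inverseʳ _ ⟩
      0#                      ∎

    act-τ : ∀ p x → act p (τ x) ≈ τ (act p x)
    act-τ []             x = sym τ-0
    act-τ ((a , Ka) ∷ p) x = sym (trans (τ-+ (a * x) _) (+-cong (τ-* x Ka) (sym (act-τ p (τ x)))))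

  -- Products become compositions because every operator commutes with `τ`, the coefficients lying
  -- in `K` and `τ` being K-linear.
  act-* : ∀ p q x → act (p F[X].* q) x ≈ act p (act q x)
  act-* []      q x = refl
  act-* (a ∷ p) q x = begin
    act (map (a F.*_) q F[X].+ (F.0# ∷ p F[X].* q)) x           ≈⟨ act-+ (map (a F.*_) q) (F.0# ∷ p F[X].* q) x ⟩
    act (map (a F.*_) q) x + (0# * x + act (p F[X].* q) (τ x))   ≈⟨ +-cong (act-scale a q x) (trans (+-congʳ (zeroˡ x)) (+-identityˡ _)) ⟩
    proj₁ a * act q x + act (p F[X].* q) (τ x)                   ≈⟨ +-congˡ (trans (act-* p q (τ x)) (act-cong p (act-τ q x))) ⟩
    proj₁ a * act q x + act p (τ (act q x))                      ∎

  act-1 : ∀ x → act F[X].1# x ≈ x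
  act-1 x = trans (+-identityʳ _) (*-identityˡ x)

  -- The passage from ideals to kernels: what both generators kill is killed by every element of
  -- their ideal.
  act-combination : ∀ u v {A B G} → u F[X].* A F[X].+ v F[X].* B ≋ G → ∀ {x} → act A x ≈ 0# → act B x ≈ 0# → act G x ≈ 0#
  act-combination u v {A} {B} {G} e {x} Ax≈0 Bx≈0 = begin
    act G x                                      ≈⟨ act-≋ e x ⟨
    act (u F[X].* A F[X].+ v F[X].* B) x         ≈⟨ act-+ (u F[X].* A) (v F[X].* B) x ⟩
    act (u F[X].* A) x + act (v F[X].* B) x      ≈⟨ +-cong (act-* u A x) (act-* v B x) ⟩
    act u (act A x) + act v (act B x)            ≈⟨ +-cong (act-cong u Ax≈0) (act-cong v Bx≈0) ⟩
    act u 0# + act v 0#                          ≈⟨ +-cong (act-0 u) (act-0 v) ⟩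
    0# + 0#                                      ≈⟨ +-identityˡ 0# ⟩
    0#                                           ∎

  X : Poly
  X = F.0# ∷ F.1# ∷ []

  act-X : ∀ x → act X x ≈ τ x
  act-X x = trans (solve 2 (λ x t → con (pos 0) :* x :+ t := t) refl x _) (act-1 (τ x))

  iterate : ℕ → Carrier → Carrier
  iterate zero    x = x
  iterate (suc k) x = τ (iterate k x)

  act-X↑ : ∀ k x → act (X ↑ k) x ≈ iterate k x
  act-X↑ zero    x = act-1 x
  act-X↑ (suc k) x = trans (act-* X (X ↑ k) x) (trans (act-X _) (τ-cong (act-X↑ k x)))

  act-X↑-1 : ∀ k x → act (X ↑ k F[X].- F[X].1#) x ≈ iterate k x - x
  act-X↑-1 k x = trans (act-+ (X ↑ k) (F[X].- F[X].1#) x) (+-cong (act-X↑ k x)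
    (trans (+-identityʳ _) (trans (solve 2 (λ e x → (:- e) :* x := :- (e :* x)) refl 1# x) (-‿cong (*-identityˡ x)))))

module _ {c ℓ : Level} (R : CommutativeRing c ℓ) (q n : ℕ) where
  open CommutativeRing R using (Carrier; setoid)
  open Data.List.Relation.Unary.Unique.Setoid setoid using (Unique)
  open Data.List.Membership.Setoid setoid using (_∈_)

  NormalOutside : ℕ → ℕ → List Carrier → Set (c ⊔ ℓ)
  NormalOutside l m bs = ∀ x → ¬ (x ∈ bs) → NormalOver R q l m x

  -- The bound m q ^ (n - l), multiplied by q ^ l so that no subtraction occurs. `bs` will be a
  -- concatenation of kernels and may contain repetitions.
  FewAbnormal : ℕ → ℕ → Set (c ⊔ ℓ)
  FewAbnormal l m = ∃ λ bs → length bs ℕ.* q ^ l ≤ m ℕ.* q ^ n × NormalOutside l m bs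

  -- s counts the elements that pass the sieve by the g distinct linear factors of Xⁿ − 1 over F_q,
  -- and r is the number of its non-linear irreducible factors.
  ManyNormal : Set (c ⊔ ℓ)
  ManyNormal = ∃ λ gs → Unique gs × All (NormalOver R q 1 n) gs ×
    ∃₂ λ s g → ∃ λ r → (g ≤ ℕ-gcd n (q ∸ 1)) × (2 ℕ.* r ≤ n) ×
      ((q ∸ 1) ^ g ℕ.* q ^ n ≤ q ^ g ℕ.* s) × (q ^ 2 ℕ.* s ≤ q ^ 2 ℕ.* length gs ℕ.+ r ℕ.* s)

-- Normal elements of a finite extension

module FiniteExtension {c ℓ : Level} (R : CommutativeRing c ℓ) (isField : IsFieldCR R)
  (_≟_ : Decidable (CommutativeRing._≈_ R)) {p : Level} {K : CommutativeRing.Carrier R → Set p} (isSubfield : IsSubfield R K)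
  {q n : ℕ} (2≤q : 2 ≤ q) (sizeK : HasSize R K q) (sizeL : HasSize R (λ _ → ⊤) (q ℕ.^ n)) where
  open CommutativeRing R hiding (zero)
  open IntegerCoefficients R
  open Algebra.Properties.Ring ring using (+-cancelˡ)
  open Powers R
  open Field R isField _≟_
  open IsFieldCR isField
  open Counting setoid _≟_
  open Data.List.Relation.Unary.Unique.Setoid setoid using (Unique)
  open Data.List.Membership.Setoid setoid using (_∈_)
  open Relation.Binary.Reasoning.Setoid setoid

  univ : List Carrier
  univ = proj₁ sizeL

  length-univ : length univ ≡ q ℕ.^ n
  length-univ = proj₁ (proj₂ sizeL)

  univ! : Unique univ
  univ! = proj₁ (proj₂ (proj₂ sizeL))

  ∈univ : ∀ x → x ∈ univ
  ∈univ x = proj₂ (proj₂ (proj₂ (proj₂ sizeL))) x tt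

  private
    whole : IsSubfield R (λ _ → ⊤)
    whole = record { resp = λ _ _ → tt ; has0 = tt ; has1 = tt ; +-cl = λ _ _ → tt ; neg-cl = λ _ → tt ; *-cl = λ _ _ → tt
                   ; inv-cl = λ {x} _ x≉0 → let (y , e) = inverse x x≉0 in y , tt , e }

  ↑qⁿ : ∀ x → x ↑ (q ℕ.^ n) ≈ x
  ↑qⁿ x = FiniteSubfield.fermat whole sizeL tt

  frobenius-+ : ∀ l x y → (x + y) ↑ (q ℕ.^ l) ≈ x ↑ (q ℕ.^ l) + y ↑ (q ℕ.^ l)
  frobenius-+ zero    x y = solve 3 (λ x y e → (x :+ y) :* e := x :* e :+ y :* e) refl x y 1#
  frobenius-+ (suc l) x y = begin
    (x + y) ↑ (q ℕ.* q ℕ.^ l)                          ≈⟨ ↑-* (x + y) q (q ℕ.^ l) ⟩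
    ((x + y) ↑ q) ↑ (q ℕ.^ l)                          ≈⟨ ↑-cong (q ℕ.^ l) (FiniteSubfield.frobenius-+ isSubfield sizeK x y) ⟩
    (x ↑ q + y ↑ q) ↑ (q ℕ.^ l)                        ≈⟨ frobenius-+ l (x ↑ q) (y ↑ q) ⟩
    (x ↑ q) ↑ (q ℕ.^ l) + (y ↑ q) ↑ (q ℕ.^ l)          ≈⟨ +-cong (↑-* x q (q ℕ.^ l)) (↑-* y q (q ℕ.^ l)) ⟨
    x ↑ (q ℕ.* q ℕ.^ l) + y ↑ (q ℕ.* q ℕ.^ l)          ∎

  1≤q^ : ∀ l → 1 ≤ q ℕ.^ l
  1≤q^ l = ℕₚ.m^n>0 q ⦃ ℕ.>-nonZero (ℕₚ.≤-trans (s≤s z≤n) 2≤q) ⦄ l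

  Sub-isSubfield : ∀ l → IsSubfield R (Sub R q l)
  Sub-isSubfield l = record
    { resp   = λ x≈y Sx → trans (↑-cong Q (sym x≈y)) (trans Sx x≈y)
    ; has0   = 0↑ (1≤q^ l)
    ; has1   = 1↑ Q
    ; +-cl   = λ {x} {y} Sx Sy → trans (frobenius-+ l x y) (+-cong Sx Sy)
    ; neg-cl = λ {x} Sx → begin
        (- x) ↑ Q                    ≈⟨ solve 2 (λ u v → u := (v :+ u) :- v) refl _ (x ↑ Q) ⟩
        x ↑ Q + (- x) ↑ Q - x ↑ Q    ≈⟨ +-congʳ (frobenius-+ l x (- x)) ⟨
        (x - x) ↑ Q - x ↑ Q          ≈⟨ +-cong (trans (↑-cong Q (-‿inverseʳ x)) (0↑ (1≤q^ l))) (-‿cong Sx) ⟩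
        0# - x                       ≈⟨ +-identityˡ _ ⟩
        - x                          ∎
    ; *-cl   = λ {x} {y} Sx Sy → trans (↑-distrib-* x y Q) (*-cong Sx Sy)
    ; inv-cl = λ {x} Sx x≉0 → let (y , xy≈1) = inverse x x≉0 in y , *-cancelˡ x≉0 (begin
        x * y ↑ Q      ≈⟨ *-congʳ Sx ⟨
        x ↑ Q * y ↑ Q  ≈⟨ ↑-distrib-* x y Q ⟨
        (x * y) ↑ Q    ≈⟨ ↑-cong Q xy≈1 ⟩
        1# ↑ Q         ≈⟨ 1↑ Q ⟩
        1#             ≈⟨ xy≈1 ⟨
        x * y          ∎) , xy≈1
    }
    where Q = q ℕ.^ l

  -- Every x differs from the representative of its value by a kernel element, so one translate of
  -- the kernel per value of `T` covers the field: a counting form of rank and nullity.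
  many-images : (T : Carrier → Carrier) → (∀ {x y} → x ≈ y → T x ≈ T y) → (∀ x y → T (x - y) ≈ T x - T y) →
    ∀ k → (∀ {xs} → Unique xs → All (λ x → T x ≈ 0#) xs → length xs ≤ k) →
    ∃ λ ws → AllPairs (λ v w → ¬ (T v ≈ T w)) ws × (q ℕ.^ n ≤ length ws ℕ.* k)
  many-images T T-cong T-sub k small with distinct-representatives T univ
  ... | ws , ws! , cover = ws , ws! , ℕₚ.≤-trans
    (ℕₚ.≤-reflexive (≡.sym length-univ)) (ℕₚ.≤-trans
    (Unique-⊆⇒length≤ univ! λ {x} x∈ → ⊆-product x (All.lookupWith (λ Aw x≈y → Any.map (trans (T-cong x≈y)) Aw) cover x∈))
    (ℕₚ.≤-trans (ℕₚ.≤-reflexive (length-cartesianProductWith _+_ ws ker))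
    (ℕₚ.*-monoʳ-≤ (length ws) (small (AllPairsₚ.filter⁺ ker? univ!) (Allₚ.all-filter ker? univ)))))
    where
    ker? : ∀ x → Dec (T x ≈ 0#)
    ker? x = T x ≟ 0#
    ker = filter ker? univ
    ⊆-product : ∀ x {ws} → Any (λ w → T x ≈ T w) ws → x ∈ cartesianProductWith _+_ ws ker
    ⊆-product x (here {w} Tx≈Tw) = Anyₚ.++⁺ˡ (Anyₚ.map⁺ (Any.map (λ {z} e → trans (solve 2 (λ x w → x := w :+ (x :- w)) refl x w) (+-congˡ e))
      (∈ₚ.∈-filter⁺ setoid ker? (λ x≈y Tx≈0 → trans (T-cong (sym x≈y)) Tx≈0) (∈univ (x - w))
        (trans (T-sub x w) (trans (+-congʳ Tx≈Tw) (-‿inverseʳ _))))))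
    ⊆-product x (there {v} any) = Anyₚ.++⁺ʳ (map (v +_) ker) (⊆-product x any)

  sumFin-cong : ∀ k {f g : Fin k → Carrier} → (∀ i → f i ≈ g i) → sumFin R k f ≈ sumFin R k g
  sumFin-cong zero    e = refl
  sumFin-cong (suc k) e = +-cong (e Fin.zero) (sumFin-cong k (λ i → e (Fin.suc i)))

  module OverSub (l m : ℕ) (1≤l : 1 ≤ l) (l*m≡n : l ℕ.* m ≡ n) where
    Q : ℕ
    Q = q ℕ.^ l

    2≤Q : 2 ≤ Q
    2≤Q = ℕₚ.≤-trans 2≤q (ℕₚ.≤-trans (ℕₚ.≤-reflexive (≡.sym (ℕₚ.*-identityʳ q)))
      (ℕₚ.^-monoʳ-≤ q ⦃ ℕ.>-nonZero (ℕₚ.≤-trans (s≤s z≤n) 2≤q) ⦄ 1≤l))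

    Q^m≡q^n : Q ℕ.^ m ≡ q ℕ.^ n
    Q^m≡q^n = ≡.trans (ℕₚ.^-*-assoc q l m) (≡.cong (q ℕ.^_) l*m≡n)

    open SubfieldRing R (Sub-isSubfield l) public
    open PolynomialRing subring public
    open Factorisation subring (subring-isField isField) (λ x y → proj₁ x ≟ proj₁ y) public
    open Action R (Sub-isSubfield l) (_↑ Q) (↑-cong Q) (frobenius-+ l)
      (λ {a} x Sa → trans (↑-distrib-* a x Q) (*-congʳ Sa)) public
    module F[X] = CommutativeRing polyRing
    open Powers polyRing using () renaming (_↑_ to _↑ᵖ_) public

    iterate-↑ : ∀ k x → iterate k x ≈ x ↑ (Q ℕ.^ k)
    iterate-↑ zero    x = sym (*-identityʳ x)
    iterate-↑ (suc k) x = trans (↑-cong Q (iterate-↑ k x)) (trans (sym (↑-* x (Q ℕ.^ k) Q))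
      (reflexive (≡.cong (x ↑_) (ℕₚ.*-comm (Q ℕ.^ k) Q))))

    N : Poly
    N = X ↑ᵖ m F[X].- F[X].1#

    act-N : ∀ x → act N x ≈ 0#
    act-N x = trans (act-X↑-1 m x) (x≈y⇒x-y≈0 (trans (iterate-↑ m x)
      (trans (reflexive (≡.cong (x ↑_) Q^m≡q^n)) (↑qⁿ x))))

    Monic-X↑ : ∀ k → Monic k (X ↑ᵖ k)
    Monic-X↑ zero    = Monic-1
    Monic-X↑ (suc k) = Monic-* {1} {k} {X} {X ↑ᵖ k}
      (record { leading = refl ; below = λ { (suc zero) (s≤s ()) ; (suc (suc i)) _ → refl } }) (Monic-X↑ k)

    Monic-X↑-1 : ∀ {k} → 1 ≤ k → Monic k (X ↑ᵖ k F[X].- F[X].1#)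
    Monic-X↑-1 {k} (s≤s _) = record
      { leading = trans (coef-+ (X ↑ᵖ k) (F[X].- F[X].1#) k) (trans (+-identityʳ _) (Monic-X↑ k .leading))
      ; below   = λ { (suc i) le → trans (coef-+ (X ↑ᵖ k) (F[X].- F[X].1#) (suc i)) (trans (+-identityʳ _) (Monic-X↑ k .below (suc i) le)) } }

    private
      -- `act p` is a linearised polynomial, with exponents Q ^ i only. Its recursion raises the
      -- argument to the power Q, hence the general offset `j`; since 2 ≤ Q, the term of exponent Q
      -- ^ j lies below the top one and does not affect the leading coefficient.
      Lead-act : ∀ d j p → Below (suc d) p → Lead (Q ℕ.^ (j ℕ.+ d)) (proj₁ (coef p d)) (λ x → act p (x ↑ (Q ℕ.^ j)))
      Lead-act d j [] b = Lead-< (ℕₚ.m^n>0 Q ⦃ ℕ.>-nonZero (ℕₚ.≤-trans (s≤s z≤n) 2≤Q) ⦄ (j ℕ.+ d)) (λ x → refl)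
      Lead-act zero j (a ∷ p) b = Lead-resp (Q ℕ.^ (j ℕ.+ 0)) (*-identityʳ (proj₁ a)) (λ x → begin
          proj₁ a * x ↑ (Q ℕ.^ (j ℕ.+ 0))                      ≈⟨ *-congˡ (reflexive (≡.cong (λ s → x ↑ (Q ℕ.^ s)) (ℕₚ.+-identityʳ j))) ⟩
          proj₁ a * x ↑ (Q ℕ.^ j)                              ≈⟨ +-identityʳ _ ⟨
          proj₁ a * x ↑ (Q ℕ.^ j) + 0#                         ≈⟨ +-congˡ (act-≋ {p} {[]} (coefwise λ i → b (suc i) (s≤s z≤n)) _) ⟨
          proj₁ a * x ↑ (Q ℕ.^ j) + act p ((x ↑ (Q ℕ.^ j)) ↑ Q)  ∎)
        (Lead-scale (Q ℕ.^ (j ℕ.+ 0)) (proj₁ a) (Lead-↑ (Q ℕ.^ (j ℕ.+ 0))))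
      Lead-act (suc d) j (a ∷ p) b = Lead-resp (Q ℕ.^ (j ℕ.+ suc d)) (+-identityˡ _) (λ x → +-congˡ (act-cong p (begin
          x ↑ (Q ℕ.* Q ℕ.^ j)      ≡⟨ ≡.cong (x ↑_) (ℕₚ.*-comm Q (Q ℕ.^ j)) ⟩
          x ↑ (Q ℕ.^ j ℕ.* Q)      ≈⟨ ↑-* x (Q ℕ.^ j) Q ⟩
          (x ↑ (Q ℕ.^ j)) ↑ Q      ∎)))
        (Lead-+ (Q ℕ.^ (j ℕ.+ suc d)) (Lead-< (ℕₚ.^-monoʳ-< Q 2≤Q (ℕₚ.m<m+n j (s≤s z≤n))) (Lead-scale (Q ℕ.^ j) (proj₁ a) (Lead-↑ (Q ℕ.^ j))))
          (≡.subst (λ s → Lead (Q ℕ.^ s) (proj₁ (coef p d)) (λ x → act p (x ↑ (Q ℕ.^ suc j)))) (≡.sym (ℕₚ.+-suc j d)) (Lead-act d (suc j) p (λ i le → b (suc i) (s≤s le)))))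

    kernel-size : ∀ {d p} → Monic d p → ∀ {xs} → Unique xs → All (λ x → act p x ≈ 0#) xs → length xs ≤ Q ℕ.^ d
    kernel-size {d} {p} mp = roots≤degree (Q ℕ.^ d)
      (Lead-resp (Q ℕ.^ d) refl (λ x → act-cong p (*-identityʳ x)) (Lead-act d 0 p (mp .below)))
      (λ e → nontrivial (trans (sym (mp .leading)) e))

  -- (σⁿ − 1)/(σˡ − 1) maps the whole field into Sub q l and has at most q ^ (n ∸ l) zeros.
  Sub-size : ∀ l m → 1 ≤ l → 1 ≤ n → l ℕ.* m ≡ n →
    ∃ λ ys → Unique ys × All (Sub R q l) ys × (q ℕ.^ l ≤ length ys)
  Sub-size l m 1≤l 1≤n l*m≡n =
    map (act C) ws , AllPairsₚ.map⁺ ws! , Allₚ.map⁺ (All.universal in-Sub ws) ,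
    ℕₚ.≤-trans (ℕₚ.*-cancelʳ-≤ (q ℕ.^ l) (length ws) (q ℕ.^ k) ⦃ ℕ.>-nonZero (1≤q^ k) ⦄ bound)
      (ℕₚ.≤-reflexive (≡.sym (length-map (act C) ws)))
    where
    -- Only the sizes of `K` and of the whole field are given, so the number of elements fixed by σˡ
    -- must be derived; here σ is the q-power map and coefficients lie in `Sub q 1`.
    open OverSub 1 n (s≤s z≤n) (ℕₚ.*-identityˡ n)
    module Pp = Powers polyRing
    divides : (X ↑ᵖ l F[X].- F[X].1#) ∣ N
    divides = let (D , e) = Pp.geometric (X ↑ᵖ l) m in D , F[X].trans e (F[X].+-congʳ (F[X].trans (F[X].sym (Pp.↑-* X l m))
      (F[X].reflexive (≡.cong (X ↑ᵖ_) l*m≡n))))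
    C = proj₁ divides
    degree = cofactor-degree {C = C} (Monic-X↑-1 1≤l) (Monic-X↑-1 1≤n) (proj₂ divides)
    k = proj₁ degree
    images = many-images (act C) (act-cong C) (act-sub C) (Q ℕ.^ k) (kernel-size (proj₁ (proj₂ degree)))
    ws = proj₁ images
    ws! = proj₁ (proj₂ images)
    bound : q ℕ.^ l ℕ.* q ℕ.^ k ≤ length ws ℕ.* q ℕ.^ k
    bound = ≡.subst₂ _≤_ (≡.trans (≡.cong (q ℕ.^_) (≡.trans (≡.sym (proj₂ (proj₂ degree))) (ℕₚ.+-comm k l))) (ℕₚ.^-distribˡ-+-* q l k))
      (≡.cong (λ s → length ws ℕ.* s ℕ.^ k) (ℕₚ.^-identityʳ q)) (proj₂ (proj₂ images))
    in-Sub : ∀ w → Sub R q l (act C w)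
    in-Sub w = x-y≈0⇒x≈y (begin
      act C w ↑ (q ℕ.^ l) - act C w            ≡⟨ ≡.cong (λ s → act C w ↑ (s ℕ.^ l) - act C w) (ℕₚ.^-identityʳ q) ⟨
      act C w ↑ (Q ℕ.^ l) - act C w            ≈⟨ +-congʳ (iterate-↑ l (act C w)) ⟨
      iterate l (act C w) - act C w            ≈⟨ act-X↑-1 l (act C w) ⟨
      act (X ↑ᵖ l F[X].- F[X].1#) (act C w)    ≈⟨ act-* (X ↑ᵖ l F[X].- F[X].1#) C w ⟨
      act ((X ↑ᵖ l F[X].- F[X].1#) F[X].* C) w  ≈⟨ act-≋ (F[X].trans (F[X].*-comm _ C) (proj₂ divides)) w ⟩
      act N w                                  ≈⟨ act-N w ⟩
      0#                                       ∎)

  -- Independent families of full length span, by counting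

  module Spanning (l m : ℕ) (1≤l : 1 ≤ l) (1≤n : 1 ≤ n) (l*m≡n : l ℕ.* m ≡ n) where
    open IsSubfield (Sub-isSubfield l)
    private
      ys  = proj₁ (Sub-size l m 1≤l 1≤n l*m≡n)
      ys! = proj₁ (proj₂ (Sub-size l m 1≤l 1≤n l*m≡n))
      ysS = proj₁ (proj₂ (proj₂ (Sub-size l m 1≤l 1≤n l*m≡n)))
      ys≥ = proj₂ (proj₂ (proj₂ (Sub-size l m 1≤l 1≤n l*m≡n)))

    Independent : ∀ k → (Fin k → Carrier) → Set (c ⊔ ℓ)
    Independent k v = (a : Fin k → Carrier) → (∀ i → Sub R q l (a i)) → sumFin R k (λ i → a i * v i) ≈ 0# → ∀ i → a i ≈ 0#

    InSpan : ∀ k → (Fin k → Carrier) → Carrier → Set (c ⊔ ℓ)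
    InSpan k v y = Σ (Fin k → Carrier) λ a → (∀ i → Sub R q l (a i)) × (sumFin R k (λ i → a i * v i) ≈ y)

    private
      cons : ∀ {k} {A : Set c} → A → (Fin k → A) → Fin (suc k) → A
      cons x f Fin.zero    = x
      cons x f (Fin.suc i) = f i

      cons-Sub : ∀ {k x} {f : Fin k → Carrier} → Sub R q l x → (∀ i → Sub R q l (f i)) → ∀ i → Sub R q l (cons x f i)
      cons-Sub Sx Sf Fin.zero    = Sx
      cons-Sub Sx Sf (Fin.suc i) = Sf i

      sum-sub : ∀ k (a b v : Fin k → Carrier) →
        sumFin R k (λ i → (a i - b i) * v i) ≈ sumFin R k (λ i → a i * v i) - sumFin R k (λ i → b i * v i)
      sum-sub zero    a b v = sym (-‿inverseʳ 0#)
      sum-sub (suc k) a b v = trans (+-congˡ (sum-sub k _ _ _))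
        (solve 5 (λ a b v x y → (a :- b) :* v :+ (x :- y) := (a :* v :+ x) :- (b :* v :+ y)) refl (a Fin.zero) (b Fin.zero) (v Fin.zero) _ _)

      combinations : ∀ k → (Fin k → Carrier) → List Carrier
      combinations zero    v = 0# ∷ []
      combinations (suc k) v = cartesianProductWith (λ a y → a * v Fin.zero + y) ys (combinations k (λ i → v (Fin.suc i)))

      length-combinations : ∀ k v → length (combinations k v) ≡ length ys ℕ.^ k
      length-combinations zero    v = ≡.refl
      length-combinations (suc k) v = ≡.trans (length-cartesianProductWith _ ys _) (≡.cong (length ys ℕ.*_) (length-combinations k _))

      combinations-InSpan : ∀ k v → All (InSpan k v) (combinations k v)
      combinations-InSpan zero    v = ((λ ()) , (λ ()) , refl) ∷ []
      combinations-InSpan (suc k) v = go ysS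
        where
        go : ∀ {zs} → All (Sub R q l) zs →
          All (InSpan (suc k) v) (cartesianProductWith (λ a y → a * v Fin.zero + y) zs (combinations k (λ i → v (Fin.suc i))))
        go [] = []
        go (Sz ∷ Szs) = Allₚ.++⁺ (Allₚ.map⁺ (All.map (λ (a , Sa , e) → cons _ a , cons-Sub Sz Sa , +-congˡ e)
          (combinations-InSpan k (λ i → v (Fin.suc i))))) (go Szs)

      pairs : ∀ {zs} → All (Sub R q l) zs → Unique zs → AllPairs (λ a b → Sub R q l a × Sub R q l b × ¬ (a ≈ b)) zs
      pairs [] [] = []
      pairs (Sz ∷ Szs) (z∉ ∷ zs!) = All.zipWith (λ (Sw , z≉w) → Sz , Sw , z≉w) (Szs , z∉) ∷ pairs Szs zs!

      -- If two equal combinations had different first coefficients, their difference would be a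
      -- non-trivial relation; if the first coefficients agree, they cancel and the remaining
      -- vectors are independent.
      combinations! : ∀ k v → Independent k v → Unique (combinations k v)
      combinations! zero    v ind = [] ∷ []
      combinations! (suc k) v ind = Unique-cartesianProductWith {P = InSpan k v⁺} (λ a y → a * v₀ + y) apart
        (λ _ _ y≉y′ e → y≉y′ (+-cancelˡ _ _ _ e))
        (pairs ysS ys!)
        (combinations! k v⁺ λ a Sa e i → ind (cons 0# a) (cons-Sub has0 Sa) (trans (+-cong (zeroˡ v₀) e) (+-identityˡ 0#)) (Fin.suc i))
        (combinations-InSpan k v⁺)
        where
        v₀ = v Fin.zero
        v⁺ = λ i → v (Fin.suc i)
        apart : ∀ {a b y z} → Sub R q l a × Sub R q l b × ¬ (a ≈ b) → InSpan k v⁺ y → InSpan k v⁺ z → ¬ (a * v₀ + y ≈ b * v₀ + z)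
        apart {a} {b} {y} {z} (Sa , Sb , a≉b) (f , Sf , ey) (g , Sg , ez) e = a≉b (x-y≈0⇒x≈y
          (ind (λ i → cons a f i - cons b g i)
               (λ i → +-cl (cons-Sub Sa Sf i) (neg-cl (cons-Sub Sb Sg i)))
               (trans (sum-sub (suc k) (cons a f) (cons b g) v) (x≈y⇒x-y≈0 (trans (+-congˡ ey) (trans e (+-congˡ (sym ez))))))
               Fin.zero))

    -- `ys` has at least q ^ l elements, so independence yields at least q ^ (l m) = q ^ n distinct
    -- combinations, which exhaust the field.
    independent⇒spanning : ∀ v → Independent m v → ∀ y → InSpan m v y
    independent⇒spanning v ind y = All.lookupWith (λ (a , Sa , e) y≈z → a , Sa , trans e (sym y≈z))
      (combinations-InSpan m v)
      (Unique-⊆-length≥⇒⊇ (combinations! m v ind) (λ {x} _ → ∈univ x)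
        (ℕₚ.≤-trans (ℕₚ.≤-reflexive (≡.trans length-univ (≡.trans (≡.cong (q ℕ.^_) (≡.sym l*m≡n)) (≡.sym (ℕₚ.^-*-assoc q l m)))))
        (ℕₚ.≤-trans (ℕₚ.^-monoˡ-≤ m ys≥) (ℕₚ.≤-reflexive (≡.sym (length-combinations m v))))) (∈univ y))

  -- The criterion for normality and the sieve by factors of Xᵐ - 1

  module Normality (l m : ℕ) (1≤l : 1 ≤ l) (1≤n : 1 ≤ n) (l*m≡n : l ℕ.* m ≡ n) where
    open OverSub l m 1≤l l*m≡n public
    open Spanning l m 1≤l 1≤n l*m≡n
    open Factor

    1≤m : 1 ≤ m
    1≤m = ℕₚ.n≢0⇒n>0 λ { ≡.refl → ℕₚ.<⇒≢ 1≤n (≡.trans (≡.sym (ℕₚ.*-zeroʳ l)) l*m≡n) }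

    private
      coef-tabulate : ∀ {k} (g : Fin k → CommutativeRing.Carrier subring) i → coef (tabulate g) (toℕ i) ≡ g i
      coef-tabulate g Fin.zero    = ≡.refl
      coef-tabulate g (Fin.suc i) = coef-tabulate (λ i → g (Fin.suc i)) i

      act-tabulate : ∀ k (g : Fin k → CommutativeRing.Carrier subring) j x →
        act (tabulate g) (x ↑ (q ℕ.^ (l ℕ.* j))) ≈ sumFin R k (λ i → proj₁ (g i) * x ↑ (q ℕ.^ (l ℕ.* (j ℕ.+ toℕ i))))
      act-tabulate zero    g j x = refl
      act-tabulate (suc k) g j x = +-cong
        (*-congˡ (reflexive (≡.cong (λ s → x ↑ (q ℕ.^ (l ℕ.* s))) (≡.sym (ℕₚ.+-identityʳ j)))))
        (begin
          act (tabulate g⁺) ((x ↑ (q ℕ.^ (l ℕ.* j))) ↑ Q)   ≈⟨ act-cong (tabulate g⁺) step ⟩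
          act (tabulate g⁺) (x ↑ (q ℕ.^ (l ℕ.* suc j)))     ≈⟨ act-tabulate k g⁺ (suc j) x ⟩
          sumFin R k (λ i → proj₁ (g⁺ i) * x ↑ (q ℕ.^ (l ℕ.* (suc j ℕ.+ toℕ i))))
            ≈⟨ sumFin-cong k (λ i → *-congˡ (reflexive (≡.cong (λ s → x ↑ (q ℕ.^ (l ℕ.* s))) (≡.sym (ℕₚ.+-suc j (toℕ i)))))) ⟩
          sumFin R k (λ i → proj₁ (g⁺ i) * x ↑ (q ℕ.^ (l ℕ.* (j ℕ.+ suc (toℕ i)))))  ∎)
        where
        g⁺ = λ i → g (Fin.suc i)
        step : (x ↑ (q ℕ.^ (l ℕ.* j))) ↑ Q ≈ x ↑ (q ℕ.^ (l ℕ.* suc j))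
        step = trans (sym (↑-* x (q ℕ.^ (l ℕ.* j)) Q)) (reflexive (≡.cong (x ↑_)
          (≡.trans (≡.sym (ℕₚ.^-distribˡ-+-* q (l ℕ.* j) l)) (≡.cong (q ℕ.^_) (≡.trans (ℕₚ.+-comm (l ℕ.* j) l) (≡.sym (ℕₚ.*-suc l j)))))))

    AvoidsKernel : Carrier → Factor m N → Set ℓ
    AvoidsKernel x f = ¬ (act (M f) x ≈ 0#)

    private
      Below-tabulate : ∀ {k} (g : Fin k → CommutativeRing.Carrier subring) → Below k (tabulate g)
      Below-tabulate {zero}  g i       _        = refl
      Below-tabulate {suc k} g (suc i) (s≤s le) = Below-tabulate (λ i → g (Fin.suc i)) i le

      tabulate-annihilates : ∀ (g : Fin m → CommutativeRing.Carrier subring) x →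
        sumFin R m (λ i → proj₁ (g i) * x ↑ (q ℕ.^ (l ℕ.* toℕ i))) ≈ 0# → act (tabulate g) x ≈ 0#
      tabulate-annihilates g x e = begin
        act (tabulate g) x                        ≈⟨ act-cong (tabulate g) (*-identityʳ x) ⟨
        act (tabulate g) (x ↑ 1)                  ≡⟨ ≡.cong (λ s → act (tabulate g) (x ↑ (q ℕ.^ s))) (ℕₚ.*-zeroʳ l) ⟨
        act (tabulate g) (x ↑ (q ℕ.^ (l ℕ.* 0)))  ≈⟨ act-tabulate m g 0 x ⟩
        sumFin R m (λ i → proj₁ (g i) * x ↑ (q ℕ.^ (l ℕ.* toℕ i)))  ≈⟨ e ⟩
        0#                                        ∎

      -- A non-zero `D` killing x would generate, together with N, the cofactor `M f` of some
      -- factor, which would then kill x as well.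
      no-relation : (cov : Cover m N) → ∀ x → All (AvoidsKernel x) (Cover.factors cov) → ∀ D → Below m D →
        act D x ≈ 0# → ¬ ¬ (D ≋ F[X].0#)
      no-relation cov x avoids D bD Dx≈0 D≉0 = Allₚ.All¬⇒¬Any
        (All.map (λ {f} avoid (u , v , comb) → avoid (act-combination u v {D} {N} {M f} comb Dx≈0 (act-N x))) avoids)
        (Cover.covers cov D D≉0 bD)

    -- A linear relation among the conjugates of x is a polynomial of degree below m annihilating x,
    -- which `no-relation` excludes; spanning follows by counting.
    normal : (cov : Cover m N) → ∀ x → All (AvoidsKernel x) (Cover.factors cov) → NormalOver R q l m x
    normal cov x avoids = independent , independent⇒spanning _ independent
      where
      independent : Independent m (λ i → x ↑ (q ℕ.^ (l ℕ.* toℕ i)))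
      -- `covers` refutes only non-zero polynomials, so vanishing comes doubly negated; decidable
      -- equality removes the negations coefficient by coefficient.
      independent a Sa e i = decidable-stable (a i ≟ 0#) λ ai≉0 →
        no-relation cov x avoids (tabulate g) (Below-tabulate g) (tabulate-annihilates g x e)
          λ D≋0 → ai≉0 (trans (reflexive (≡.cong proj₁ (≡.sym (coef-tabulate g i)))) (D≋0 .at (toℕ i)))
        where
        g : Fin m → CommutativeRing.Carrier subring
        g i = a i , Sa i

    in-kernel? : ∀ (f : Factor m N) x → Dec (act (M f) x ≈ 0#)
    in-kernel? f x = act (M f) x ≟ 0#

    kernel : Factor m N → List Carrier
    kernel f = filter (in-kernel? f) univ

    ∈kernel : ∀ (f : Factor m N) {x} → act (M f) x ≈ 0# → x ∈ kernel f
    ∈kernel f e = ∈ₚ.∈-filter⁺ setoid (in-kernel? f) (λ x≈y Mx≈0 → trans (act-cong (M f) (sym x≈y)) Mx≈0) (∈univ _) e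

    Q^deg*Q^codeg : ∀ (f : Factor m N) → Q ℕ.^ deg f ℕ.* Q ℕ.^ codeg f ≡ q ℕ.^ n
    Q^deg*Q^codeg f = ≡.trans (≡.sym (ℕₚ.^-distribˡ-+-* Q (deg f) (codeg f))) (≡.trans (≡.cong (Q ℕ.^_) (deg-sum f)) Q^m≡q^n)

    length-kernel : ∀ (f : Factor m N) → length (kernel f) ℕ.* Q ≤ q ℕ.^ n
    length-kernel f = ℕₚ.≤-trans
      (ℕₚ.*-mono-≤ (kernel-size (monic-M f) (AllPairsₚ.filter⁺ (in-kernel? f) univ!) (Allₚ.all-filter (in-kernel? f) univ)) Q≤)
      (ℕₚ.≤-reflexive (≡.trans (ℕₚ.*-comm (Q ℕ.^ codeg f) _) (Q^deg*Q^codeg f)))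
      where
      Q≤ : Q ≤ Q ℕ.^ deg f
      Q≤ = ℕₚ.≤-trans (ℕₚ.≤-reflexive (≡.sym (ℕₚ.^-identityʳ Q)))
        (ℕₚ.^-monoʳ-≤ Q ⦃ ℕ.>-nonZero (1≤q^ l) ⦄ (1≤deg f))

    abnormal : Cover m N → FewAbnormal R q n l m
    abnormal cov = kernels factors , ≡.subst (λ s → length (kernels factors) ℕ.* Q ≤ s ℕ.* q ℕ.^ n) total-deg (bound factors) ,
      λ x x∉ → normal cov x (outside factors x∉)
      where
      open Cover cov
      kernels : List (Factor m N) → List Carrier
      kernels fs = concat (map kernel fs)
      bound : ∀ (fs : List (Factor m N)) → length (kernels fs) ℕ.* Q ≤ sum (map deg fs) ℕ.* q ℕ.^ n
      bound [] = z≤n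
      bound (f ∷ fs) = ℕₚ.≤-trans (ℕₚ.≤-reflexive (≡.trans (≡.cong (ℕ._* Q) (length-++ (kernel f)))
          (ℕₚ.*-distribʳ-+ Q (length (kernel f)) (length (kernels fs)))))
        -- Each factor is charged deg f ≥ 1 times q ^ n although once would do: then the charges sum
        -- to m q ^ n by `total-deg`.
        (ℕₚ.≤-trans (ℕₚ.+-mono-≤ (ℕₚ.≤-trans (length-kernel f)
            (ℕₚ.≤-trans (ℕₚ.≤-reflexive (≡.sym (ℕₚ.*-identityˡ _))) (ℕₚ.*-monoˡ-≤ (q ℕ.^ n) (1≤deg f)))) (bound fs))
          (ℕₚ.≤-reflexive (≡.sym (ℕₚ.*-distribʳ-+ (q ℕ.^ n) (deg f) _))))
      outside : ∀ (fs : List (Factor m N)) {x} → ¬ (x ∈ kernels fs) → All (AvoidsKernel x) fs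
      outside []       x∉ = []
      outside (f ∷ fs) x∉ = (λ e → x∉ (Anyₚ.++⁺ˡ (∈kernel f e))) ∷ outside fs (λ x∈ → x∉ (Anyₚ.++⁺ʳ (kernel f) x∈))

    avoids? : ∀ (f : Factor m N) x → Dec (AvoidsKernel x f)
    avoids? f x = ¬? (in-kernel? f x)

    sieve : List (Factor m N) → List Carrier → List Carrier
    sieve []       xs = xs
    sieve (f ∷ fs) xs = filter (avoids? f) (sieve fs xs)

    sieve! : ∀ (fs : List (Factor m N)) {xs} → Unique xs → Unique (sieve fs xs)
    sieve! []       xs! = xs!
    sieve! (f ∷ fs) xs! = AllPairsₚ.filter⁺ (avoids? f) (sieve! fs xs!)

    AvoidsKernel-resp : ∀ (f : Factor m N) {x y} → x ≈ y → AvoidsKernel x f → AvoidsKernel y f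
    AvoidsKernel-resp f x≈y avoid e = avoid (trans (act-cong (M f) x≈y) e)

    ∈-sieve⁻ : ∀ (fs : List (Factor m N)) {xs x} → x ∈ sieve fs xs → x ∈ xs × All (AvoidsKernel x) fs
    ∈-sieve⁻ []       x∈ = x∈ , []
    ∈-sieve⁻ (f ∷ fs) {xs} x∈ = proj₁ (∈-sieve⁻ fs (proj₁ split)) , proj₂ split ∷ proj₂ (∈-sieve⁻ fs (proj₁ split))
      where split = ∈ₚ.∈-filter⁻ setoid {P = λ x → AvoidsKernel x f} (avoids? f) (AvoidsKernel-resp f) {xs = sieve fs xs} x∈

    ∈-sieve⁺ : ∀ (fs : List (Factor m N)) {xs x} → x ∈ xs → All (AvoidsKernel x) fs → x ∈ sieve fs xs
    ∈-sieve⁺ []       x∈ []                = x∈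
    ∈-sieve⁺ (f ∷ fs) x∈ (avoid ∷ avoids) = ∈ₚ.∈-filter⁺ setoid {P = λ x → AvoidsKernel x f} (avoids? f) (AvoidsKernel-resp f) (∈-sieve⁺ fs x∈ avoids) avoid

    removed : Factor m N → List Carrier → List Carrier
    removed f xs = filter (in-kernel? f) xs

    length-sieve : ∀ (f : Factor m N) xs → length xs ≡ length (removed f xs) ℕ.+ length (filter (avoids? f) xs)
    length-sieve f xs = length-filter-split (in-kernel? f) (avoids? f) (λ h → h) (λ h g → g h) xs

    ∏P : List (Factor m N) → Poly
    ∏P []       = F[X].1#
    ∏P (f ∷ fs) = P f F[X].* ∏P fs

    private
      -- `∏P fs` contains each `P g`, so `M g` times it is a multiple of N, which acts as zero.
      annihilates : ∀ (fs : List (Factor m N)) → All (λ f → ∀ u → act (M f) (act (∏P fs) u) ≈ 0#) fs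
      annihilates []       = []
      annihilates (f ∷ fs) = (λ u → begin
          act (M f) (act (P f F[X].* ∏P fs) u)    ≈⟨ act-cong (M f) (act-* (P f) (∏P fs) u) ⟩
          act (M f) (act (P f) (act (∏P fs) u))   ≈⟨ act-* (M f) (P f) _ ⟨
          act (M f F[X].* P f) (act (∏P fs) u)    ≈⟨ act-≋ (F[X].trans (F[X].*-comm (M f) (P f)) (PM≋N f)) _ ⟩
          act N (act (∏P fs) u)                   ≈⟨ act-N _ ⟩
          0#                                      ∎)
        ∷ All.map (λ {g} ann u → trans (act-cong (M g) (trans (act-≋ (F[X].*-comm (P f) (∏P fs)) u) (act-* (∏P fs) (P f) u)))
            (ann (act (P f) u))) (annihilates fs)

      All-cartesianProductWith : ∀ {a b p r} {A : Set a} {B : Set b} {P : B → Set p} {T : Carrier → Set r} (f : A → B → Carrier) →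
        (∀ x {y} → P y → T (f x y)) → ∀ xs {ys} → All P ys → All T (cartesianProductWith f xs ys)
      All-cartesianProductWith f h []       Pys = []
      All-cartesianProductWith f h (x ∷ xs) Pys = Allₚ.++⁺ (Allₚ.map⁺ (All.map (h x) Pys)) (All-cartesianProductWith f h xs Pys)

    -- Translating by the image of ∏P fs preserves the sieved set but separates the cosets of the kernel of M f.
    removed-bound : ∀ (f : Factor m N) (fs : List (Factor m N)) → Coprime (P f) (∏P fs) →
      Q ℕ.^ deg f ℕ.* length (removed f (sieve fs univ)) ≤ length (sieve fs univ)
    removed-bound f fs (u , v , comb) = ℕₚ.≤-trans (ℕₚ.*-monoˡ-≤ (length ts) many)
      (ℕₚ.≤-trans (ℕₚ.≤-reflexive (≡.sym (length-cartesianProductWith translate ws ts)))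
        (Unique-⊆⇒length≤ translates! λ x∈ → All.lookupWith (λ y∈ x≈y → ∈ₚ.∈-resp-≈ setoid (sym x≈y) y∈) translates⊆ x∈))
      where
      A = ∏P fs
      ts = removed f (sieve fs univ)
      -- `act (M f) x` is killed by `A` and, as P f times M f is N, also by `P f`; these are
      -- coprime. So the kernel of the product M f A is no larger than that of `M f`.
      ker-MA : ∀ {x} → act (M f F[X].* A) x ≈ 0# → act (M f) x ≈ 0#
      ker-MA {x} e = begin
        act (M f) x         ≈⟨ act-1 (act (M f) x) ⟨
        act F[X].1# (act (M f) x)  ≈⟨ act-combination u v {P f} {A} comb
           (trans (sym (act-* (P f) (M f) x)) (trans (act-≋ (PM≋N f) x) (act-N x)))
           (trans (sym (act-* A (M f) x)) (trans (act-≋ (F[X].*-comm A (M f)) x) e)) ⟩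
        0#                  ∎
      T = act (M f F[X].* A)
      -- The kernel of `T` has at most Q ^ codeg elements, so `T` takes at least Q ^ deg values, and
      -- `ws` holds one preimage of each.
      images = many-images T (act-cong (M f F[X].* A)) (act-sub (M f F[X].* A)) (Q ℕ.^ codeg f)
        (λ xs! zeros → kernel-size (monic-M f) xs! (All.map ker-MA zeros))
      ws = proj₁ images
      many : Q ℕ.^ deg f ≤ length ws
      many = ℕₚ.*-cancelʳ-≤ (Q ℕ.^ deg f) (length ws) (Q ℕ.^ codeg f)
        ⦃ ℕ.>-nonZero (ℕₚ.m^n>0 Q ⦃ ℕ.>-nonZero (1≤q^ l) ⦄ (codeg f)) ⦄
        (ℕₚ.≤-trans (ℕₚ.≤-reflexive (Q^deg*Q^codeg f)) (proj₂ (proj₂ images)))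
      translate : Carrier → Carrier → Carrier
      translate w t = act A w + t
      image-translate : ∀ (g : Factor m N) w t → act (M g) (translate w t) ≈ act (M g) (act A w) + act (M g) t
      image-translate g w t = act-additive (M g) (act A w) t
      translates! : Unique (cartesianProductWith translate ws ts)
      -- `M f` kills every t in `ts`, so it sends the translate of t by w to T w; translates by
      -- different representatives are thereby distinct.
      translates! = Unique-cartesianProductWith {P = λ t → act (M f) t ≈ 0#} {T = λ s t → ¬ (s ≈ t)} translate
        (λ {w} {w′} {t} {t′} Tw≉Tw′ Mt≈0 Mt′≈0 e → Tw≉Tw′ (begin
          T w                                  ≈⟨ act-* (M f) A w ⟩
          act (M f) (act A w)                  ≈⟨ +-identityʳ _ ⟨
          act (M f) (act A w) + 0#             ≈⟨ +-congˡ Mt≈0 ⟨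
          act (M f) (act A w) + act (M f) t    ≈⟨ image-translate f w t ⟨
          act (M f) (translate w t)            ≈⟨ act-cong (M f) e ⟩
          act (M f) (translate w′ t′)          ≈⟨ image-translate f w′ t′ ⟩
          act (M f) (act A w′) + act (M f) t′  ≈⟨ +-congˡ Mt′≈0 ⟩
          act (M f) (act A w′) + 0#            ≈⟨ +-identityʳ _ ⟩
          act (M f) (act A w′)                 ≈⟨ act-* (M f) A w′ ⟨
          T w′                                 ∎))
        (λ _ _ t≉t′ e → t≉t′ (+-cancelˡ _ _ _ e))
        (proj₁ (proj₂ images)) (AllPairsₚ.filter⁺ (in-kernel? f) (sieve! fs univ!))
        (Allₚ.all-filter (in-kernel? f) (sieve fs univ))
      ts-sieved : All (λ t → All (AvoidsKernel t) fs) ts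
      ts-sieved = All.tabulateₛ setoid λ x∈ → proj₂ (∈-sieve⁻ fs (proj₁ (∈ₚ.∈-filter⁻ setoid (in-kernel? f)
        (λ x≈y Mx≈0 → trans (act-cong (M f) (sym x≈y)) Mx≈0) {xs = sieve fs univ} x∈)))
      avoid-translate : ∀ (g : Factor m N) w t → (∀ u → act (M g) (act A u) ≈ 0#) → AvoidsKernel t g → AvoidsKernel (translate w t) g
      avoid-translate g w t ann avoid e = avoid (begin
        act (M g) t                            ≈⟨ +-identityˡ _ ⟨
        0# + act (M g) t                       ≈⟨ +-congʳ (ann w) ⟨
        act (M g) (act A w) + act (M g) t      ≈⟨ image-translate g w t ⟨
        act (M g) (translate w t)              ≈⟨ e ⟩
        0#                                     ∎)
      avoid-translates : ∀ w t (gs : List (Factor m N)) → All (λ g → ∀ u → act (M g) (act A u) ≈ 0#) gs → All (AvoidsKernel t) gs →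
        All (AvoidsKernel (translate w t)) gs
      avoid-translates w t []       []           []                = []
      avoid-translates w t (g ∷ gs) (ann ∷ anns) (avoid ∷ avoids) = avoid-translate g w t ann avoid ∷ avoid-translates w t gs anns avoids
      translates⊆ : All (_∈ sieve fs univ) (cartesianProductWith translate ws ts)
      translates⊆ = All-cartesianProductWith translate
        (λ w {t} avoids → ∈-sieve⁺ fs (∈univ _) (avoid-translates w t fs (annihilates fs) avoids)) ws ts-sieved

  -- Normality over the base field, l = 1

  module Sieve (1≤n : 1 ≤ n) where
    open Normality 1 n (s≤s z≤n) 1≤n (ℕₚ.*-identityˡ n)
    open Factor
    private
      module S = IsSubfield (Sub-isSubfield 1)
      module F = CommutativeRing subring

    Linear : Factor n N → Set
    Linear f = deg f ≡ 1

    constant : Factor n N → Carrier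
    constant f = proj₁ (coef (P f) 0)

    private
      monic-1 : ∀ (f : Factor n N) → Linear f → Monic 1 (P f)
      monic-1 f lin = ≡.subst (λ d → Monic d (P f)) lin (monic-P f)

      coprime-∏P : ∀ (f : Factor n N) (gs : List (Factor n N)) → All (λ g → Coprime (P f) (P g)) gs → Coprime (P f) (∏P gs)
      coprime-∏P f []       []         = Coprime-1 (P f)
      coprime-∏P f (g ∷ gs) (cop ∷ cops) = Coprime-* {P f} {P g} {∏P gs} cop (coprime-∏P f gs cops)

    root : Factor n N → Carrier
    root f = - constant f

    -- Evaluation at ζ is the action in which σ is replaced by multiplication by ζ.
    root↑n : ∀ (f : Factor n N) → Linear f → root f ↑ n ≈ 1#
    root↑n f lin = x-y≈0⇒x≈y (begin
      ζ ↑ n - 1#                    ≈⟨ +-congʳ (iterate-1 n) ⟨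
      At.iterate n 1# - 1#          ≈⟨ At.act-X↑-1 n 1# ⟨
      At.act N 1#                   ≈⟨ At.act-≋ (F[X].trans (F[X].sym (PM≋N f)) (F[X].*-congʳ {M f} (linear-≋ (monic-1 f lin)))) 1# ⟩
      At.act (P′ F[X].* M f) 1#     ≈⟨ At.act-* P′ (M f) 1# ⟩
      At.act P′ (At.act (M f) 1#)   ≈⟨ solve 3 (λ a e y → a :* y :+ (e :* ((:- a) :* y) :+ con (pos 0)) := a :* y :- e :* (a :* y)) refl (constant f) 1# _ ⟩
      constant f * y - 1# * (constant f * y)  ≈⟨ x≈y⇒x-y≈0 (sym (*-identityˡ _)) ⟩
      0#                            ∎)
      where
      ζ = root f
      P′ = coef (P f) 0 ∷ F.1# ∷ []
      module At = Action R (Sub-isSubfield 1) (ζ *_) *-congˡ (distribˡ ζ)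
        (λ {a} x _ → solve 3 (λ z a x → z :* (a :* x) := a :* (z :* x)) refl ζ a x)
      y = At.act (M f) 1#
      iterate-1 : ∀ k → At.iterate k 1# ≈ ζ ↑ k
      iterate-1 zero    = refl
      iterate-1 (suc k) = *-congˡ (iterate-1 k)

    root≉0 : ∀ (f : Factor n N) → Linear f → ¬ (root f ≈ 0#)
    root≉0 f lin e = nontrivial (trans (sym (root↑n f lin)) (trans (↑-cong n e) (0↑ 1≤n)))

    root↑q-1 : ∀ (f : Factor n N) → Linear f → root f ↑ (q ℕ.∸ 1) ≈ 1#
    root↑q-1 f lin = *-cancelˡ (root≉0 f lin) (begin
      root f ↑ suc (q ℕ.∸ 1)  ≡⟨ ≡.cong (root f ↑_) (ℕₚ.m+[n∸m]≡n (ℕₚ.≤-trans (s≤s z≤n) 2≤q)) ⟩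
      root f ↑ q              ≡⟨ ≡.cong (root f ↑_) (ℕₚ.^-identityʳ q) ⟨
      root f ↑ (q ℕ.^ 1)      ≈⟨ S.neg-cl (proj₂ (coef (P f) 0)) ⟩
      root f                  ≈⟨ *-identityʳ _ ⟨
      root f * 1#             ∎)

    -- A root satisfies both ζ ↑ n = 1 and ζ ↑ (q - 1) = 1, hence is a zero of X ^ g - 1 for the gcd
    -- `g`, and that polynomial has at most g zeros.
    distinct-roots≤gcd : {fs : List (Factor n N)} → All Linear fs → AllPairs (λ f g → ¬ (constant f ≈ constant g)) fs →
      length fs ≤ ℕ-gcd n (q ℕ.∸ 1)
    distinct-roots≤gcd {fs} lin distinct = ℕₚ.≤-trans (ℕₚ.≤-reflexive (≡.sym (length-map root fs)))
      (roots≤degree g leading₁ nontrivial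
        (AllPairsₚ.map⁺ (AllPairs.map (λ a≉b e → a≉b (-‿injective e)) distinct))
        (Allₚ.map⁺ (All.map (λ {f} lf → trans (+-congˡ (*-identityʳ _)) (x≈y⇒x-y≈0 (↑-gcd n (q ℕ.∸ 1) (root↑n f lf) (root↑q-1 f lf)))) lin)))
      where
      g = ℕ-gcd n (q ℕ.∸ 1)
      leading₁ : Lead g 1# (λ x → x ↑ g + - 1# * 1#)
      leading₁ = Lead-resp g (trans (+-congˡ (zeroʳ _)) (+-identityʳ 1#)) (λ _ → refl)
        (Lead-+ g (Lead-↑ g) (Lead-scale g (- 1#) (Lead-< {f = λ _ → 1#} (gcd>0 1≤n) (λ _ → refl))))
        where
        gcd>0 : 1 ≤ n → 0 < g
        gcd>0 1≤n = ℕₚ.n≢0⇒n>0 λ e → ℕₚ.<⇒≢ 1≤n (≡.sym (gcd[m,n]≡0⇒m≡0 {n} {q ℕ.∸ 1} e))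
      -‿injective : ∀ {x y} → - x ≈ - y → x ≈ y
      -‿injective {x} {y} e = trans (solve 1 (λ x → x := :- (:- x)) refl x) (trans (-‿cong e) (solve 1 (λ x → :- (:- x) := x) refl y))

    -- Distinct constants make each new factor coprime to the product of the others, so
    -- `removed-bound` applies to the list already sieved and the proportions 1 - 1/Q multiply.
    linear-sieve : (fs : List (Factor n N)) → All Linear fs → AllPairs (λ f g → ¬ (constant f ≈ constant g)) fs →
      (Q ℕ.∸ 1) ℕ.^ length fs ℕ.* q ℕ.^ n ≤ Q ℕ.^ length fs ℕ.* length (sieve fs univ)
    linear-sieve [] [] [] = ℕₚ.≤-reflexive (≡.cong (1 ℕ.*_) (≡.sym length-univ))
    linear-sieve (f ∷ fs) (lf ∷ lfs) (a∉ ∷ distinct) = step Q (Q ℕ.^ length fs) ((Q ℕ.∸ 1) ℕ.^ length fs)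
      (length-sieve f (sieve fs univ))
      (≡.subst (λ e → e ℕ.* length (removed f (sieve fs univ)) ≤ length (sieve fs univ))
        (≡.trans (≡.cong (Q ℕ.^_) lf) (ℕₚ.*-identityʳ Q))
        (removed-bound f fs (coprime-∏P f fs (All.zipWith (λ {g} (lg , a≉b) → linear-coprime (monic-1 f lf) (monic-1 g lg) a≉b) (lfs , a∉)))))
      (linear-sieve fs lfs distinct)
      where
      -- q r ≤ s = r + t gives (q − 1) s ≤ q t.
      step : ∀ Q A B {s r t x} → s ≡ r ℕ.+ t → Q ℕ.* r ≤ s → B ℕ.* x ≤ A ℕ.* s → (Q ℕ.∸ 1) ℕ.* B ℕ.* x ≤ Q ℕ.* A ℕ.* t
      step zero    A B _ _ _ = z≤n
      step (suc k) A B {s} {r} {t} {x} ≡.refl le ih = begin′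
        k ℕ.* B ℕ.* x            ≤⟨ ℕₚ.≤-trans (ℕₚ.≤-reflexive (ℕₚ.*-assoc k B x)) (ℕₚ.*-monoʳ-≤ k ih) ⟩
        k ℕ.* (A ℕ.* s)          ≤⟨ ℕₚ.≤-reflexive (≡.trans (≡.sym (ℕₚ.*-assoc k A s)) (≡.trans (≡.cong (ℕ._* s) (ℕₚ.*-comm k A)) (ℕₚ.*-assoc A k s))) ⟩
        A ℕ.* (k ℕ.* s)          ≤⟨ ℕₚ.*-monoʳ-≤ A (ℕₚ.+-cancelˡ-≤ s _ _ (ℕₚ.≤-trans
                                      (ℕₚ.≤-reflexive (ℕₚ.*-distribˡ-+ (suc k) r t)) (ℕₚ.+-monoˡ-≤ (suc k ℕ.* t) le))) ⟩
        A ℕ.* (suc k ℕ.* t)      ≤⟨ ℕₚ.≤-reflexive (≡.trans (≡.sym (ℕₚ.*-assoc A (suc k) t)) (≡.cong (ℕ._* t) (ℕₚ.*-comm A (suc k)))) ⟩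
        suc k ℕ.* A ℕ.* t        ∎′
        where open ℕₚ.≤-Reasoning renaming (begin_ to begin′_; _∎ to _∎′) using (step-≤)

    -- A maximal factor of degree at least 2 is coprime to the product of linear ones, so it removes
    -- at most 1/Q² of `S`. The loss is measured against `S` and not against what the other `fs`
    -- leave, since the `fs` may repeat and need not be coprime to each other; hence the losses add.
    large-sieve : (ls fs : List (Factor n N)) → All Linear ls → All (λ f → 2 ≤ deg f) fs →
      Q ℕ.^ 2 ℕ.* length (sieve ls univ) ≤ Q ℕ.^ 2 ℕ.* length (sieve fs (sieve ls univ)) ℕ.+ length fs ℕ.* length (sieve ls univ)
    large-sieve ls []       lin [] = ℕₚ.≤-reflexive (≡.sym (ℕₚ.+-identityʳ _))
    large-sieve ls (f ∷ fs) lin (2≤f ∷ large) = step (Q ℕ.^ 2) (length fs) (length-sieve f (sieve fs S))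
      (ℕₚ.≤-trans (ℕₚ.*-mono-≤ (ℕₚ.^-monoʳ-≤ Q ⦃ ℕ.>-nonZero (1≤q^ 1) ⦄ 2≤f) fewer)
        (removed-bound f ls (coprime-∏P f ls (All.map (λ {g} lg → maximal-coprime-linear (maximal f) (monic-P f) 2≤f (monic-1 g lg)) lin))))
      (large-sieve ls fs lin large)
      where
      S = sieve ls univ
      resp-ker : ∀ {x y} → x ≈ y → act (M f) x ≈ 0# → act (M f) y ≈ 0#
      resp-ker x≈y e = trans (act-cong (M f) (sym x≈y)) e
      fewer : length (removed f (sieve fs S)) ≤ length (removed f S)
      fewer = Unique-⊆⇒length≤ (AllPairsₚ.filter⁺ (in-kernel? f) (sieve! fs (sieve! ls univ!))) λ x∈ →
        let split = ∈ₚ.∈-filter⁻ setoid (in-kernel? f) resp-ker {xs = sieve fs S} x∈ in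
        ∈ₚ.∈-filter⁺ setoid (in-kernel? f) resp-ker (proj₁ (∈-sieve⁻ fs (proj₁ split))) (proj₂ split)
      step : ∀ Q k {g r t s} → g ≡ r ℕ.+ t → Q ℕ.* r ≤ s → Q ℕ.* s ≤ Q ℕ.* g ℕ.+ k ℕ.* s → Q ℕ.* s ≤ Q ℕ.* t ℕ.+ suc k ℕ.* s
      step Q k {g} {r} {t} {s} ≡.refl le ih = ℕₚ.≤-trans ih (ℕₚ.≤-trans
        (ℕₚ.≤-reflexive (≡.trans (≡.cong (ℕ._+ k ℕ.* s) (≡.trans (ℕₚ.*-distribˡ-+ Q r t) (ℕₚ.+-comm (Q ℕ.* r) (Q ℕ.* t)))) (ℕₚ.+-assoc (Q ℕ.* t) _ _)))
        (ℕₚ.+-monoʳ-≤ (Q ℕ.* t) (ℕₚ.+-monoˡ-≤ (k ℕ.* s) le)))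

    private
      Split : List (Factor n N) → Set (c ⊔ ℓ)
      Split fs = ∃₂ λ (ls : List (Σ (Factor n N) Linear)) (bs : List (Σ (Factor n N) λ f → 2 ≤ deg f)) →
        (2 ℕ.* length bs ≤ sum (map deg fs)) ×
        (∀ x → All (λ f → AvoidsKernel x (proj₁ f)) ls → All (λ f → AvoidsKernel x (proj₁ f)) bs → All (AvoidsKernel x) fs)

      split : ∀ fs → Split fs
      split [] = [] , [] , z≤n , λ x _ _ → []
      split (f ∷ fs) = add (split fs) (deg f ℕₚ.≟ 1)
        where
        add : Split fs → Dec (deg f ≡ 1) → Split (f ∷ fs)
        add (ls , bs , le , combine) (yes lin) = (f , lin) ∷ ls , bs , ℕₚ.≤-trans le (ℕₚ.m≤n+m _ (deg f)) ,
          λ { x (af ∷ als) abs → af ∷ combine x als abs }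
        add (ls , bs , le , combine) (no ¬lin) = ls , (f , 2≤f) ∷ bs ,
          ℕₚ.≤-trans (ℕₚ.≤-reflexive (ℕₚ.*-suc 2 (length bs))) (ℕₚ.+-mono-≤ 2≤f le) ,
          λ { x als (af ∷ abs) → af ∷ combine x als abs }
          where
          2≤f : 2 ≤ deg f
          2≤f = ℕₚ.≤∧≢⇒< (1≤deg f) (λ e → ¬lin (≡.sym e))

    normal-elements : Cover n N → ManyNormal R q n
    normal-elements cov = sieve fs S , sieve! fs (sieve! ks univ!) , All.tabulateₛ setoid is-normal ,
      length S , length ks , length fs ,
      distinct-roots≤gcd ks-linear ks-distinct ,
      ≡.subst₂ (λ a b → 2 ℕ.* a ≤ b) (≡.sym (length-map proj₁ bs)) total-deg le ,
      ≡.subst (λ z → (z ℕ.∸ 1) ℕ.^ length ks ℕ.* q ℕ.^ n ≤ z ℕ.^ length ks ℕ.* length S) (ℕₚ.^-identityʳ q) (linear-sieve ks ks-linear ks-distinct) ,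
      ≡.subst (λ z → z ℕ.^ 2 ℕ.* length S ≤ z ℕ.^ 2 ℕ.* length (sieve fs S) ℕ.+ length fs ℕ.* length S) (ℕₚ.^-identityʳ q)
        (large-sieve ks fs ks-linear (Allₚ.map⁺ (All.universal proj₂ bs)))
      where
      open Cover cov
      parts = split factors
      ls = proj₁ parts
      bs = proj₁ (proj₂ parts)
      le = proj₁ (proj₂ (proj₂ parts))
      combine = proj₂ (proj₂ (proj₂ parts))
      -- When the characteristic divides n, linear factors recur. Only one per root enters the
      -- sieve, `avoid-same` transferring its condition to the others, because it is the number of
      -- distinct roots that the gcd bounds.
      reps = distinct-representatives (λ f → constant (proj₁ f)) ls
      ws = proj₁ reps
      ks = map proj₁ ws
      fs = map proj₁ bs
      ks-linear : All Linear ks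
      ks-linear = Allₚ.map⁺ (All.universal proj₂ ws)
      ks-distinct : AllPairs (λ f g → ¬ (constant f ≈ constant g)) ks
      ks-distinct = AllPairsₚ.map⁺ (proj₁ (proj₂ reps))
      S = sieve ks univ
      is-normal : ∀ {x} → x ∈ sieve fs S → NormalOver R q 1 n x
      is-normal {x} x∈ = normal cov x (combine x (All.map (λ {f} → avoid-all f in-ws) (proj₂ (proj₂ reps))) (Allₚ.map⁻ (proj₂ in-fs)))
        where
        in-fs = ∈-sieve⁻ fs x∈
        in-ws : All (λ f → AvoidsKernel x (proj₁ f)) ws
        in-ws = Allₚ.map⁻ (proj₂ (∈-sieve⁻ ks (proj₁ in-fs)))
        avoid-same : ∀ f g → Linear f → Linear g → constant f ≈ constant g → AvoidsKernel x g → AvoidsKernel x f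
        avoid-same f g lf lg a≈b avoid e = avoid (trans (act-≋ (linear-cofactor-unique (monic-1 g lg) (monic-1 f lf) (sym a≈b) (PM≋N g) (PM≋N f)) x) e)
        avoid-all : (f : Σ (Factor n N) Linear) → ∀ {vs} → All (λ f → AvoidsKernel x (proj₁ f)) vs →
          Any (λ w → constant (proj₁ f) ≈ constant (proj₁ w)) vs → AvoidsKernel x (proj₁ f)
        avoid-all (f , lf) {(g , lg) ∷ _} (avoid ∷ _)  (here a≈b)  = avoid-same f g lf lg a≈b avoid
        avoid-all f                       (_ ∷ avoids) (there any) = avoid-all f avoids any

    many-normal : ¬ ¬ ManyNormal R q n
    many-normal cont = cover (suc n) ℕₚ.≤-refl (Monic-X↑-1 1≤n) λ cov → cont (normal-elements cov)

  few-abnormal : ∀ l m → 1 ≤ l → 1 ≤ n → l ℕ.* m ≡ n → ¬ ¬ FewAbnormal R q n l m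
  few-abnormal l m 1≤l 1≤n l*m≡n cont = cover (suc m) ℕₚ.≤-refl (Monic-X↑-1 1≤m) λ cov → cont (abnormal cov)
    where open Normality l m 1≤l 1≤n l*m≡n

-- Numerical estimates

module Arithmetic where
  open import Data.Nat using (_+_; _*_; >-nonZero)
  open ℕₚ
  open ℕ∣ using (_∣_; divides; ∣⇒≤)
  open ≡ using (refl; sym; trans; cong; subst)
  open ≤-Reasoning

  -- Bernoulli's inequality 1 - a/q ≤ (1 - 1/q) ^ a with q = `suc k` and b = q - a, cleared of
  -- denominators.
  bernoulli : ∀ k a b → a + b ≡ suc k → b * suc k ^ a ≤ k ^ a * suc k
  bernoulli k zero    b refl = ≤-reflexive (trans (*-identityʳ (suc k)) (sym (*-identityˡ (suc k))))
  bernoulli k (suc a) b eq = begin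
    b * (suc k * suc k ^ a)      ≡⟨ regroup b (suc k) (suc k ^ a) ⟩
    -- This is b q ≤ k (b + 1), which holds because b ≤ k.
    (b + k * b) * suc k ^ a      ≤⟨ *-monoˡ-≤ (suc k ^ a) (+-monoˡ-≤ (k * b) (≤-trans (m≤n+m b a) (≤-reflexive (suc-injective eq)))) ⟩
    (k + k * b) * suc k ^ a      ≡⟨ cong (_* suc k ^ a) (sym (*-suc k b)) ⟩
    k * suc b * suc k ^ a        ≡⟨ *-assoc k (suc b) (suc k ^ a) ⟩
    k * (suc b * suc k ^ a)      ≤⟨ *-monoʳ-≤ k (bernoulli k a (suc b) (trans (+-suc a b) eq)) ⟩
    k * (k ^ a * suc k)          ≡⟨ *-assoc k (k ^ a) (suc k) ⟨
    k * k ^ a * suc k            ∎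
    where
    regroup : ∀ b q x → b * (q * x) ≡ (q * b) * x
    regroup = solve-∀

  -- (1 − 1/q) ^ (a + a′) ≥ (1 − a/q)(1 − a′/q): Bernoulli's inequality for each half of the exponent.
  power-ratio : ∀ k a a′ b b′ c d → a + b ≡ suc k → a′ + b′ ≡ suc k →
    c * suc k ^ 2 ≤ d * (b * b′) → c * suc k ^ (a + a′) ≤ d * k ^ (a + a′)
  power-ratio k a a′ b b′ c d eq eq′ le = *-cancelˡ-≤ (q ^ 2) (begin
    q ^ 2 * (c * q ^ (a + a′))            ≡⟨ cong (λ z → q ^ 2 * (c * z)) (^-distribˡ-+-* q a a′) ⟩
    q ^ 2 * (c * (q ^ a * q ^ a′))        ≡⟨ r₁ (q ^ 2) c (q ^ a) (q ^ a′) ⟩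
    (c * q ^ 2) * (q ^ a * q ^ a′)        ≤⟨ *-monoˡ-≤ (q ^ a * q ^ a′) le ⟩
    (d * (b * b′)) * (q ^ a * q ^ a′)     ≡⟨ r₂ d b b′ (q ^ a) (q ^ a′) ⟩
    d * ((b * q ^ a) * (b′ * q ^ a′))     ≤⟨ *-monoʳ-≤ d (*-mono-≤ (bernoulli k a b eq) (bernoulli k a′ b′ eq′)) ⟩
    d * ((k ^ a * q) * (k ^ a′ * q))      ≡⟨ r₃ d (k ^ a) (k ^ a′) q ⟩
    q ^ 2 * (d * (k ^ a * k ^ a′))        ≡⟨ cong (λ z → q ^ 2 * (d * z)) (^-distribˡ-+-* k a a′) ⟨
    q ^ 2 * (d * k ^ (a + a′))            ∎)
    where
    q = suc k
    r₁ : ∀ Q c x y → Q * (c * (x * y)) ≡ (c * Q) * (x * y)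
    r₁ = solve-∀
    r₂ : ∀ d b b′ x y → (d * (b * b′)) * (x * y) ≡ d * ((b * x) * (b′ * y))
    r₂ = solve-∀
    r₃ : ∀ d x y q → d * ((x * q) * (y * q)) ≡ q * (q * 1) * (d * (x * y))
    r₃ = solve-∀

  halves : ∀ g → ∃ λ a → (g ≡ a + a) ⊎ (g ≡ a + suc a)
  halves zero = 0 , inj₁ refl
  halves (suc g) with halves g
  ... | a , inj₁ refl = a , inj₂ (sym (+-suc a a))
  ... | a , inj₂ refl = suc a , inj₁ refl

  -- (c + 1) b is (c + 1) q - (c + 1) a, and (c + 1) a ≤ q - e. It is applied with c = 1 when a is
  -- about q/2 and with c = 3 when a is about q/4; `e` preserves the gain from rounding.
  complement : ∀ c a b {e q} → a + b ≡ q → suc c * a + e ≤ q → c * q + e ≤ suc c * b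
  complement c a b {e} refl le = +-cancelˡ-≤ (suc c * a) _ _ (begin
    suc c * a + (c * (a + b) + e)     ≡⟨ r₁ (suc c * a) (c * (a + b)) e ⟩
    (suc c * a + e) + c * (a + b)     ≤⟨ +-monoˡ-≤ (c * (a + b)) le ⟩
    suc c * (a + b)                   ≡⟨ *-distribˡ-+ (suc c) a b ⟩
    suc c * a + suc c * b             ∎)
    where
    r₁ : ∀ x y e → x + (y + e) ≡ (x + e) + y
    r₁ = solve-∀

  private
    -- With q = 8 + t (below: q = 9 + t) the difference of the two sides is a polynomial in t with non-negative coefficients.
    product-bound₁ : ∀ k → 7 ≤ k → ∀ b b′ → 1 * suc k + 1 ≤ 2 * b → 1 * suc k ≤ 2 * b′ → 2 * suc k ^ 2 ≤ (suc k + 1) * (b * b′)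
    product-bound₁ k 7≤k b b′ = subst (λ k → 1 * suc k + 1 ≤ 2 * b → 1 * suc k ≤ 2 * b′ → 2 * suc k ^ 2 ≤ (suc k + 1) * (b * b′))
      (m+[n∸m]≡n 7≤k) (λ le le′ → *-cancelˡ-≤ 4 (begin
        4 * (2 * (8 + t) ^ 2)                                          ≤⟨ m≤m+n _ ((8 + t) * (17 + 10 * t + t * t)) ⟩
        4 * (2 * (8 + t) ^ 2) + (8 + t) * (17 + 10 * t + t * t)        ≡⟨ r₁ t ⟩
        ((8 + t) + 1) * ((1 * (8 + t) + 1) * (1 * (8 + t)))            ≤⟨ *-monoʳ-≤ ((8 + t) + 1) (*-mono-≤ le le′) ⟩
        ((8 + t) + 1) * ((2 * b) * (2 * b′))                           ≡⟨ r₂ ((8 + t) + 1) b b′ ⟩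
        4 * (((8 + t) + 1) * (b * b′))                                 ∎))
      where
      t = k ∸ 7
      r₁ : ∀ t → 4 * (2 * ((8 + t) * ((8 + t) * 1))) + (8 + t) * (17 + 10 * t + t * t) ≡ ((8 + t) + 1) * ((1 * (8 + t) + 1) * (1 * (8 + t)))
      r₁ = solve-∀
      r₂ : ∀ x b b′ → x * ((2 * b) * (2 * b′)) ≡ 4 * (x * (b * b′))
      r₂ = solve-∀

    product-bound₂ : ∀ k → 8 ≤ k → ∀ b b′ → (3 * suc k + 1 ≤ 4 * b × 3 * suc k + 1 ≤ 4 * b′) ⊎ (3 * suc k + 3 ≤ 4 * b × 3 * suc k ≤ 4 * b′ + 1) →
      (suc k + 3) * suc k ^ 2 ≤ 2 * (suc k + 1) * (b * b′)
    product-bound₂ k 8≤k b b′ = subst (λ k → (3 * suc k + 1 ≤ 4 * b × 3 * suc k + 1 ≤ 4 * b′) ⊎ (3 * suc k + 3 ≤ 4 * b × 3 * suc k ≤ 4 * b′ + 1) →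
        (suc k + 3) * suc k ^ 2 ≤ 2 * (suc k + 1) * (b * b′)) (m+[n∸m]≡n 8≤k) λ
      { (inj₁ (le , le′)) → *-cancelˡ-≤ 16 (begin
          16 * (((9 + t) + 3) * (9 + t) ^ 2)                                          ≤⟨ m≤m+n _ (2 * (t * t * t) + 36 * (t * t) + 176 * t + 128) ⟩
          16 * (((9 + t) + 3) * (9 + t) ^ 2) + (2 * (t * t * t) + 36 * (t * t) + 176 * t + 128)  ≡⟨ r₁ t ⟩
          2 * ((9 + t) + 1) * ((3 * (9 + t) + 1) * (3 * (9 + t) + 1))                 ≤⟨ *-monoʳ-≤ (2 * ((9 + t) + 1)) (*-mono-≤ le le′) ⟩
          2 * ((9 + t) + 1) * ((4 * b) * (4 * b′))                                    ≡⟨ r₃ (2 * ((9 + t) + 1)) b b′ ⟩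
          16 * (2 * ((9 + t) + 1) * (b * b′))                                         ∎)
      ; (inj₂ (le , le′)) → *-cancelˡ-≤ 16 (begin
          16 * (((9 + t) + 3) * (9 + t) ^ 2)                                          ≤⟨ m≤m+n _ (2 * (t * t * t) + 36 * (t * t) + 168 * t + 48) ⟩
          16 * (((9 + t) + 3) * (9 + t) ^ 2) + (2 * (t * t * t) + 36 * (t * t) + 168 * t + 48)  ≡⟨ r₂ t ⟩
          2 * ((9 + t) + 1) * ((3 * (9 + t) + 3) * (26 + 3 * t))                      ≤⟨ *-monoʳ-≤ (2 * ((9 + t) + 1)) (*-mono-≤ le (+-cancelʳ-≤ 1 (26 + 3 * t) (4 * b′) (≤-trans (≤-reflexive (r₄ t)) le′))) ⟩
          2 * ((9 + t) + 1) * ((4 * b) * (4 * b′))                                    ≡⟨ r₃ (2 * ((9 + t) + 1)) b b′ ⟩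
          16 * (2 * ((9 + t) + 1) * (b * b′))                                         ∎) }
      where
      t = k ∸ 8
      r₁ : ∀ t → 16 * (((9 + t) + 3) * ((9 + t) * ((9 + t) * 1))) + (2 * (t * t * t) + 36 * (t * t) + 176 * t + 128) ≡ 2 * ((9 + t) + 1) * ((3 * (9 + t) + 1) * (3 * (9 + t) + 1))
      r₁ = solve-∀
      r₂ : ∀ t → 16 * (((9 + t) + 3) * ((9 + t) * ((9 + t) * 1))) + (2 * (t * t * t) + 36 * (t * t) + 168 * t + 48) ≡ 2 * ((9 + t) + 1) * ((3 * (9 + t) + 3) * (26 + 3 * t))
      r₂ = solve-∀
      r₃ : ∀ x b b′ → x * ((4 * b) * (4 * b′)) ≡ 16 * (x * (b * b′))
      r₃ = solve-∀
      r₄ : ∀ t → 26 + 3 * t + 1 ≡ 3 * (9 + t)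
      r₄ = solve-∀

  power-bound₁ : ∀ {q} k g → suc k ≡ q → 7 ≤ k → g ≤ k → 2 * q ^ g ≤ (q + 1) * k ^ g
  power-bound₁ k g refl 7≤k g≤k with halves g
  ... | a , inj₁ refl = power-ratio k a a b b 2 (suc k + 1) eq eq (product-bound₁ k 7≤k b b lower (≤-trans (m≤m+n _ 1) lower))
    where
    b = suc k ∸ a
    eq : a + b ≡ suc k
    eq = m+[n∸m]≡n (≤-trans (m≤m+n a a) (m≤n⇒m≤1+n g≤k))
    r : ∀ a → 2 * a + 1 ≡ suc (a + a)
    r = solve-∀
    lower : 1 * suc k + 1 ≤ 2 * b
    lower = complement 1 a b eq (≤-trans (≤-reflexive (r a)) (s≤s g≤k))
  -- The odd exponent splits as a + (a + 1), with complements `suc b` and `b`; the surplus 2 in the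
  -- bound for the larger complement pays for the smaller one.
  ... | a , inj₂ refl = power-ratio k a (suc a) (suc b) b 2 (suc k + 1) eq (trans (sym (+-suc a b)) eq) (product-bound₁ k 7≤k (suc b) b
          (≤-trans (+-monoʳ-≤ (1 * suc k) (s≤s z≤n)) lower) (+-cancelʳ-≤ 2 _ _ (≤-trans lower (≤-reflexive (r′ b)))))
    where
    b = suc k ∸ suc a
    eq : a + suc b ≡ suc k
    eq = trans (+-suc a b) (m+[n∸m]≡n (≤-trans (m≤n+m (suc a) a) (m≤n⇒m≤1+n g≤k)))
    r : ∀ a → 2 * a + 2 ≡ suc (a + suc a)
    r = solve-∀
    r′ : ∀ b → 2 * suc b ≡ 2 * b + 2
    r′ = solve-∀
    lower : 1 * suc k + 2 ≤ 2 * suc b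
    lower = complement 1 a (suc b) eq (≤-trans (≤-reflexive (r a)) (s≤s g≤k))

  power-bound₂ : ∀ {q} k g → suc k ≡ q → 8 ≤ k → 2 * g ≤ k → (q + 3) * q ^ g ≤ 2 * (q + 1) * k ^ g
  power-bound₂ k g refl 8≤k 2g≤k with halves g
  ... | a , inj₁ refl = power-ratio k a a b b (suc k + 3) (2 * (suc k + 1)) eq eq (product-bound₂ k 8≤k b b (inj₁ (lower , lower)))
    where
    b = suc k ∸ a
    eq : a + b ≡ suc k
    eq = m+[n∸m]≡n (≤-trans (m≤m+n a a) (≤-trans (m≤n*m (a + a) 2) (m≤n⇒m≤1+n 2g≤k)))
    r : ∀ a → 4 * a + 1 ≡ suc (2 * (a + a))
    r = solve-∀
    lower : 3 * suc k + 1 ≤ 4 * b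
    lower = complement 3 a b eq (≤-trans (≤-reflexive (r a)) (s≤s 2g≤k))
  -- As 4 (b + 1) ≥ 3q + 3, the smaller complement satisfies only 4b ≥ 3q - 1, which is why
  -- `product-bound₂` has a second alternative.
  ... | a , inj₂ refl = power-ratio k a (suc a) (suc b) b (suc k + 3) (2 * (suc k + 1)) eq (trans (sym (+-suc a b)) eq)
          (product-bound₂ k 8≤k (suc b) b (inj₂ (lower , +-cancelʳ-≤ 3 _ _ (≤-trans lower (≤-reflexive (r′ b))))))
    where
    b = suc k ∸ suc a
    eq : a + suc b ≡ suc k
    eq = trans (+-suc a b) (m+[n∸m]≡n (≤-trans (m≤n+m (suc a) a) (≤-trans (m≤n*m (a + suc a) 2) (m≤n⇒m≤1+n 2g≤k))))
    r : ∀ a → 4 * a + 3 ≡ suc (2 * (a + suc a))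
    r = solve-∀
    r′ : ∀ b → 4 * suc b ≡ 4 * b + 1 + 3
    r′ = solve-∀
    lower : 3 * suc k + 3 ≤ 4 * suc b
    lower = complement 3 a (suc b) eq (≤-trans (≤-reflexive (r a)) (s≤s 2g≤k))

  gcd≤ʳ : ∀ n k → 1 ≤ k → ℕ-gcd n k ≤ k
  gcd≤ʳ n k 1≤k = ∣⇒≤ ⦃ >-nonZero 1≤k ⦄ (gcd[m,n]∣n n k)

  -- The gcd divides k, and cofactor 1 would make k itself a divisor of n, so the cofactor is at
  -- least 2.
  2gcd≤ : ∀ n k → 1 ≤ k → ¬ (k ∣ n) → 2 * ℕ-gcd n k ≤ k
  2gcd≤ n k 1≤k k∤n with gcd[m,n]∣n n k
  ... | divides zero          k≡ = contradiction (subst (1 ≤_) k≡ 1≤k) λ ()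
  ... | divides (suc zero)    k≡ = contradiction (subst (_∣ n) (trans (sym (+-identityʳ _)) (sym k≡)) (gcd[m,n]∣m n k)) k∤n
  ... | divides (suc (suc t)) k≡ = ≤-trans (*-monoˡ-≤ (ℕ-gcd n k) (s≤s (s≤s (z≤n {t})))) (≤-reflexive (sym k≡))

  -- With X = q ^ (2 + j) and Y = q ^ j the invariant is B ≤ (E/3)(1/q³ + ... + 1/q ^ (2 + j)),
  -- multiplied by 3(q - 1) q ^ (2 + j); the extra `E` on the left avoids writing E (q ^ j - 1). The
  -- new summand is b ≤ (E/3)/q ^ (3 + j).
  geometric-step : ∀ {q} k E X Y B b → suc k ≡ q → 3 * k * X * B + E ≤ E * Y → 3 * (b * (q * X)) ≤ E →
    3 * k * (q * X) * (B + b) + E ≤ E * (q * Y)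
  geometric-step k E X Y B b refl old new = begin
    3 * k * (suc k * X) * (B + b) + E                          ≡⟨ r₁ k E X B b (suc k) ⟩
    suc k * (3 * k * X * B) + (k * (3 * (b * (suc k * X))) + E)  ≤⟨ +-monoʳ-≤ (suc k * (3 * k * X * B)) (+-monoˡ-≤ E (*-monoʳ-≤ k new)) ⟩
    suc k * (3 * k * X * B) + (k * E + E)                      ≡⟨ r₂ k E (3 * k * X * B) ⟩
    suc k * (3 * k * X * B + E)                                ≤⟨ *-monoʳ-≤ (suc k) old ⟩
    suc k * (E * Y)                                            ≡⟨ r₃ (suc k) E Y ⟩
    E * (suc k * Y)                                            ∎
    where
    r₁ : ∀ k E X B b q → 3 * k * (q * X) * (B + b) + E ≡ q * (3 * k * X * B) + (k * (3 * (b * (q * X))) + E)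
    r₁ = solve-∀
    r₂ : ∀ k E x → suc k * x + (k * E + E) ≡ suc k * (x + E)
    r₂ = solve-∀
    r₃ : ∀ q E Y → q * (E * Y) ≡ E * (q * Y)
    r₃ = solve-∀

  ratio-transfer : ∀ {q} k g c d {s T} → suc k ≡ q → c * q ^ g ≤ d * k ^ g → k ^ g * T ≤ q ^ g * s → c * T ≤ d * s
  ratio-transfer k g c d {s} {T} refl le le′ = *-cancelˡ-≤ (suc k ^ g) ⦃ >-nonZero (m^n>0 (suc k) g) ⦄ (begin
    suc k ^ g * (c * T)     ≡⟨ r (suc k ^ g) c T ⟩
    (c * suc k ^ g) * T     ≤⟨ *-monoˡ-≤ T le ⟩
    d * k ^ g * T           ≡⟨ *-assoc d (k ^ g) T ⟩
    d * (k ^ g * T)         ≤⟨ *-monoʳ-≤ d le′ ⟩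
    d * (suc k ^ g * s)     ≡⟨ r′ d (suc k ^ g) s ⟩
    suc k ^ g * (d * s)     ∎)
    where
    r : ∀ x c T → x * (c * T) ≡ (c * x) * T
    r = solve-∀
    r′ : ∀ d x s → d * (x * s) ≡ x * (d * s)
    r′ = solve-∀

  -- Eliminates s from  c T ≤ d s  and  Q (1 − r / Q) s ≤ Q G,  with both sides moved so that no subtraction occurs.
  combine : ∀ Q n r s G T c d → 2 * r ≤ n → n ≤ 2 * Q → Q * s ≤ Q * G + r * s → c * T ≤ d * s →
    2 * Q * (c * T) ≤ n * (c * T) + 2 * Q * (d * G)
  combine Q n r s G T c d 2r≤n n≤2Q sieve dense = begin
    2 * Q * (c * T)                  ≡⟨ cong (_* (c * T)) (m+[n∸m]≡n n≤2Q) ⟨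
    (n + D) * (c * T)                ≡⟨ *-distribʳ-+ (c * T) n D ⟩
    n * (c * T) + D * (c * T)        ≤⟨ +-monoʳ-≤ (n * (c * T)) (*-monoʳ-≤ D dense) ⟩
    n * (c * T) + D * (d * s)        ≡⟨ cong (n * (c * T) +_) (r₂ D d s) ⟩
    n * (c * T) + d * (D * s)        ≤⟨ +-monoʳ-≤ (n * (c * T)) (*-monoʳ-≤ d Ds≤) ⟩
    n * (c * T) + d * (2 * Q * G)    ≡⟨ cong (n * (c * T) +_) (r₂ d (2 * Q) G) ⟩
    n * (c * T) + 2 * Q * (d * G)    ∎
    where
    -- With Q = q², D/(2Q) = 1 - n/(2q²) is the proportion left by the non-linear factors; n ≤ 2Q
    -- makes the truncated difference exact.
    D = 2 * Q ∸ n
    r₂ : ∀ D d s → D * (d * s) ≡ d * (D * s)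
    r₂ = solve-∀
    r₃ : ∀ Q G r s → 2 * (Q * G + r * s) ≡ (2 * r) * s + 2 * Q * G
    r₃ = solve-∀
    Ds≤ : D * s ≤ 2 * Q * G
    Ds≤ = +-cancelˡ-≤ (n * s) _ _ (begin
      n * s + D * s              ≡⟨ *-distribʳ-+ s n D ⟨
      (n + D) * s                ≡⟨ cong (_* s) (m+[n∸m]≡n n≤2Q) ⟩
      2 * Q * s                  ≡⟨ *-assoc 2 Q s ⟩
      2 * (Q * s)                ≤⟨ *-monoʳ-≤ 2 sieve ⟩
      2 * (Q * G + r * s)        ≡⟨ r₃ Q G r s ⟩
      (2 * r) * s + 2 * Q * G    ≤⟨ +-monoˡ-≤ (2 * Q * G) (*-monoˡ-≤ s 2r≤n) ⟩
      n * s + 2 * Q * G          ∎)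

  assemble-odd : ∀ {q} k n r s G T B CN → suc k ≡ q → 7 ≤ k → 2 * r ≤ n → q ^ 2 * s ≤ q ^ 2 * G + r * s →
    2 * T ≤ (q + 1) * s → G ≤ CN + B → 3 * k * q ^ 2 * B ≤ n * T →
    200 * (T * q ^ 2) ≤ CN * (100 * q ^ 2 * (q + 1)) + 145 * n * T
  assemble-odd k n r s G T B CN refl 7≤k 2r≤n sieve dense G≤ B≤ with ≤-total n (2 * suc k ^ 2)
  -- For n ≥ 2q² the claimed lower bound for `CN` is not positive, since 1.45 n already exceeds 2q².
  ... | inj₂ 2Q≤n = ≤-trans (begin
    200 * (T * Q)       ≡⟨ e₁ T Q ⟩
    100 * (2 * Q) * T   ≤⟨ *-monoˡ-≤ T (*-mono-≤ (m≤m+n 100 45) 2Q≤n) ⟩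
    145 * n * T         ∎) (m≤n+m _ _)
    where
    Q = suc k ^ 2
    e₁ : ∀ T Q → 200 * (T * Q) ≡ 100 * (2 * Q) * T
    e₁ = solve-∀
  ... | inj₁ n≤2Q = *-cancelˡ-≤ 2 (begin
    2 * (200 * (T * Q))                                    ≡⟨ e₁ T Q ⟩
    100 * (2 * Q * (2 * T))                                ≤⟨ *-monoʳ-≤ 100 (combine Q n r s G T 2 (suc k + 1) 2r≤n n≤2Q sieve dense) ⟩
    100 * (n * (2 * T) + 2 * Q * ((suc k + 1) * G))        ≤⟨ *-monoʳ-≤ 100 (+-monoʳ-≤ (n * (2 * T)) (*-monoʳ-≤ (2 * Q) (*-monoʳ-≤ (suc k + 1) G≤))) ⟩
    100 * (n * (2 * T) + 2 * Q * ((suc k + 1) * (CN + B)))  ≡⟨ e₂ n T Q (suc k + 1) CN B ⟩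
    2 * (CN * (100 * Q * (suc k + 1)) + 100 * (n * T)) + 2 * (100 * (suc k + 1) * (Q * B))  ≤⟨ +-monoʳ-≤ (2 * (CN * (100 * Q * (suc k + 1)) + 100 * (n * T))) (*-monoʳ-≤ 2 tail) ⟩
    2 * (CN * (100 * Q * (suc k + 1)) + 100 * (n * T)) + 2 * (45 * (n * T))  ≡⟨ e₃ (CN * (100 * Q * (suc k + 1))) n T ⟩
    2 * (CN * (100 * Q * (suc k + 1)) + 145 * n * T)       ∎)
    where
    Q = suc k ^ 2
    e₁ : ∀ T Q → 2 * (200 * (T * Q)) ≡ 100 * (2 * Q * (2 * T))
    e₁ = solve-∀
    e₂ : ∀ n T Q p CN B → 100 * (n * (2 * T) + 2 * Q * (p * (CN + B))) ≡ 2 * (CN * (100 * Q * p) + 100 * (n * T)) + 2 * (100 * p * (Q * B))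
    e₂ = solve-∀
    e₃ : ∀ x n T → 2 * (x + 100 * (n * T)) + 2 * (45 * (n * T)) ≡ 2 * (x + 145 * n * T)
    e₃ = solve-∀
    e₄ : ∀ t → 100 * ((8 + t) + 1) + (45 + 35 * t) ≡ 45 * (3 * (7 + t))
    e₄ = solve-∀
    e₅ : ∀ k Q B → 45 * (3 * k) * (Q * B) ≡ 45 * (3 * k * Q * B)
    e₅ = solve-∀
    -- In fractions, (q + 1)/(3(q - 1)) ≤ 0.45: the price of all l ≥ 3 relative to n/(q²(q + 1)).
    coefficient : ∀ k → 7 ≤ k → 100 * (suc k + 1) ≤ 45 * (3 * k)
    coefficient k 7≤k = subst (λ k → 100 * (suc k + 1) ≤ 45 * (3 * k)) (m+[n∸m]≡n 7≤k)
      (≤-trans (m≤m+n _ (45 + 35 * (k ∸ 7))) (≤-reflexive (e₄ (k ∸ 7))))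
    tail : 100 * (suc k + 1) * (Q * B) ≤ 45 * (n * T)
    tail = begin
      100 * (suc k + 1) * (Q * B)   ≤⟨ *-monoˡ-≤ (Q * B) (coefficient k 7≤k) ⟩
      45 * (3 * k) * (Q * B)        ≡⟨ e₅ k Q B ⟩
      45 * (3 * k * Q * B)          ≤⟨ *-monoʳ-≤ 45 B≤ ⟩
      45 * (n * T)                  ∎

  assemble-even : ∀ {q} k n r s G T B b CN → suc k ≡ q → 8 ≤ k → 2 * r ≤ n → q ^ 2 * s ≤ q ^ 2 * G + r * s →
    (q + 3) * T ≤ 2 * (q + 1) * s → G ≤ CN + (b + B) → 3 * k * q ^ 2 * B ≤ n * T → 2 * (b * q ^ 2) ≤ n * T →
    T * (100 * q ^ 2 * (q + 1) + 200 * q ^ 2) ≤ CN * (200 * q ^ 2 * (q + 1)) + 172 * n * (q + 1) * T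
  assemble-even k n r s G T B b CN refl 8≤k 2r≤n sieve dense G≤ B≤ b≤ with ≤-total n (2 * suc k ^ 2)
  -- For n ≥ 2q² the claim is again vacuous: 1/2 + 1/(q + 1) is crudely at most 3/2, while 0.86 n/q²
  -- is at least 1.72.
  ... | inj₂ 2Q≤n = ≤-trans (begin
    T * (100 * Q * p + 200 * Q)          ≤⟨ *-monoʳ-≤ T (+-monoʳ-≤ (100 * Q * p) (≤-trans (≤-reflexive (sym (*-identityʳ (200 * Q)))) (*-monoʳ-≤ (200 * Q) (s≤s z≤n)))) ⟩
    T * (100 * Q * p + 200 * Q * p)      ≡⟨ e₁ T Q p ⟩
    150 * (2 * Q) * p * T                ≤⟨ *-monoˡ-≤ T (*-monoˡ-≤ p (*-mono-≤ (m≤m+n 150 22) 2Q≤n)) ⟩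
    172 * n * p * T                      ∎) (m≤n+m _ _)
    where
    Q = suc k ^ 2
    p = suc k + 1
    e₁ : ∀ T Q p → T * (100 * Q * p + 200 * Q * p) ≡ 150 * (2 * Q) * p * T
    e₁ = solve-∀
  ... | inj₁ n≤2Q = begin
    T * (100 * Q * p + 200 * Q)                                                ≡⟨ e₁ T Q (suc k) ⟩
    50 * (2 * Q * ((suc k + 3) * T))                                           ≤⟨ *-monoʳ-≤ 50 (combine Q n r s G T (suc k + 3) (2 * p) 2r≤n n≤2Q sieve dense) ⟩
    50 * (n * ((suc k + 3) * T) + 2 * Q * (2 * p * G))                         ≤⟨ *-monoʳ-≤ 50 (+-monoʳ-≤ (n * ((suc k + 3) * T)) (*-monoʳ-≤ (2 * Q) (*-monoʳ-≤ (2 * p) G≤))) ⟩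
    50 * (n * ((suc k + 3) * T) + 2 * Q * (2 * p * (CN + (b + B))))            ≡⟨ e₂ n T Q (suc k + 3) p CN b B ⟩
    -- The three losses in units of p n T, out of 200: at most 60 for the non-linear factors at l =
    -- 1, 100 for l = 2 and 9 for l ≥ 3. The total 169 stays below 172.
    CN * (200 * Q * p) + (50 * (suc k + 3) * (n * T) + (100 * p * (2 * (b * Q)) + 200 * p * (Q * B)))
      ≤⟨ +-monoʳ-≤ (CN * (200 * Q * p)) (+-mono-≤ (*-monoˡ-≤ (n * T) (c₁ k 8≤k)) (+-mono-≤ (*-monoʳ-≤ (100 * p) b≤) tail)) ⟩
    CN * (200 * Q * p) + (60 * p * (n * T) + (100 * p * (n * T) + 9 * p * (n * T)))  ≡⟨ cong (CN * (200 * Q * p) +_) (e₃ p n T) ⟩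
    CN * (200 * Q * p) + 169 * n * p * T                                       ≤⟨ +-monoʳ-≤ (CN * (200 * Q * p)) (*-monoˡ-≤ T (*-monoˡ-≤ p (*-monoˡ-≤ n (m≤m+n 169 3)))) ⟩
    CN * (200 * Q * p) + 172 * n * p * T                                       ∎
    where
    Q = suc k ^ 2
    p = suc k + 1
    e₁ : ∀ T Q q → T * (100 * Q * (q + 1) + 200 * Q) ≡ 50 * (2 * Q * ((q + 3) * T))
    e₁ = solve-∀
    e₂ : ∀ n T Q c p CN b B → 50 * (n * (c * T) + 2 * Q * (2 * p * (CN + (b + B)))) ≡ CN * (200 * Q * p) + (50 * c * (n * T) + (100 * p * (2 * (b * Q)) + 200 * p * (Q * B)))
    e₂ = solve-∀
    e₃ : ∀ p n T → 60 * p * (n * T) + (100 * p * (n * T) + 9 * p * (n * T)) ≡ 169 * n * p * T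
    e₃ = solve-∀
    e₄ : ∀ t → 50 * ((9 + t) + 3) + 10 * t ≡ 60 * ((9 + t) + 1)
    e₄ = solve-∀
    c₁ : ∀ k → 8 ≤ k → 50 * (suc k + 3) ≤ 60 * (suc k + 1)
    c₁ k 8≤k = subst (λ k → 50 * (suc k + 3) ≤ 60 * (suc k + 1)) (m+[n∸m]≡n 8≤k)
      (≤-trans (m≤m+n _ (10 * (k ∸ 8))) (≤-reflexive (e₄ (k ∸ 8))))
    e₅ : ∀ p k x → 9 * p * (3 * k * x) ≡ 27 * p * k * x
    e₅ = solve-∀
    e₆ : ∀ p x → 27 * p * 8 * x ≡ 216 * p * x
    e₆ = solve-∀
    -- The factor 9 suffices because 9 · 3k ≥ 216 ≥ 200 for k ≥ 8.
    tail : 200 * p * (Q * B) ≤ 9 * p * (n * T)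
    tail = begin
      200 * p * (Q * B)           ≤⟨ *-monoˡ-≤ (Q * B) (*-monoˡ-≤ p (m≤m+n 200 16)) ⟩
      216 * p * (Q * B)           ≡⟨ e₆ p (Q * B) ⟨
      27 * p * 8 * (Q * B)        ≤⟨ *-monoˡ-≤ (Q * B) (*-monoʳ-≤ (27 * p) 8≤k) ⟩
      27 * p * k * (Q * B)        ≡⟨ e₅ p k (Q * B) ⟨
      9 * p * (3 * k * (Q * B))   ≡⟨ cong (9 * p *_) (*-assoc (3 * k) Q B) ⟨
      9 * p * (3 * k * Q * B)     ≤⟨ *-monoʳ-≤ (9 * p) B≤ ⟩
      9 * p * (n * T)             ∎

-- The union bound over the divisors of n

open import Data.Nat using (_+_; _*_; >-nonZero)
open ℕₚ
open ℕ∣ using (_∣_; _∣?_; divides)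
open ≡ using (refl; sym; trans; cong; cong₂; subst)
open Arithmetic

≤-stable : ∀ {a b} → ¬ ¬ (a ≤ b) → a ≤ b
≤-stable {a} {b} = decidable-stable (a ≤? b)

module CompletelyNormalCount {c ℓ : Level} (R : CommutativeRing c ℓ) (isField : IsFieldCR R)
  (_≟_ : Decidable (CommutativeRing._≈_ R)) {p : Level} {K : CommutativeRing.Carrier R → Set p} (isSubfield : IsSubfield R K)
  (q n : ℕ) (8≤q : 8 ≤ q) (1≤n : 1 ≤ n) (sizeK : HasSize R K q) (sizeL : HasSize R (λ _ → ⊤) (q ^ n)) where
  open CommutativeRing R using (Carrier; setoid)
  open Counting setoid _≟_
  open Data.List.Relation.Unary.Unique.Setoid setoid using (Unique)
  open Data.List.Membership.Setoid setoid using (_∈_)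

  private
    k = q ∸ 1

    7≤k : 7 ≤ k
    7≤k = ∸-monoˡ-≤ 1 8≤q

    2≤q : 2 ≤ q
    2≤q = ≤-trans (m≤m+n 2 6) 8≤q

    1+k≡q : suc k ≡ q
    1+k≡q = m+[n∸m]≡n (≤-trans (m≤m+n 1 7) 8≤q)

  private
    1≤q^n : 1 ≤ q ^ n
    1≤q^n = m^n>0 q ⦃ >-nonZero (≤-trans (s≤s z≤n) 2≤q) ⦄ n

    many : ¬ ¬ ManyNormal R q n
    many = FiniteExtension.Sieve.many-normal R isField _≟_ isSubfield {q} {n} 2≤q sizeK sizeL 1≤n

    few : ∀ l m → 1 ≤ l → l * m ≡ n → ¬ ¬ FewAbnormal R q n l m
    few l m 1≤l = FiniteExtension.few-abnormal R isField _≟_ isSubfield {q} {n} 2≤q sizeK sizeL l m 1≤l 1≤n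

  private
    -- The invariant of `geometric-step` with E = n q ^ n, for exceptions with 3 ≤ l ≤ 2 + j. The
    -- range starts at 3 since l = 1 is sieved and l = 2 is charged separately, when n is even.
    AbnormalUpTo : ℕ → Set (c ⊔ ℓ)
    AbnormalUpTo j = ∃ λ bs → (3 * k * q ^ (2 + j) * length bs + n * q ^ n ≤ n * q ^ n * q ^ j) ×
      (∀ l m → 3 ≤ l → l ≤ 2 + j → l * m ≡ n → NormalOutside R q n l m bs)

    skip : ∀ j → ¬ (3 + j ∣ n) → AbnormalUpTo j → AbnormalUpTo (suc j)
    skip j 3+j∤n (bs , le , normal) = bs ,
      subst (λ b → 3 * k * (q * q ^ (2 + j)) * b + n * q ^ n ≤ n * q ^ n * (q * q ^ j)) (+-identityʳ (length bs))
        (geometric-step k (n * q ^ n) (q ^ (2 + j)) (q ^ j) (length bs) 0 1+k≡q le z≤n) ,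
      λ l m 3≤l l≤ l*m≡n → case l m 3≤l l*m≡n (m≤n⇒m<n∨m≡n l≤)
      where
      case : ∀ l m → 3 ≤ l → l * m ≡ n → l < 3 + j ⊎ l ≡ 3 + j → NormalOutside R q n l m bs
      case l m 3≤l l*m≡n (inj₁ (s≤s l≤)) = normal l m 3≤l l≤ l*m≡n
      case l m 3≤l l*m≡n (inj₂ refl)     = contradiction (divides m (trans (sym l*m≡n) (*-comm l m))) 3+j∤n

    extend : ∀ j m → (3 + j) * m ≡ n → AbnormalUpTo j →
      FewAbnormal R q n (3 + j) m → AbnormalUpTo (suc j)
    extend j m eq (bs , le , normal) (cs , le′ , normal′) = bs ++ cs ,
      subst (λ b → 3 * k * (q * q ^ (2 + j)) * b + n * q ^ n ≤ n * q ^ n * (q * q ^ j)) (sym (length-++ bs))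
        (geometric-step k (n * q ^ n) (q ^ (2 + j)) (q ^ j) (length bs) (length cs) 1+k≡q le new) ,
      λ l m′ 3≤l l≤ l*m≡n → case l m′ 3≤l l*m≡n (m≤n⇒m<n∨m≡n l≤)
      where
      -- 3m ≤ (3 + j) m = n. Replacing n/l by n/3 for every l is what makes the sum over l
      -- geometric.
      new : 3 * (length cs * q ^ (3 + j)) ≤ n * q ^ n
      new = ≤-trans (*-monoʳ-≤ 3 le′) (≤-trans (≤-reflexive (sym (*-assoc 3 m (q ^ n))))
        (*-monoˡ-≤ (q ^ n) (≤-trans (*-monoˡ-≤ m (m≤m+n 3 j)) (≤-reflexive eq))))
      case : ∀ l m′ → 3 ≤ l → l * m′ ≡ n → l < 3 + j ⊎ l ≡ 3 + j → NormalOutside R q n l m′ (bs ++ cs)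
      case l m′ 3≤l l*m≡n (inj₁ (s≤s l≤)) x x∉ = normal l m′ 3≤l l≤ l*m≡n x (λ x∈ → x∉ (Anyₚ.++⁺ˡ x∈))
      case l m′ 3≤l l*m≡n (inj₂ refl)     x x∉ = subst (λ m → NormalOver R q (3 + j) m x)
        (*-cancelˡ-≡ m m′ (3 + j) (trans eq (sym l*m≡n))) (normal′ x (λ x∈ → x∉ (Anyₚ.++⁺ʳ bs x∈)))

    abnormal-up-to : ∀ j → ¬ ¬ AbnormalUpTo j
    abnormal-up-to zero    cont = cont ([] , ≤-reflexive (trans (cong (_+ n * q ^ n) (*-zeroʳ (3 * k * q ^ 2))) (sym (*-identityʳ (n * q ^ n)))) ,
      λ l m 3≤l l≤2 _ → contradiction (≤-trans 3≤l l≤2) 1+n≰n)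
    abnormal-up-to (suc j) cont = abnormal-up-to j λ old → case old (3 + j ∣? n)
      where
      case : AbnormalUpTo j → Dec (3 + j ∣ n) → ⊥
      case old (no 3+j∤n)        = cont (skip j 3+j∤n old)
      case old (yes (divides m eq)) = few (3 + j) m (s≤s z≤n) eq′ λ new → cont (extend j m eq′ old new)
        where
        eq′ : (3 + j) * m ≡ n
        eq′ = trans (*-comm (3 + j) m) (sym eq)

  FewAbove2 : Set (c ⊔ ℓ)
  FewAbove2 = ∃ λ bs → 3 * k * q ^ 2 * length bs ≤ n * q ^ n × (∀ l m → 3 ≤ l → l * m ≡ n → NormalOutside R q n l m bs)

  -- All divisors of n are at most n, so j = n reaches every one; the summand `n * q ^ n` on the
  -- left is dropped and the common q ^ n cancelled.
  few-abnormal-above-2 : ¬ ¬ FewAbove2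
  few-abnormal-above-2 cont = abnormal-up-to n λ (bs , le , normal) → cont (bs ,
    *-cancelʳ-≤ _ _ (q ^ n) ⦃ >-nonZero 1≤q^n ⦄ (≤-trans (≤-trans (≤-reflexive (regroup (3 * k) (q ^ 2) (q ^ n) (length bs)))
      (≤-trans (≤-reflexive (cong (λ z → 3 * k * z * length bs) (sym (^-distribˡ-+-* q 2 n)))) (m≤m+n _ (n * q ^ n)))) le) ,
    λ l m 3≤l l*m≡n → normal l m 3≤l (≤-trans (l≤n l m l*m≡n) (m≤n+m n 2)) l*m≡n)
    where
    regroup : ∀ a x y b → a * x * b * y ≡ a * (x * y) * b
    regroup = solve-∀
    l≤n : ∀ l m → l * m ≡ n → l ≤ n
    l≤n l zero    eq = contradiction (subst (1 ≤_) (trans (sym eq) (*-zeroʳ l)) 1≤n) λ ()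
    l≤n l (suc m) eq = ≤-trans (m≤m*n l (suc m)) (≤-reflexive eq)

  module _ {CN : ℕ} (sizeCN : HasSize R (CompletelyNormal R q n) CN) where

    -- Outside both lists of exceptions an element normal over the base field is completely normal,
    -- so `gs` lies in the union of three lists; l = 0 cannot occur because n ≥ 1.
    normal-count : ∀ {gs bs cs} → Unique gs → All (NormalOver R q 1 n) gs →
      (∀ m → 2 * m ≡ n → NormalOutside R q n 2 m bs) → (∀ l m → 3 ≤ l → l * m ≡ n → NormalOutside R q n l m cs) →
      length gs ≤ CN + (length bs + length cs)
    normal-count {gs} {bs} {cs} gs! normal₁ normal₂ normal₃ = ≤-trans (Unique-⊆⇒length≤ gs! included)
      (≤-reflexive (trans (length-++ (proj₁ sizeCN)) (cong₂ _+_ (proj₁ (proj₂ sizeCN)) (length-++ bs))))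
      where
      completely : ∀ x → NormalOver R q 1 n x → ¬ (x ∈ bs) → ¬ (x ∈ cs) → CompletelyNormal R q n x
      completely x nx x∉bs x∉cs zero m eq = contradiction (subst (1 ≤_) (sym eq) 1≤n) λ ()
      completely x nx x∉bs x∉cs (suc zero) m eq = subst (λ m → NormalOver R q 1 m x) (trans (sym eq) (*-identityˡ m)) nx
      completely x nx x∉bs x∉cs (suc (suc zero)) m eq = normal₂ m eq x x∉bs
      completely x nx x∉bs x∉cs l@(suc (suc (suc _))) m eq = normal₃ l m (s≤s (s≤s (s≤s z≤n))) eq x x∉cs
      place : ∀ x → NormalOver R q 1 n x → Dec (x ∈ bs) → Dec (x ∈ cs) → x ∈ proj₁ sizeCN ++ (bs ++ cs)
      place x nx (yes x∈bs) _          = Anyₚ.++⁺ʳ (proj₁ sizeCN) (Anyₚ.++⁺ˡ x∈bs)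
      place x nx (no _)     (yes x∈cs) = Anyₚ.++⁺ʳ (proj₁ sizeCN) (Anyₚ.++⁺ʳ bs x∈cs)
      place x nx (no x∉bs)  (no x∉cs)  = Anyₚ.++⁺ˡ (proj₂ (proj₂ (proj₂ (proj₂ sizeCN))) x (completely x nx x∉bs x∉cs))
      included : ∀ {x} → x ∈ gs → x ∈ proj₁ sizeCN ++ (bs ++ cs)
      included x∈ = All.lookupWith (λ {y} ny x≈y → ∈ₚ.∈-resp-≈ setoid (CommutativeRing.sym R x≈y) (place y ny (y ∈? bs) (y ∈? cs))) normal₁ x∈

    private
      conclude-odd : ¬ (2 ∣ n) → ManyNormal R q n → FewAbove2 →
        200 * (q ^ n * q ^ 2) ≤ CN * (100 * q ^ 2 * (q + 1)) + 145 * n * q ^ n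
      conclude-odd 2∤n (gs , gs! , normal₁ , s , g , r , g≤ , 2r≤n , dense , sieve) (cs , cs≤ , normal₃) =
        assemble-odd k n r s (length gs) (q ^ n) (length cs) CN 1+k≡q 7≤k 2r≤n sieve
          (ratio-transfer k g 2 (q + 1) 1+k≡q (power-bound₁ k g 1+k≡q 7≤k (≤-trans g≤ (gcd≤ʳ n k (≤-trans (s≤s z≤n) 7≤k)))) dense)
          -- For odd n the case l = 2 does not arise, so its list of exceptions is empty.
          (normal-count {bs = []} gs! normal₁ (λ m eq → contradiction (divides m (trans (sym eq) (*-comm 2 m))) 2∤n) normal₃) cs≤

      conclude-even : ∀ m → 2 * m ≡ n → 8 ≤ k → ¬ (k ∣ n) → ManyNormal R q n → FewAbove2 → FewAbnormal R q n 2 m →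
        q ^ n * (100 * q ^ 2 * (q + 1) + 200 * q ^ 2) ≤ CN * (200 * q ^ 2 * (q + 1)) + 172 * n * (q + 1) * q ^ n
      conclude-even m 2*m≡n 8≤k k∤n (gs , gs! , normal₁ , s , g , r , g≤ , 2r≤n , dense , sieve) (cs , cs≤ , normal₃) (bs , bs≤ , normal₂) =
        assemble-even k n r s (length gs) (q ^ n) (length cs) (length bs) CN 1+k≡q 8≤k 2r≤n sieve
          (ratio-transfer k g (q + 3) (2 * (q + 1)) 1+k≡q (power-bound₂ k g 1+k≡q 8≤k
            (≤-trans (*-monoʳ-≤ 2 g≤) (2gcd≤ n k (≤-trans (s≤s z≤n) 8≤k) k∤n))) dense)
          (normal-count gs! normal₁ (λ m′ eq x x∉ → subst (λ m → NormalOver R q 2 m x) (*-cancelˡ-≡ m m′ 2 (trans 2*m≡n (sym eq))) (normal₂ x x∉)) normal₃)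
          cs≤
          (≤-trans (*-monoʳ-≤ 2 bs≤) (≤-reflexive (trans (sym (*-assoc 2 m (q ^ n))) (cong (_* q ^ n) 2*m≡n))))

    -- The bound of part (1) multiplied by 100 q² (q + 1), with the subtracted term moved to the
    -- right.
    bound-odd : ¬ (2 ∣ n) → 200 * q ^ (n + 2) ≤ CN * (100 * q ^ 2 * (q + 1)) + 145 * n * q ^ n
    bound-odd 2∤n = ≤-trans (≤-reflexive (cong (200 *_) (^-distribˡ-+-* q n 2)))
      (≤-stable λ cont → many λ dense → few-abnormal-above-2 λ above → cont (conclude-odd 2∤n dense above))

    -- The bound of part (2) multiplied by 200 q² (q + 1), with the subtracted term moved to the
    -- right.
    bound-even : 2 ∣ n → 8 ≤ k → ¬ (k ∣ n) →
      q ^ n * (100 * q ^ 2 * (q + 1) + 200 * q ^ 2) ≤ CN * (200 * q ^ 2 * (q + 1)) + 172 * n * (q + 1) * q ^ n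
    bound-even (divides m n≡m*2) 8≤k k∤n = ≤-stable λ cont → many λ dense → few-abnormal-above-2 λ above →
      few 2 m (s≤s z≤n) 2*m≡n λ few₂ → cont (conclude-even m 2*m≡n 8≤k k∤n dense above few₂)
      where
      2*m≡n : 2 * m ≡ n
      2*m≡n = trans (*-comm 2 m) (sym n≡m*2)

theorem5 : {c ℓ : Level} (L : CommutativeRing c ℓ) →
    IsFieldCR L →
    Decidable (CommutativeRing._≈_ L) →
    (K : CommutativeRing.Carrier L → Set ℓ) → IsSubfield L K →
    (q n : ℕ) → 1 ≤ n →
    HasSize L K q →
    HasSize L (λ _ → ⊤) (q ^ n) →
    (CN : ℕ) → HasSize L (CompletelyNormal L q n) CN →
    ((¬ (2 ∣ n) → 8 ≤ q →
    200 * q ^ (n + 2) ≤ CN * (100 * q ^ 2 * (q + 1)) + 145 * n * q ^ n)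
    × (2 ∣ n → 9 ≤ q → ¬ ((q ∸ 1) ∣ n) →
    q ^ n * (100 * q ^ 2 * (q + 1) + 200 * q ^ 2)
    ≤ CN * (200 * q ^ 2 * (q + 1)) + 172 * n * (q + 1) * q ^ n))
theorem5 L isField _≟_ K isSubfield q n 1≤n sizeK sizeL CN sizeCN =
  (λ 2∤n 8≤q → CompletelyNormalCount.bound-odd L isField _≟_ isSubfield q n 8≤q 1≤n sizeK sizeL sizeCN 2∤n) ,
  λ 2∣n 9≤q → CompletelyNormalCount.bound-even L isField _≟_ isSubfield q n (≤-trans (m≤n+m 8 1) 9≤q) 1≤n sizeK sizeL sizeCN 2∣n (∸-monoˡ-≤ 1 9≤q)
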